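{- Let $R(z,q)$ and $C(z,q)$ be the rank and crank generating functions, $R^{*}(z,q)=R(z,q)/(1-z)$, $C^{*}(z,q)=C(z,q)/(1-z)$, $\delta_z=z\frac{\partial}{\partial z}$, $\delta_q=q\frac{\partial}{\partial q}$, and $(q)_\infty=\prod_{n\ge1}(1-q^n)$. Then $$z\,(q)_\infty^2\,\left[C^{*}(z,q)\right]^3=\left(3\delta_q+\tfrac12\delta_z+\tfrac12\delta_z^2\right)R^{*}(z,q),$$ and $$z\,(q)_\infty^2\,\left[C(z,q)\right]^3=\left(3(1-z)^2\delta_q+\tfrac12(1-z)^2\delta_z^2-\tfrac12(z^2-1)\delta_z+z\right)R(z,q).$$
   Context: The rank of a partition is its largest part minus its number of parts. $N(m,n)$ is the number of partitions of $n$ with rank $m$; $N(0,0)=1$ and $N(m,0)=0$ for $m\ne0$. The crank of a partition is its largest part if the partition contains no ones; otherwise it is (the number of parts larger than the number of ones) minus (the number of ones). For $n\ge2$, $M(m,n)$ is the number of partitions of $n$ with crank $m$. By convention $M(0,0)=1$ and $M(m,0)=0$ for $m\neq0$; and $M(0,1)=-1$, $M(-1,1)=M(1,1)=1$, $M(m,1)=0$ otherwise. The generating functions are $$R(z,q)=\sum_{n\ge0}\sum_m N(m,n)z^mq^n=1+\sum_{n\ge1}\frac{q^{n^2}}{(zq)_n(z^{ -1}q)_n},\qquad C(z,q)=\sum_{n\ge0}\sum_m M(m,n)z^mq^n=\prod_{n\ge1}\frac{1-q^n}{(1-zq^n)(1-z^{ -1}q^n)},$$ where $(a)_n=(1-a)(1-aq)\cdots(1-aq^{n-1})$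 (these second equalities are known). Here $|q|<1$; the identities may be read as identities of formal power series in $q$ whose coefficients are rational functions of $z$. -}

module Defs where

open import Algebra.Bundles.Raw using (RawRing)
open import Data.Empty using (⊥-elim)
open import Data.Fin.Base using (Fin; toℕ)
open import Data.Integer.Base as ℤ using (ℤ; +_; -[1+_]; _⊖_)
import Data.Integer.Properties as ℤ
open import Data.List.Base
  using (List; []; _∷_; _++_; map; concatMap; foldr; length; filter; replicate; upTo)
open import Data.Nat.Base as ℕ using (ℕ; zero; suc; _∸_; _⊔_; _/_)
import Data.Nat.Properties as ℕ
open import Data.Product.Base using (∃; _,_)
open import Data.Sum.Base using ([_,_]′)
open import Level using (0ℓ)
open import Relation.Binary.PropositionalEquality
open import Relation.Nullary using (yes; no)
import Algebra.Definitions.RawSemiring as RawSemiringDefs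

------------------------------------------------------------------------
-- Partitions, rank and crank

-- The partitions of n with all parts ≤ k, each listed once in weakly
-- decreasing order; j is the multiplicity of the part suc k.
partitions≤ : ℕ → ℕ → List (List ℕ)
partitions≤ zero    zero    = [] ∷ []
partitions≤ zero    (suc n) = []
partitions≤ (suc k) n       =
  concatMap (λ j → map (replicate j (suc k) ++_) (partitions≤ k (n ∸ j ℕ.* suc k)))
            (upTo (suc (n / suc k)))

partitions : ℕ → List (List ℕ)
partitions n = partitions≤ n n

largest : List ℕ → ℕ
largest = foldr _⊔_ 0

rank : List ℕ → ℤ
rank xs = + largest xs ℤ.- + length xs

crank : List ℕ → ℤ
crank xs = go (length (filter (ℕ._≟ 1) xs))
  where
  go : ℕ → ℤ
  go zero      = + largest xs
  go ω@(suc _) = + length (filter (ω ℕ.<?_) xs) ℤ.- + ω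

N : ℤ → ℕ → ℤ
N m n = + length (filter (λ xs → rank xs ℤ.≟ m) (partitions n))

M : ℤ → ℕ → ℤ
M (+ 0)         0 = ℤ.1ℤ
M _             0 = ℤ.0ℤ
M (+ 0)         1 = ℤ.-1ℤ
M (+ 1)         1 = ℤ.1ℤ
M -[1+ 0 ]      1 = ℤ.1ℤ
M _             1 = ℤ.0ℤ
M m n@(suc (suc _)) = + length (filter (λ xs → crank xs ℤ.≟ m) (partitions n))

------------------------------------------------------------------------
-- ℤ[z]: lists of coefficients, constant term first, compared up to
-- trailing zeros

module Polynomial where

  Poly : Set
  Poly = List ℤ

  coeff : Poly → ℕ → ℤ
  coeff []      _       = ℤ.0ℤ
  coeff (a ∷ p) zero    = a
  coeff (a ∷ p) (suc k) = coeff p k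

  infix  4 _≈_
  infixl 6 _+_
  infixl 7 _*_
  infix  8 -_

  _≈_ : Poly → Poly → Set
  p ≈ r = ∀ k → coeff p k ≡ coeff r k

  _+_ : Poly → Poly → Poly
  []      + r       = r
  (a ∷ p) + []      = a ∷ p
  (a ∷ p) + (b ∷ r) = (a ℤ.+ b) ∷ (p + r)

  -_ : Poly → Poly
  - p = map (λ a → ℤ.- a) p

  _*_ : Poly → Poly → Poly
  []      * r = []
  (a ∷ p) * r = map (a ℤ.*_) r + (ℤ.0ℤ ∷ p * r)

  -- (a + z p)′ = p + z p′
  deriv : Poly → Poly
  deriv []      = []
  deriv (a ∷ p) = p + (ℤ.0ℤ ∷ deriv p)

  NonZero : Poly → Set
  NonZero p = ∃ λ k → coeff p k ≢ ℤ.0ℤ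

  coeff-+ : ∀ p r k → coeff (p + r) k ≡ coeff p k ℤ.+ coeff r k
  coeff-+ []      r       k       = sym (ℤ.+-identityˡ _)
  coeff-+ (a ∷ p) []      k       = sym (ℤ.+-identityʳ _)
  coeff-+ (a ∷ p) (b ∷ r) zero    = refl
  coeff-+ (a ∷ p) (b ∷ r) (suc k) = coeff-+ p r k

  coeff-map : ∀ a p k → coeff (map (a ℤ.*_) p) k ≡ a ℤ.* coeff p k
  coeff-map a []      k       = sym (ℤ.*-zeroʳ a)
  coeff-map a (b ∷ p) zero    = refl
  coeff-map a (b ∷ p) (suc k) = coeff-map a p k

  coeff-∷* : ∀ a p r k →
    coeff ((a ∷ p) * r) k ≡ a ℤ.* coeff r k ℤ.+ coeff (ℤ.0ℤ ∷ p * r) k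
  coeff-∷* a p r k =
    trans (coeff-+ (map (a ℤ.*_) r) _ k) (cong (ℤ._+ _) (coeff-map a r k))

  coeff-*0∷ : ∀ p r k → coeff (p * (ℤ.0ℤ ∷ r)) k ≡ coeff (ℤ.0ℤ ∷ p * r) k
  coeff-*0∷ []      r zero    = refl
  coeff-*0∷ []      r (suc k) = refl
  coeff-*0∷ (a ∷ p) r zero    =
    trans (ℤ.+-identityʳ _) (ℤ.*-zeroʳ a)
  coeff-*0∷ (a ∷ p) r (suc k) = begin
    coeff ((a ∷ p) * (ℤ.0ℤ ∷ r)) (suc k)                ≡⟨ coeff-∷* a p (ℤ.0ℤ ∷ r) (suc k) ⟩
    a ℤ.* coeff r k ℤ.+ coeff (p * (ℤ.0ℤ ∷ r)) k        ≡⟨ cong (λ c → a ℤ.* coeff r k ℤ.+ c) (coeff-*0∷ p r k) ⟩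
    a ℤ.* coeff r k ℤ.+ coeff (ℤ.0ℤ ∷ p * r) k          ≡⟨ coeff-∷* a p r k ⟨
    coeff ((a ∷ p) * r) k                               ∎
    where open ≡-Reasoning

  nonZero-* : ∀ {p r} → NonZero p → NonZero r → NonZero (p * r)
  nonZero-* {[]}    (_ , p≢0) _ = ⊥-elim (p≢0 refl)
  nonZero-* {a ∷ p} {r} p≢0 r≢0 with a ℤ.≟ ℤ.0ℤ
  nonZero-* {a ∷ p} {r} (zero  , a≢0) r≢0 | yes a≡0 = ⊥-elim (a≢0 a≡0)
  nonZero-* {a ∷ p} {r} (suc i , p≢0) r≢0 | yes refl with nonZero-* {p} {r} (i , p≢0) r≢0
  ... | k , pr≢0 = suc k , λ eq → pr≢0
        (trans (sym (trans (coeff-∷* ℤ.0ℤ p r (suc k)) (ℤ.+-identityˡ _))) eq)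
  nonZero-* {a ∷ p} {r} _ r≢0 | no a≢0 = go r r≢0
    where
    go : ∀ r → NonZero r → NonZero ((a ∷ p) * r)
    go []      (_ , r≢0) = ⊥-elim (r≢0 refl)
    go (b ∷ r) r≢0 with b ℤ.≟ ℤ.0ℤ
    go (b ∷ r) _             | no b≢0 = zero , λ eq →
      [ a≢0 , b≢0 ]′ (ℤ.i*j≡0⇒i≡0∨j≡0 a (trans (sym (ℤ.+-identityʳ _)) eq))
    go (b ∷ r) (zero  , b≢0) | yes b≡0  = ⊥-elim (b≢0 b≡0)
    go (b ∷ r) (suc i , r≢0) | yes refl with go r (i , r≢0)
    ... | k , ar≢0 = suc k , λ eq → ar≢0 (trans (sym (coeff-*0∷ (a ∷ p) r (suc k))) eq)

------------------------------------------------------------------------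
-- ℚ(z), as the field of fractions of ℤ[z]

module RationalFunction where

  open Polynomial using (Poly; NonZero; nonZero-*; deriv)
  private module P = Polynomial

  record RatFun : Set where
    constructor frac
    field
      num   : Poly
      den   : Poly
      den≢0 : NonZero den

  open RatFun public

  infix  4 _≃_
  infixl 6 _+_
  infixl 7 _*_
  infix  8 -_

  data _≃_ (f g : RatFun) : Set where
    *≡* : num f P.* den g P.≈ num g P.* den f → f ≃ g

  _+_ : RatFun → RatFun → RatFun
  f + g = frac (num f P.* den g P.+ num g P.* den f) (den f P.* den g)
               (nonZero-* {den f} {den g} (den≢0 f) (den≢0 g))

  _*_ : RatFun → RatFun → RatFun
  f * g = frac (num f P.* num g) (den f P.* den g)
               (nonZero-* {den f} {den g} (den≢0 f) (den≢0 g))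

  -_ : RatFun → RatFun
  - f = frac (P.- num f) (den f) (den≢0 f)

  poly : Poly → RatFun
  poly p = frac p (ℤ.1ℤ ∷ []) (0 , λ ())

  const : ℤ → RatFun
  const a = poly (a ∷ [])

  rawRing : RawRing 0ℓ 0ℓ
  rawRing = record
    { Carrier = RatFun ; _≈_ = _≃_ ; _+_ = _+_ ; _*_ = _*_ ; -_ = -_
    ; 0# = const ℤ.0ℤ ; 1# = const ℤ.1ℤ }

  open RawSemiringDefs (RawRing.rawSemiring rawRing) public using (sum; _^_)

  Z : RatFun
  Z = poly (ℤ.0ℤ ∷ ℤ.1ℤ ∷ [])

  Z⁻¹ : RatFun
  Z⁻¹ = frac (ℤ.1ℤ ∷ []) (ℤ.0ℤ ∷ ℤ.1ℤ ∷ []) (1 , λ ())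

  half : RatFun
  half = frac (ℤ.1ℤ ∷ []) (+ 2 ∷ []) (0 , λ ())

  [1-Z]⁻¹ : RatFun
  [1-Z]⁻¹ = frac (ℤ.1ℤ ∷ []) (ℤ.1ℤ ∷ ℤ.-1ℤ ∷ []) (0 , λ ())

  Z^_ : ℤ → RatFun
  Z^ (+ k)    = Z ^ k
  Z^ -[1+ k ] = Z⁻¹ ^ suc k

  d/dZ : RatFun → RatFun
  d/dZ f = frac (deriv (num f) P.* den f P.+ P.- (num f P.* deriv (den f))) (den f P.* den f)
                (nonZero-* {den f} {den f} (den≢0 f) (den≢0 f))

------------------------------------------------------------------------
-- ℚ(z)[[q]]: f n is the coefficient of qⁿ

private module F = RationalFunction
open RationalFunction using (RatFun)

Series : Set
Series = ℕ → RatFun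

infix  4 _≈_
infixl 6 _+_ _-_
infixl 7 _*_
infix  8 -_

_≈_ : Series → Series → Set
f ≈ g = ∀ n → f n F.≃ g n

_+_ : Series → Series → Series
(f + g) n = f n F.+ g n

-_ : Series → Series
(- f) n = F.- f n

_-_ : Series → Series → Series
f - g = f + - g

_*_ : Series → Series → Series
(f * g) n = F.sum {suc n} λ i → f (toℕ i) F.* g (n ∸ toℕ i)

constant : RatFun → Series
constant c zero    = c
constant c (suc _) = F.const ℤ.0ℤ

𝟎 𝟏 𝟑 ½ z q : Series
𝟎 = constant (F.const ℤ.0ℤ)
𝟏 = constant (F.const ℤ.1ℤ)
𝟑 = constant (F.const (+ 3))
½ = constant F.half
z = constant F.Z
q 1 = F.const ℤ.1ℤ
q _ = F.const ℤ.0ℤ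

seriesRawRing : RawRing 0ℓ 0ℓ
seriesRawRing = record
  { Carrier = Series ; _≈_ = _≈_ ; _+_ = _+_ ; _*_ = _*_ ; -_ = -_ ; 0# = 𝟎 ; 1# = 𝟏 }

open RawSemiringDefs (RawRing.rawSemiring seriesRawRing) public using (product; _^_)

δz : Series → Series
δz f n = F.Z F.* F.d/dZ (f n)

δq : Series → Series
δq f n = F.const (+ n) F.* f n

-- Factors 1 - qᵏ with k > n do not affect the coefficient of qⁿ.
[q]∞ : Series
[q]∞ n = product {n} (λ i → 𝟏 - q ^ suc (toℕ i)) n

-- ∑ₘ a(m) zᵐ over -n ≤ m ≤ n.  Both N(m,n) and M(m,n) vanish for |m| > n.
laurent : (ℤ → ℤ) → ℕ → RatFun
laurent a n = F.sum {suc (2 ℕ.* n)} λ i →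
  let m = toℕ i ⊖ n in F.const (a m) F.* (F.Z^ m)

R C R* C* : Series
R n = laurent (λ m → N m n) n
C n = laurent (λ m → M m n) n
R* = constant F.[1-Z]⁻¹ * R
C* = constant F.[1-Z]⁻¹ * C

{-# OPTIONS --safe #-}
module Submission where

-- Write L k and W k for the generating functions in q of the partitions of rank
-- ≤ k and of crank ≤ k, k ∈ ℤ: the coefficients of zᵏ in R* and C* for |z| < 1.  The
-- proof compares Laurent coefficients, with θ = ∑ₛ (-1)ˢ zˢ q^(s(s-1)/2) as the
-- only theta function; neither the product for C nor the q-series for R is needed.
--
-- Counting partitions in boxes by their largest part and, transposed, by their
-- number of parts gives L k + q^(k+2) L (k+3) = P (Dyson) up to two monomials, where
-- P = ∑ p(n) qⁿ; a computation with ∑ q^(ab+a) / (q)ₐ(q)_b over b - a = k gives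
-- W k + q^(k+1) W (k+1) = P.  The factor 6n + k² + k, which is twice the operator
-- 3 δq + ½ δz + ½ δz², is invariant under (k , n) ↦ (k + 3 , n - k - 2) and kills the
-- two monomials, so h = (6n + k² + k) L satisfies a recurrence of the same shape.
--
-- Multiplication by θ turns a recurrence with shift (d , e) into one with shift
-- (d - 1 , e - 1) and lowers the degree in k of the inhomogeneous term.  Hence
-- F = θ³ h satisfies F k = q^(k-1) F k and θ W satisfies (θ W) k = qᵏ (θ W) k: the
-- first is supported at k = 1 and the second at k = 0.  So θ C = (1 - z) Q and
-- θ³ · 2HR = (1 - z)³ z F₁ with Q and F₁ free of z, where HR is the right-hand side
-- of the second identity; therefore Q³ · 2HR = z F₁ C³.  Evaluation at z = 1 yields
-- 2 Q³ P = F₁ P³, and eliminating F₁ / Q³ with P (q)∞ = 1 proves the identity.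

open import Algebra.Bundles using (CommutativeRing; RawRing)
import Algebra.Morphism.RingMonomorphism as RingMonomorphism
open import Algebra.Morphism.Structures using (IsRingMonomorphism)
import Algebra.Properties.CommutativeSemigroup as CommutativeSemigroupProperties
import Algebra.Properties.Semiring.Sum as SemiringSum
import Algebra.Solver.Ring as RingSolver
open import Algebra.Solver.Ring.AlmostCommutativeRing using (_-Raw-AlmostCommutative⟶_)
  renaming (fromCommutativeRing to toAlmostCommutativeRing)
open import Algebra.Structures using (IsCommutativeRing)
open import Data.Bool.Base using (true; false; if_then_else_)
open import Data.Empty using (⊥-elim)
open import Data.Fin.Base as Fin using (Fin; toℕ)
import Data.Fin.Properties as Fin
open import Data.Integer.Base as ℤ using (ℤ; +_; -[1+_]; 0ℤ; 1ℤ; ∣_∣; _⊖_)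
import Data.Integer.Properties as ℤ
open import Data.Integer.Tactic.RingSolver using () renaming (solve-∀ to solveℤ)
open import Data.List.Base
  using (List; []; _∷_; _++_; map; concat; concatMap; length; filter; replicate; upTo; applyUpTo)
import Data.List.Properties as List
open import Data.Maybe.Base as Maybe using (Maybe; just; nothing)
open import Data.Nat.Base as ℕ using (ℕ; zero; suc; _∸_; s≤s; z≤n; _/_)
open import Data.Nat.DivMod using (m/n≡1+[m∸n]/n; m<n⇒m/n≡0)
import Data.Nat.Properties as ℕ
open import Data.Product.Base using (_,_; _×_; ∃; proj₂)
open import Data.Sum.Base using (inj₁; inj₂)
open import Data.Unit.Base using (⊤; tt)
open import Function.Base using (_∘_)
open import Level using (0ℓ)
open import Relation.Binary.PropositionalEquality as ≡ using (_≡_; _≢_; module ≡-Reasoning)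
import Relation.Binary.Reasoning.Setoid as SetoidReasoning
open import Relation.Nullary using (Dec; yes; no; does; contradiction; ¬_)
open import Relation.Unary using (Pred; Decidable)
open import Tactic.RingSolver using (solve-∀)
open import Tactic.RingSolver.Core.AlmostCommutativeRing using (AlmostCommutativeRing; fromCommutativeRing)
open import Defs
  using (partitions≤; partitions; largest; rank; crank; N; M; laurent; module Polynomial; module RationalFunction)

-- For fixed n the values of L and W tend to p(n) as k grows, so R* and C* have poles at z = 1 and
-- no Laurent polynomials represent them. Integer arrays indexed by (k , n) carry the argument
-- instead: multiplication by θ is a finite sum there, because s(s-1)/2 grows, and rational
-- functions return only after multiplication by powers of 1 - z.
--
-- The array (k , n) ↦ p(n) stands for P times the two-sided sum of all zᵏ, which 1 - z annihilates.
-- As θ has a simple zero at z = 1, it annihilates this array too, and d + 1 factors θ annihilate an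
-- inhomogeneous term of degree d in k. The crank has d = 0; the rank has d = 2, as p(n) is
-- multiplied by a quadratic in k. This is the origin of the cube of C. The same numbers of factors
-- bring the shift in k of either recurrence, 1 and 3, to 0.
--
-- By the Jacobi triple product, Q is (q)∞² and F₁ is 2 (q)∞⁸. Only the ratio F₁ / Q³ enters, and it
-- is free of z, so one value of z determines it; at z = 1 all terms of 2HR except 2zR contain a
-- vanishing factor.

-- Power series over a commutative ring

module PowerSeries
  (𝓡 : CommutativeRing 0ℓ 0ℓ)
  (constant : CommutativeRing.Carrier 𝓡 → ℕ → CommutativeRing.Carrier 𝓡)
  (constant-zero : ∀ c → CommutativeRing._≈_ 𝓡 (constant c 0) c)
  (constant-suc  : ∀ c n → CommutativeRing._≈_ 𝓡 (constant c (suc n)) (CommutativeRing.0# 𝓡))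
  where

  open CommutativeRing 𝓡 hiding (isCommutativeRing)
  open SemiringSum semiring
  open SetoidReasoning setoid

  infix  4 _≋_
  infixl 6 _⊕_
  infixl 7 _⊛_

  -- Wrapped in a record so that f and g can be inferred from a proof.
  record _≋_ (f g : ℕ → Carrier) : Set where
    constructor mk
    field
      at : ∀ n → f n ≈ g n
  open _≋_ public

  _⊕_ _⊛_ : (f g : ℕ → Carrier) → ℕ → Carrier
  (f ⊕ g) n = f n + g n
  (f ⊛ g) n = sum {suc n} λ i → f (toℕ i) * g (n ∸ toℕ i)

  ⊝_ : (ℕ → Carrier) → ℕ → Carrier
  (⊝ f) n = - f n

  tail : (ℕ → Carrier) → ℕ → Carrier
  tail f n = f (suc n)

  infix 4 _≗_
  _≗_ : (f g : ℕ → Carrier) → Set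
  f ≗ g = ∀ n → f n ≈ g n

  ⊛-cong : ∀ {f f′ g g′} → f ≗ f′ → g ≗ g′ → f ⊛ g ≗ f′ ⊛ g′
  ⊛-cong p r n = sum-cong-≋ {suc n} λ i → *-cong (p (toℕ i)) (r (n ∸ toℕ i))

  ⊛-zero : ∀ f g → (f ⊛ g) 0 ≈ f 0 * g 0
  ⊛-zero f g = +-identityʳ _

  scaleˡ : ∀ a f g n → ((λ m → a * f m) ⊛ g) n ≈ a * (f ⊛ g) n
  scaleˡ a f g n = trans
    (sum-cong-≋ {suc n} λ i → *-assoc a (f (toℕ i)) (g (n ∸ toℕ i)))
    (sym (*-distribˡ-sum {suc n} a λ i → f (toℕ i) * g (n ∸ toℕ i)))

  distribʳ-⊛ : ∀ h f g → (f ⊕ g) ⊛ h ≗ f ⊛ h ⊕ g ⊛ h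
  distribʳ-⊛ h f g n = trans
    (sum-cong-≋ {suc n} λ i → distribʳ (h (n ∸ toℕ i)) (f (toℕ i)) (g (toℕ i)))
    (∑-distrib-+ {suc n} (λ i → f (toℕ i) * h (n ∸ toℕ i)) (λ i → g (toℕ i) * h (n ∸ toℕ i)))

  -- The sum unfolds at its left factor only. Peeling the head of f, swapping and peeling the head
  -- of g reaches the product of the tails two degrees lower, hence the recursion by two with two
  -- base cases.
  ⊛-comm : ∀ f g → f ⊛ g ≗ g ⊛ f
  ⊛-comm f g zero = +-congʳ (*-comm _ _)
  ⊛-comm f g (suc zero) = begin
    f 0 * g 1 + (f 1 * g 0 + 0#)  ≈⟨ +-congˡ (+-identityʳ _) ⟩
    f 0 * g 1 + f 1 * g 0         ≈⟨ +-comm _ _ ⟩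
    f 1 * g 0 + f 0 * g 1         ≈⟨ +-cong (*-comm _ _) (*-comm _ _) ⟩
    g 0 * f 1 + g 1 * f 0         ≈⟨ +-congˡ (+-identityʳ _) ⟨
    g 0 * f 1 + (g 1 * f 0 + 0#)  ∎
  ⊛-comm f g (suc (suc n)) = begin
    f 0 * g (2+ n) + (tail f ⊛ g) (suc n)
      ≈⟨ +-congˡ (⊛-comm (tail f) g (suc n)) ⟩
    f 0 * g (2+ n) + (g 0 * f (2+ n) + (tail g ⊛ tail f) n)
      ≈⟨ +-congˡ (+-congˡ (⊛-comm (tail g) (tail f) n)) ⟩
    f 0 * g (2+ n) + (g 0 * f (2+ n) + (tail f ⊛ tail g) n)
      ≈⟨ +-assoc _ _ _ ⟨
    f 0 * g (2+ n) + g 0 * f (2+ n) + (tail f ⊛ tail g) n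
      ≈⟨ +-congʳ (+-comm _ _) ⟩
    g 0 * f (2+ n) + f 0 * g (2+ n) + (tail f ⊛ tail g) n
      ≈⟨ +-assoc _ _ _ ⟩
    g 0 * f (2+ n) + (f ⊛ tail g) (suc n)
      ≈⟨ +-congˡ (⊛-comm f (tail g) (suc n)) ⟩
    g 0 * f (2+ n) + (tail g ⊛ f) (suc n) ∎
    where
    2+_ : ℕ → ℕ
    2+ n = suc (suc n)

  ⊛-assoc : ∀ f g h → (f ⊛ g) ⊛ h ≗ f ⊛ (g ⊛ h)
  ⊛-assoc f g h zero = +-congʳ (begin
    (f 0 * g 0 + 0#) * h 0   ≈⟨ *-congʳ (+-identityʳ _) ⟩
    f 0 * g 0 * h 0          ≈⟨ *-assoc _ _ _ ⟩
    f 0 * (g 0 * h 0)        ≈⟨ *-congˡ (+-identityʳ _) ⟨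
    f 0 * (g 0 * h 0 + 0#)   ∎)
  ⊛-assoc f g h (suc n) = begin
    -- By definition `tail (f ⊛ g)` is `f 0` times `tail g` plus `tail f ⊛ g`.
    (f ⊛ g) 0 * h (suc n) + (tail (f ⊛ g) ⊛ h) n
      ≈⟨ +-cong (*-congʳ (⊛-zero f g)) (distribʳ-⊛ h (λ m → f 0 * g (suc m)) (tail f ⊛ g) n) ⟩
    f 0 * g 0 * h (suc n) + (((λ m → f 0 * g (suc m)) ⊛ h) n + ((tail f ⊛ g) ⊛ h) n)
      ≈⟨ +-cong (*-assoc _ _ _) (+-cong (scaleˡ (f 0) (tail g) h n) (⊛-assoc (tail f) g h n)) ⟩
    f 0 * (g 0 * h (suc n)) + (f 0 * (tail g ⊛ h) n + (tail f ⊛ (g ⊛ h)) n)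
      ≈⟨ +-assoc _ _ _ ⟨
    f 0 * (g 0 * h (suc n)) + f 0 * (tail g ⊛ h) n + (tail f ⊛ (g ⊛ h)) n
      ≈⟨ +-congʳ (distribˡ _ _ _) ⟨
    f 0 * (g ⊛ h) (suc n) + (tail f ⊛ (g ⊛ h)) n ∎

  constant-⊛ : ∀ c f n → (constant c ⊛ f) n ≈ c * f n
  constant-⊛ c f zero    = trans (⊛-zero (constant c) f) (*-congʳ (constant-zero c))
  constant-⊛ c f (suc n) = begin
    constant c 0 * f (suc n) + (tail (constant c) ⊛ f) n
      ≈⟨ +-cong (*-congʳ (constant-zero c))
                (⊛-cong {g = f} (λ m → trans (constant-suc c m) (sym (zeroˡ 0#))) (λ _ → refl) n) ⟩
    c * f (suc n) + ((λ _ → 0# * 0#) ⊛ f) n  ≈⟨ +-congˡ (scaleˡ 0# (λ _ → 0#) f n) ⟩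
    c * f (suc n) + 0# * ((λ _ → 0#) ⊛ f) n  ≈⟨ +-congˡ (zeroˡ _) ⟩
    c * f (suc n) + 0#                       ≈⟨ +-identityʳ _ ⟩
    c * f (suc n)                            ∎

  constant-0# : ∀ n → constant 0# n ≈ 0#
  constant-0# zero    = constant-zero 0#
  constant-0# (suc n) = constant-suc 0# n

  ⊛-identityˡ : ∀ f → constant 1# ⊛ f ≗ f
  ⊛-identityˡ f n = trans (constant-⊛ 1# f n) (*-identityˡ _)

  powerSeries-isCommutativeRing : IsCommutativeRing _≋_ _⊕_ _⊛_ ⊝_ (constant 0#) (constant 1#)
  powerSeries-isCommutativeRing = record
    { isRing = record
      { +-isAbelianGroup = record
        { isGroup = record
          { isMonoid = record
            { isSemigroup = record
              { isMagma = record
                { isEquivalence = record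
                  { refl = mk λ _ → refl ; sym = λ p → mk λ n → sym (at p n) ; trans = λ p r → mk λ n → trans (at p n) (at r n) }
                ; ∙-cong = λ p r → mk λ n → +-cong (at p n) (at r n) }
              ; assoc = λ f g h → mk λ n → +-assoc _ _ _ }
            ; identity = (λ f → mk λ n → trans (+-congʳ (constant-0# n)) (+-identityˡ _))
                       , (λ f → mk λ n → trans (+-congˡ (constant-0# n)) (+-identityʳ _)) }
          ; inverse = (λ f → mk λ n → trans (-‿inverseˡ _) (sym (constant-0# n)))
                    , (λ f → mk λ n → trans (-‿inverseʳ _) (sym (constant-0# n)))
          ; ⁻¹-cong = λ p → mk λ n → -‿cong (at p n) }
        ; comm = λ f g → mk λ n → +-comm _ _ }
      ; *-cong = λ p r → mk (⊛-cong (at p) (at r))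
      ; *-assoc = λ f g h → mk (⊛-assoc f g h)
      ; *-identity = (λ f → mk (⊛-identityˡ f)) , λ f → mk λ n → trans (⊛-comm f (constant 1#) n) (⊛-identityˡ f n)
      ; distrib = (λ h f g → mk λ n → trans (⊛-comm h (f ⊕ g) n) (trans (distribʳ-⊛ h f g n)
                    (+-cong (⊛-comm f h n) (⊛-comm g h n))))
                , λ h f g → mk (distribʳ-⊛ h f g) }
    ; *-comm = λ f g → mk (⊛-comm f g) }

-- The ring ℤ[z] and its derivation

module PolynomialRing where
  open Polynomial
  open ≡-Reasoning

  record _≋_ (p r : Poly) : Set where
    constructor mk
    field
      at : p ≈ r
  open _≋_ public

  infix 4 _≋_

  constantℤ : ℤ → ℕ → ℤ
  constantℤ c zero    = c
  constantℤ c (suc _) = 0ℤ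

  module ℤ[[z]] = PowerSeries ℤ.+-*-commutativeRing constantℤ (λ _ → ≡.refl) (λ _ _ → ≡.refl)

  rawRing : RawRing 0ℓ 0ℓ
  rawRing = record { Carrier = Poly ; _≈_ = _≋_ ; _+_ = _+_ ; _*_ = _*_ ; -_ = -_ ; 0# = [] ; 1# = 1ℤ ∷ [] }

  0⊛ : ∀ f k → ((λ _ → 0ℤ) ℤ[[z]].⊛ f) k ≡ 0ℤ
  0⊛ f k = ≡.trans (ℤ[[z]].scaleˡ 0ℤ (λ _ → 0ℤ) f k) (ℤ.*-zeroˡ ((((λ _ → 0ℤ) ℤ[[z]].⊛ f) k)))

  coeff-* : ∀ p r k → coeff (p * r) k ≡ (coeff p ℤ[[z]].⊛ coeff r) k
  coeff-* []      r k       = ≡.sym (0⊛ (coeff r) k)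
  coeff-* (a ∷ p) r zero    = coeff-∷* a p r 0
  coeff-* (a ∷ p) r (suc k) = ≡.trans (coeff-∷* a p r (suc k)) (≡.cong (ℤ._+_ (a ℤ.* coeff r (suc k))) (coeff-* p r k))

  coeff-neg : ∀ p k → coeff (- p) k ≡ ℤ.- coeff p k
  coeff-neg []      k       = ≡.refl
  coeff-neg (a ∷ p) zero    = ≡.refl
  coeff-neg (a ∷ p) (suc k) = coeff-neg p k

  -- Equality of polynomials is equality of coefficients, so the ring laws of ℤ[z] are pulled back
  -- along this map from ℤ[[z]] instead of being proved on lists.
  coeff-isRingMonomorphism : IsRingMonomorphism rawRing
    (CommutativeRing.rawRing (record { isCommutativeRing = ℤ[[z]].powerSeries-isCommutativeRing })) coeff
  coeff-isRingMonomorphism = record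
    { isRingHomomorphism = record
      { isSemiringHomomorphism = record
        { isNearSemiringHomomorphism = record
          { +-isMonoidHomomorphism = record
            { isMagmaHomomorphism = record
              { isRelHomomorphism = record { cong = λ p → ℤ[[z]].mk (at p) }
              ; homo = λ p r → ℤ[[z]].mk (coeff-+ p r) }
            ; ε-homo = ℤ[[z]].mk λ { zero → ≡.refl ; (suc k) → ≡.refl } }
          ; *-homo = λ p r → ℤ[[z]].mk (coeff-* p r) }
        ; 1#-homo = ℤ[[z]].mk λ { zero → ≡.refl ; (suc k) → ≡.refl } }
      ; -‿homo = λ p → ℤ[[z]].mk (coeff-neg p) }
    ; injective = λ p → mk (ℤ[[z]].at p) }

  ring : CommutativeRing 0ℓ 0ℓ
  ring = record
    { isCommutativeRing = RingMonomorphism.isCommutativeRing coeff-isRingMonomorphism ℤ[[z]].powerSeries-isCommutativeRing }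

  -- The ring solver needs to recognise that coefficients such as 1 - 1 vanish.
  zero? : ∀ p → Maybe ([] ≋ p)
  zero? []      = just (mk λ _ → ≡.refl)
  zero? (a ∷ p) with a ℤ.≟ 0ℤ | zero? p
  ... | yes a≡0 | just p≋0 = just (mk λ { zero → ≡.sym a≡0 ; (suc k) → at p≋0 k })
  ... | _       | _        = nothing

  almostRing : AlmostCommutativeRing 0ℓ 0ℓ
  almostRing = fromCommutativeRing ring zero?

  open CommutativeRing ring public
    using (setoid; refl; sym; trans; +-cong; *-cong; *-comm; *-congˡ; *-congʳ; +-congˡ; +-congʳ; -‿cong; zeroˡ; *-identityˡ; *-identityʳ)

  coeff-deriv : ∀ p k → coeff (deriv p) k ≡ + suc k ℤ.* coeff p (suc k)
  coeff-deriv []      k       = ≡.sym (ℤ.*-zeroʳ (+ suc k))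
  coeff-deriv (a ∷ p) zero    = begin
    coeff (p + (0ℤ ∷ deriv p)) 0   ≡⟨ coeff-+ p (0ℤ ∷ deriv p) 0 ⟩
    coeff p 0 ℤ.+ 0ℤ               ≡⟨ ℤ.+-identityʳ _ ⟩
    coeff p 0                      ≡⟨ ℤ.*-identityˡ _ ⟨
    1ℤ ℤ.* coeff p 0               ∎
  coeff-deriv (a ∷ p) (suc k) = begin
    coeff (p + (0ℤ ∷ deriv p)) (suc k)              ≡⟨ coeff-+ p (0ℤ ∷ deriv p) (suc k) ⟩
    coeff p (suc k) ℤ.+ coeff (deriv p) k           ≡⟨ ≡.cong (ℤ._+_ (coeff p (suc k))) (coeff-deriv p k) ⟩
    coeff p (suc k) ℤ.+ + suc k ℤ.* coeff p (suc k) ≡⟨ ℤ.suc-* (+ suc k) (coeff p (suc k)) ⟨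
    + suc (suc k) ℤ.* coeff p (suc k)               ∎

  deriv-cong : ∀ {p r} → p ≋ r → deriv p ≋ deriv r
  deriv-cong {p} {r} p≋r = mk λ k → begin
    coeff (deriv p) k               ≡⟨ coeff-deriv p k ⟩
    + suc k ℤ.* coeff p (suc k)     ≡⟨ ≡.cong (+ suc k ℤ.*_) (at p≋r (suc k)) ⟩
    + suc k ℤ.* coeff r (suc k)     ≡⟨ coeff-deriv r k ⟨
    coeff (deriv r) k               ∎

  deriv-+ : ∀ p r → deriv (p + r) ≋ deriv p + deriv r
  deriv-+ p r = mk λ k → begin
    coeff (deriv (p + r)) k                        ≡⟨ coeff-deriv (p + r) k ⟩
    + suc k ℤ.* coeff (p + r) (suc k)              ≡⟨ ≡.cong (+ suc k ℤ.*_) (coeff-+ p r (suc k)) ⟩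
    + suc k ℤ.* (coeff p (suc k) ℤ.+ coeff r (suc k))
      ≡⟨ ℤ.*-distribˡ-+ (+ suc k) (coeff p (suc k)) (coeff r (suc k)) ⟩
    + suc k ℤ.* coeff p (suc k) ℤ.+ + suc k ℤ.* coeff r (suc k)
      ≡⟨ ≡.cong₂ ℤ._+_ (coeff-deriv p k) (coeff-deriv r k) ⟨
    coeff (deriv p) k ℤ.+ coeff (deriv r) k        ≡⟨ coeff-+ (deriv p) (deriv r) k ⟨
    coeff (deriv p + deriv r) k                    ∎

  var : Poly
  var = 0ℤ ∷ 1ℤ ∷ []

  0∷≋var* : ∀ p → 0ℤ ∷ p ≋ var * p
  0∷≋var* p = mk λ where
    zero    → ≡.sym (≡.trans (coeff-∷* 0ℤ (1ℤ ∷ []) p 0) (ℤ.+-identityʳ _))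
    (suc k) → ≡.sym (≡.trans (coeff-∷* 0ℤ (1ℤ ∷ []) p (suc k)) (≡.trans (ℤ.+-identityˡ _) (at (*-identityˡ p) k)))

  ∷≋+0∷ : ∀ a p → a ∷ p ≋ (a ∷ []) + (0ℤ ∷ p)
  ∷≋+0∷ a p = mk λ where
    zero    → ≡.sym (ℤ.+-identityʳ a)
    (suc k) → ≡.refl

  ∷≋+var* : ∀ a p → a ∷ p ≋ (a ∷ []) + var * p
  ∷≋+var* a p = trans (∷≋+0∷ a p) (+-congˡ {a ∷ []} (0∷≋var* p))

  coeff-scale : ∀ a r k → coeff ((a ∷ []) * r) k ≡ a ℤ.* coeff r k
  coeff-scale a r k = ≡.trans (coeff-∷* a [] r k)
    (≡.trans (≡.cong (ℤ._+_ (a ℤ.* coeff r k)) (0∷[] k)) (ℤ.+-identityʳ _))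
    where
    0∷[] : ∀ k → coeff (0ℤ ∷ []) k ≡ 0ℤ
    0∷[] zero    = ≡.refl
    0∷[] (suc k) = ≡.refl

  deriv-scale : ∀ a r → deriv ((a ∷ []) * r) ≋ (a ∷ []) * deriv r
  deriv-scale a r = mk λ k → begin
    coeff (deriv ((a ∷ []) * r)) k           ≡⟨ coeff-deriv ((a ∷ []) * r) k ⟩
    + suc k ℤ.* coeff ((a ∷ []) * r) (suc k) ≡⟨ ≡.cong (+ suc k ℤ.*_) (coeff-scale a r (suc k)) ⟩
    + suc k ℤ.* (a ℤ.* coeff r (suc k))      ≡⟨ swap (+ suc k) a (coeff r (suc k)) ⟩
    a ℤ.* (+ suc k ℤ.* coeff r (suc k))      ≡⟨ ≡.cong (a ℤ.*_) (coeff-deriv r k) ⟨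
    a ℤ.* coeff (deriv r) k                  ≡⟨ coeff-scale a (deriv r) k ⟨
    coeff ((a ∷ []) * deriv r) k             ∎
    where
    swap : ∀ x y z → x ℤ.* (y ℤ.* z) ≡ y ℤ.* (x ℤ.* z)
    swap = solveℤ

  deriv-* : ∀ p r → deriv (p * r) ≋ deriv p * r + p * deriv r
  deriv-* []      r = refl
  deriv-* (a ∷ p) r = begin′
    deriv ((a ∷ p) * r)
      ≈⟨ deriv-cong (trans (*-congʳ {r} (∷≋+var* a p)) (trans (distrib A var p r) (+-congˡ {A * r} (sym (0∷≋var* (p * r)))))) ⟩
    deriv (A * r + (0ℤ ∷ p * r))
      ≈⟨ deriv-+ (A * r) (0ℤ ∷ p * r) ⟩
    deriv (A * r) + (p * r + (0ℤ ∷ deriv (p * r)))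
      ≈⟨ +-cong (deriv-scale a r) (+-congˡ {p * r} (trans (0∷≋var* (deriv (p * r))) (*-congˡ {var} (deriv-* p r)))) ⟩
    A * deriv r + (p * r + var * (deriv p * r + p * deriv r))
      ≈⟨ rearrange A var p r (deriv p) (deriv r) ⟩
    (p + var * deriv p) * r + (A + var * p) * deriv r
      ≈⟨ +-cong (*-congʳ {r} (+-congˡ {p} (0∷≋var* (deriv p)))) (*-congʳ {deriv r} (∷≋+var* a p)) ⟨
    (p + (0ℤ ∷ deriv p)) * r + (a ∷ p) * deriv r ∎′
    where
    open SetoidReasoning setoid using (step-≈-⟩; step-≈-⟨) renaming (begin_ to begin′_; _∎ to _∎′)
    A : Poly
    A = a ∷ []
    distrib : ∀ A v p r → (A + v * p) * r ≋ A * r + v * (p * r)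
    distrib = solve-∀ almostRing
    rearrange : ∀ A v p r p′ r′ → A * r′ + (p * r + v * (p′ * r + p * r′)) ≋ (p + v * p′) * r + (A + v * p) * r′
    rearrange = solve-∀ almostRing

  -- The absence of zero divisors in contrapositive form; integer coefficients have decidable
  -- equality, so no double negation remains.
  nonZero-cancelʳ : ∀ {p} r → NonZero r → p * r ≋ [] → p ≋ []
  nonZero-cancelʳ {p} r r≢0 pr≋0 = mk go
    where
    go : ∀ k → coeff p k ≡ 0ℤ
    go k with coeff p k ℤ.≟ 0ℤ
    ... | yes p≡0 = p≡0
    ... | no  p≢0 with nonZero-* {p} {r} (k , p≢0) r≢0
    ...   | i , pr≢0 = ⊥-elim (pr≢0 (at pr≋0 i))


-- The field ℚ(z) and its derivation

module RationalFunctionField where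
  open RationalFunction
  open Polynomial using (Poly; NonZero; deriv)
  private module P where
    open Polynomial public using (_+_; _*_; -_)
    open PolynomialRing public
  open P using (_≋_; mk; at)
  open SetoidReasoning P.setoid

  cross : ∀ {f g} → f ≃ g → num f P.* den g ≋ num g P.* den f
  cross (*≡* p) = mk p

  fromCross : ∀ {f g} → num f P.* den g ≋ num g P.* den f → f ≃ g
  fromCross p = *≡* (at p)

  cancel : ∀ {p r} d → NonZero d → p P.* d ≋ r P.* d → p ≋ r
  cancel {p} {r} d d≢0 pd≋rd = begin
    p                         ≈⟨ split p r ⟩
    (p P.+ P.- r) P.+ r       ≈⟨ P.+-congʳ (P.nonZero-cancelʳ d d≢0 difference) ⟩
    r                         ∎
    where
    split : ∀ p r → p ≋ (p P.+ P.- r) P.+ r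
    split = solve-∀ P.almostRing
    expand : ∀ p r d → (p P.+ P.- r) P.* d ≋ p P.* d P.+ P.- (r P.* d)
    expand = solve-∀ P.almostRing
    open CommutativeRing P.ring using (-‿inverseʳ)
    difference : (p P.+ P.- r) P.* d ≋ []
    difference = begin
      (p P.+ P.- r) P.* d          ≈⟨ expand p r d ⟩
      p P.* d P.+ P.- (r P.* d)    ≈⟨ P.+-congʳ pd≋rd ⟩
      r P.* d P.+ P.- (r P.* d)    ≈⟨ -‿inverseʳ (r P.* d) ⟩
      []                           ∎

  -- The two hypotheses give the conclusion only up to a factor `den g`, so transitivity rests on
  -- ℤ[z] being a domain.
  ≃-trans : ∀ {f g h} → f ≃ g → g ≃ h → f ≃ h
  ≃-trans {f} {g} {h} p r = fromCross (cancel (den g) (den≢0 g) (begin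
    num f P.* den h P.* den g    ≈⟨ swap (num f) (den h) (den g) ⟩
    num f P.* den g P.* den h    ≈⟨ P.*-congʳ (cross p) ⟩
    num g P.* den f P.* den h    ≈⟨ swap (num g) (den f) (den h) ⟩
    num g P.* den h P.* den f    ≈⟨ P.*-congʳ (cross r) ⟩
    num h P.* den g P.* den f    ≈⟨ swap (num h) (den g) (den f) ⟩
    num h P.* den f P.* den g    ∎))
    where
    swap : ∀ a b c → a P.* b P.* c ≋ a P.* c P.* b
    swap = solve-∀ P.almostRing

  +-cong′ : ∀ {f f′ g g′} → f ≃ f′ → g ≃ g′ → f + g ≃ f′ + g′
  +-cong′ {frac a b _} {frac a′ b′ _} {frac c d _} {frac c′ d′ _} p r = fromCross (begin
    (a P.* d P.+ c P.* b) P.* (b′ P.* d′)                ≈⟨ left a b c d b′ d′ ⟩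
    a P.* b′ P.* (d P.* d′) P.+ c P.* d′ P.* (b P.* b′)  ≈⟨ P.+-cong (P.*-congʳ (cross p)) (P.*-congʳ (cross r)) ⟩
    a′ P.* b P.* (d P.* d′) P.+ c′ P.* d P.* (b P.* b′)  ≈⟨ right a′ b c′ d b′ d′ ⟩
    (a′ P.* d′ P.+ c′ P.* b′) P.* (b P.* d)              ∎)
    where
    left : ∀ a b c d b′ d′ → (a P.* d P.+ c P.* b) P.* (b′ P.* d′) ≋ a P.* b′ P.* (d P.* d′) P.+ c P.* d′ P.* (b P.* b′)
    left = solve-∀ P.almostRing
    right : ∀ a′ b c′ d b′ d′ → a′ P.* b P.* (d P.* d′) P.+ c′ P.* d P.* (b P.* b′) ≋ (a′ P.* d′ P.+ c′ P.* b′) P.* (b P.* d)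
    right = solve-∀ P.almostRing

  *-cong′ : ∀ {f f′ g g′} → f ≃ f′ → g ≃ g′ → f * g ≃ f′ * g′
  *-cong′ {frac a b _} {frac a′ b′ _} {frac c d _} {frac c′ d′ _} p r = fromCross (begin
    a P.* c P.* (b′ P.* d′)     ≈⟨ swap a c b′ d′ ⟩
    a P.* b′ P.* (c P.* d′)     ≈⟨ P.*-cong (cross p) (cross r) ⟩
    a′ P.* b P.* (c′ P.* d)     ≈⟨ swap a′ b c′ d ⟩
    a′ P.* c′ P.* (b P.* d)     ∎)
    where
    swap : ∀ a b c d → a P.* b P.* (c P.* d) ≋ a P.* c P.* (b P.* d)
    swap = solve-∀ P.almostRing

  -‿cong′ : ∀ {f g} → f ≃ g → - f ≃ - g
  -‿cong′ {frac a b _} {frac c d _} p = fromCross (begin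
    P.- a P.* d     ≈⟨ pull a d ⟩
    P.- (a P.* d)   ≈⟨ P.-‿cong (cross p) ⟩
    P.- (c P.* b)   ≈⟨ pull c b ⟨
    P.- c P.* b     ∎)
    where
    pull : ∀ a d → P.- a P.* d ≋ P.- (a P.* d)
    pull = solve-∀ P.almostRing

  [0]≋[] : 0ℤ ∷ [] ≋ []
  [0]≋[] = mk λ { zero → ≡.refl ; (suc k) → ≡.refl }

  isCommutativeRing : IsCommutativeRing _≃_ _+_ _*_ -_ (const 0ℤ) (const 1ℤ)
  isCommutativeRing = record
    { isRing = record
      { +-isAbelianGroup = record
        { isGroup = record
          { isMonoid = record
            { isSemigroup = record
              { isMagma = record
                { isEquivalence = record
                  { refl = *≡* λ _ → ≡.refl
                  ; sym = λ p → fromCross (P.sym (cross p))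
                  ; trans = ≃-trans }
                ; ∙-cong = +-cong′ }
              ; assoc = λ { (frac a b _) (frac c d _) (frac e f _) → fromCross (assoc⁺ a b c d e f) } }
            ; identity = (λ { (frac a b _) → fromCross (begin
                  ((0ℤ ∷ []) P.* b P.+ a P.* one) P.* b  ≈⟨ P.*-congʳ {b} (P.+-cong (P.*-congʳ {b} [0]≋[]) (P.*-identityʳ a)) ⟩
                  a P.* b                                ≈⟨ P.*-congˡ {a} (P.*-identityˡ b) ⟨
                  a P.* (one P.* b)                      ∎) })
              , (λ { (frac a b _) → fromCross (begin
                  (a P.* one P.+ (0ℤ ∷ []) P.* b) P.* b  ≈⟨ P.*-congʳ (P.+-cong (P.*-identityʳ a) (P.*-congʳ {b} [0]≋[])) ⟩
                  (a P.+ []) P.* b                       ≈⟨ P.*-cong (+-identityʳ a) (P.sym (P.*-identityʳ b)) ⟩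
                  a P.* (b P.* one)                      ∎) }) }
          ; inverse = (λ { (frac a b _) → fromCross (inv (P.- a P.* b P.+ a P.* b) (b P.* b) (inverse₁ a b)) })
                    , (λ { (frac a b _) → fromCross (inv (a P.* b P.+ P.- a P.* b) (b P.* b) (inverse₂ a b)) })
          ; ⁻¹-cong = -‿cong′ }
        ; comm = λ { (frac a b _) (frac c d _) → fromCross (comm⁺ a b c d) } }
      ; *-cong = *-cong′
      ; *-assoc = λ { (frac a b _) (frac c d _) (frac e f _) → fromCross (assoc* a b c d e f) }
      ; *-identity = (λ { (frac a b _) → fromCross (P.*-cong (P.*-identityˡ a) (P.sym (P.*-identityˡ b))) })
                   , (λ { (frac a b _) → fromCross (P.*-cong (P.*-identityʳ a) (P.sym (P.*-identityʳ b))) })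
      ; distrib = (λ { (frac a b _) (frac c d _) (frac e f _) → fromCross (distrib₁ a b c d e f) })
                , (λ { (frac a b _) (frac c d _) (frac e f _) → fromCross (distrib₂ a b c d e f) }) }
    ; *-comm = λ { (frac a b _) (frac c d _) → fromCross (comm* a b c d) } }
    where
    open CommutativeRing P.ring using (+-identityʳ)
    one : Poly
    one = 1ℤ ∷ []
    assoc⁺ : ∀ a b c d e f → ((a P.* d P.+ c P.* b) P.* f P.+ e P.* (b P.* d)) P.* (b P.* (d P.* f))
                           ≋ (a P.* (d P.* f) P.+ (c P.* f P.+ e P.* d) P.* b) P.* (b P.* d P.* f)
    assoc⁺ = solve-∀ P.almostRing
    comm⁺ : ∀ a b c d → (a P.* d P.+ c P.* b) P.* (d P.* b) ≋ (c P.* b P.+ a P.* d) P.* (b P.* d)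
    comm⁺ = solve-∀ P.almostRing
    assoc* : ∀ a b c d e f → (a P.* c P.* e) P.* (b P.* (d P.* f)) ≋ (a P.* (c P.* e)) P.* (b P.* d P.* f)
    assoc* = solve-∀ P.almostRing
    comm* : ∀ a b c d → (a P.* c) P.* (d P.* b) ≋ (c P.* a) P.* (b P.* d)
    comm* = solve-∀ P.almostRing
    distrib₁ : ∀ a b c d e f → (a P.* (c P.* f P.+ e P.* d)) P.* ((b P.* d) P.* (b P.* f))
                             ≋ (a P.* c P.* (b P.* f) P.+ a P.* e P.* (b P.* d)) P.* (b P.* (d P.* f))
    distrib₁ = solve-∀ P.almostRing
    distrib₂ : ∀ a b c d e f → ((c P.* f P.+ e P.* d) P.* a) P.* ((d P.* b) P.* (f P.* b))
                             ≋ (c P.* a P.* (f P.* b) P.+ e P.* a P.* (d P.* b)) P.* ((d P.* f) P.* b)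
    distrib₂ = solve-∀ P.almostRing
    inverse₁ : ∀ a b → P.- a P.* b P.+ a P.* b ≋ []
    inverse₁ = solve-∀ P.almostRing
    inverse₂ : ∀ a b → a P.* b P.+ P.- a P.* b ≋ []
    inverse₂ = solve-∀ P.almostRing
    inv : ∀ p r → p ≋ [] → p P.* one ≋ (0ℤ ∷ []) P.* r
    inv p r p≋0 = begin
      p P.* one         ≈⟨ P.*-identityʳ p ⟩
      p                 ≈⟨ p≋0 ⟩
      [] P.* r          ≈⟨ P.*-congʳ [0]≋[] ⟨
      (0ℤ ∷ []) P.* r   ∎

  ring : CommutativeRing 0ℓ 0ℓ
  ring = record { isCommutativeRing = isCommutativeRing }

  zero? : ∀ f → Maybe (const 0ℤ ≃ f)
  zero? (frac a b _) = Maybe.map (λ a≋0 → fromCross (P.trans (P.*-congʳ [0]≋[]) (P.trans a≋0 (P.sym (P.*-identityʳ a))))) (P.zero? a)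

  almostRing : AlmostCommutativeRing 0ℓ 0ℓ
  almostRing = fromCommutativeRing ring zero?

  -- Only the cross-multiplied equation can be differentiated. Adding and subtracting a d′ b d
  -- expresses the quotient-rule numerators through the cross product and its derivative.
  d/dZ-cong : ∀ {f g} → f ≃ g → d/dZ f ≃ d/dZ g
  d/dZ-cong {frac a b _} {frac c d _} p = fromCross (begin
    (a′ P.* b P.+ P.- (a P.* b′)) P.* (d P.* d)
      ≈⟨ left a b d a′ b′ d′ ⟩
    (a′ P.* d P.+ a P.* d′) P.* (b P.* d) P.+ P.- (a P.* d P.* (b P.* d′ P.+ d P.* b′))
      ≈⟨ P.+-cong (P.*-congʳ derivatives) (P.-‿cong (P.*-congʳ (cross p))) ⟩
    (c′ P.* b P.+ c P.* b′) P.* (b P.* d) P.+ P.- (c P.* b P.* (b P.* d′ P.+ d P.* b′))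
      ≈⟨ right b c d b′ c′ d′ ⟩
    (c′ P.* d P.+ P.- (c P.* d′)) P.* (b P.* b) ∎)
    where
    a′ = deriv a
    b′ = deriv b
    c′ = deriv c
    d′ = deriv d
    derivatives : a′ P.* d P.+ a P.* d′ ≋ c′ P.* b P.+ c P.* b′
    derivatives = P.trans (P.sym (P.deriv-* a d)) (P.trans (P.deriv-cong (cross p)) (P.deriv-* c b))
    left : ∀ a b d a′ b′ d′ → (a′ P.* b P.+ P.- (a P.* b′)) P.* (d P.* d)
         ≋ (a′ P.* d P.+ a P.* d′) P.* (b P.* d) P.+ P.- (a P.* d P.* (b P.* d′ P.+ d P.* b′))
    left = solve-∀ P.almostRing
    right : ∀ b c d b′ c′ d′ → (c′ P.* b P.+ c P.* b′) P.* (b P.* d) P.+ P.- (c P.* b P.* (b P.* d′ P.+ d P.* b′))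
          ≋ (c′ P.* d P.+ P.- (c P.* d′)) P.* (b P.* b)
    right = solve-∀ P.almostRing

  d/dZ-* : ∀ f g → d/dZ (f * g) ≃ d/dZ f * g + f * d/dZ g
  d/dZ-* (frac a b _) (frac c d _) = fromCross (begin
    (deriv (a P.* c) P.* (b P.* d) P.+ P.- (a P.* c P.* deriv (b P.* d)))
      P.* (b P.* b P.* d P.* (b P.* (d P.* d)))
      ≈⟨ P.*-congʳ (P.+-cong (P.*-congʳ (P.deriv-* a c)) (P.-‿cong (P.*-congˡ {a P.* c} (P.deriv-* b d)))) ⟩
    ((a′ P.* c P.+ a P.* c′) P.* (b P.* d) P.+ P.- (a P.* c P.* (b′ P.* d P.+ b P.* d′)))
      P.* (b P.* b P.* d P.* (b P.* (d P.* d)))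
      ≈⟨ leibniz a b c d a′ b′ c′ d′ ⟩
    ((a′ P.* b P.+ P.- (a P.* b′)) P.* c P.* (b P.* (d P.* d)) P.+ a P.* (c′ P.* d P.+ P.- (c P.* d′)) P.* (b P.* b P.* d))
      P.* (b P.* d P.* (b P.* d)) ∎)
    where
    a′ = deriv a
    b′ = deriv b
    c′ = deriv c
    d′ = deriv d
    leibniz : ∀ a b c d a′ b′ c′ d′ →
      ((a′ P.* c P.+ a P.* c′) P.* (b P.* d) P.+ P.- (a P.* c P.* (b′ P.* d P.+ b P.* d′)))
        P.* (b P.* b P.* d P.* (b P.* (d P.* d)))
      ≋ ((a′ P.* b P.+ P.- (a P.* b′)) P.* c P.* (b P.* (d P.* d)) P.+ a P.* (c′ P.* d P.+ P.- (c P.* d′)) P.* (b P.* b P.* d))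
        P.* (b P.* d P.* (b P.* d))
    leibniz = solve-∀ P.almostRing

  d/dZ-+ : ∀ f g → d/dZ (f + g) ≃ d/dZ f + d/dZ g
  d/dZ-+ (frac a b _) (frac c d _) = fromCross (begin
    (deriv (a P.* d P.+ c P.* b) P.* (b P.* d) P.+ P.- ((a P.* d P.+ c P.* b) P.* deriv (b P.* d)))
      P.* (b P.* b P.* (d P.* d))
      ≈⟨ P.*-congʳ (P.+-cong (P.*-congʳ (P.trans (P.deriv-+ (a P.* d) (c P.* b)) (P.+-cong (P.deriv-* a d) (P.deriv-* c b))))
           (P.-‿cong (P.*-congˡ {a P.* d P.+ c P.* b} (P.deriv-* b d)))) ⟩
    ((a′ P.* d P.+ a P.* d′ P.+ (c′ P.* b P.+ c P.* b′)) P.* (b P.* d)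
        P.+ P.- ((a P.* d P.+ c P.* b) P.* (b′ P.* d P.+ b P.* d′)))
      P.* (b P.* b P.* (d P.* d))
      ≈⟨ additive a b c d a′ b′ c′ d′ ⟩
    ((a′ P.* b P.+ P.- (a P.* b′)) P.* (d P.* d) P.+ (c′ P.* d P.+ P.- (c P.* d′)) P.* (b P.* b))
      P.* (b P.* d P.* (b P.* d)) ∎)
    where
    a′ = deriv a
    b′ = deriv b
    c′ = deriv c
    d′ = deriv d
    additive : ∀ a b c d a′ b′ c′ d′ →
      ((a′ P.* d P.+ a P.* d′ P.+ (c′ P.* b P.+ c P.* b′)) P.* (b P.* d)
          P.+ P.- ((a P.* d P.+ c P.* b) P.* (b′ P.* d P.+ b P.* d′)))
        P.* (b P.* b P.* (d P.* d))
      ≋ ((a′ P.* b P.+ P.- (a P.* b′)) P.* (d P.* d) P.+ (c′ P.* d P.+ P.- (c P.* d′)) P.* (b P.* b))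
        P.* (b P.* d P.* (b P.* d))
    additive = solve-∀ P.almostRing

-- Finitely supported sums over ℤ

module SymmetricSums (𝓡 : CommutativeRing 0ℓ 0ℓ) where

  open CommutativeRing 𝓡
  open CommutativeSemigroupProperties +-commutativeSemigroup using (interchange)
  open SetoidReasoning setoid

  Σ± : ℕ → (ℤ → Carrier) → Carrier
  Σ± zero    f = f (+ 0)
  Σ± (suc K) f = Σ± K f + (f (+ suc K) + f -[1+ K ])

  Supp : ℕ → (ℤ → Carrier) → Set
  Supp K f = ∀ i → K ℕ.< ∣ i ∣ → f i ≈ 0#

  Σ±-cong : ∀ K {f g} → (∀ i → f i ≈ g i) → Σ± K f ≈ Σ± K g
  Σ±-cong zero    p = p (+ 0)
  Σ±-cong (suc K) p = +-cong (Σ±-cong K p) (+-cong (p (+ suc K)) (p -[1+ K ]))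

  Σ±-+ : ∀ K f g → Σ± K (λ i → f i + g i) ≈ Σ± K f + Σ± K g
  Σ±-+ zero    f g = refl
  Σ±-+ (suc K) f g = begin
    Σ± K (λ i → f i + g i) + (f (+ suc K) + g (+ suc K) + (f -[1+ K ] + g -[1+ K ]))
      ≈⟨ +-cong (Σ±-+ K f g) (interchange _ _ _ _) ⟩
    Σ± K f + Σ± K g + (f (+ suc K) + f -[1+ K ] + (g (+ suc K) + g -[1+ K ]))
      ≈⟨ interchange _ _ _ _ ⟩
    Σ± (suc K) f + Σ± (suc K) g ∎

  Σ±-scale : ∀ K a f → Σ± K (λ i → a * f i) ≈ a * Σ± K f
  Σ±-scale zero    a f = refl
  Σ±-scale (suc K) a f = begin
    Σ± K (λ i → a * f i) + (a * f (+ suc K) + a * f -[1+ K ])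
      ≈⟨ +-cong (Σ±-scale K a f) (sym (distribˡ a _ _)) ⟩
    a * Σ± K f + a * (f (+ suc K) + f -[1+ K ])  ≈⟨ distribˡ a _ _ ⟨
    a * Σ± (suc K) f                             ∎

  Σ±-0 : ∀ K → Σ± K (λ _ → 0#) ≈ 0#
  Σ±-0 zero    = refl
  Σ±-0 (suc K) = trans (+-cong (Σ±-0 K) (+-identityˡ 0#)) (+-identityˡ 0#)

  Σ±-neg : ∀ K f → Σ± K (λ i → f (ℤ.- i)) ≈ Σ± K f
  Σ±-neg zero    f = refl
  Σ±-neg (suc K) f = +-cong (Σ±-neg K f) (+-comm _ _)

  -- A shift by one moves the window from -K ... K to 1 - K ... K + 1. The lost and the gained
  -- boundary term stand on opposite sides, which avoids subtraction.
  Σ±-suc : ∀ K f → Σ± K (λ i → f (1ℤ ℤ.+ i)) + f (ℤ.- (+ K)) ≈ Σ± K f + f (+ suc K)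
  Σ±-suc zero    f = +-comm _ _
  Σ±-suc (suc K) f = begin
    Σ± K g + (g (+ suc K) + g -[1+ K ]) + f -[1+ K ]       ≈⟨ +-congʳ (+-congˡ (+-comm _ _)) ⟩
    Σ± K g + (g -[1+ K ] + g (+ suc K)) + f -[1+ K ]       ≈⟨ +-congʳ (+-assoc _ _ _) ⟨
    Σ± K g + g -[1+ K ] + g (+ suc K) + f -[1+ K ]         ≈⟨ +-congʳ (+-congʳ (+-congˡ (reflexive (≡.cong f (suc-neg K))))) ⟩
    Σ± K g + f (ℤ.- (+ K)) + f (+ suc (suc K)) + f -[1+ K ] ≈⟨ +-congʳ (+-congʳ (Σ±-suc K f)) ⟩
    Σ± K f + f (+ suc K) + f (+ suc (suc K)) + f -[1+ K ]  ≈⟨ +-assoc _ _ _ ⟩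
    Σ± K f + f (+ suc K) + (f (+ suc (suc K)) + f -[1+ K ]) ≈⟨ +-congˡ (+-comm _ _) ⟩
    Σ± K f + f (+ suc K) + (f -[1+ K ] + f (+ suc (suc K))) ≈⟨ +-assoc _ _ _ ⟨
    Σ± K f + f (+ suc K) + f -[1+ K ] + f (+ suc (suc K))  ≈⟨ +-congʳ (+-assoc _ _ _) ⟩
    Σ± (suc K) f + f (+ suc (suc K))                       ∎
    where
    g : ℤ → Carrier
    g i = f (1ℤ ℤ.+ i)
    suc-neg : ∀ K → 1ℤ ℤ.+ -[1+ K ] ≡ ℤ.- (+ K)
    suc-neg zero    = ≡.refl
    suc-neg (suc K) = ≡.refl

  enlarge : ∀ {K L f} → Supp K f → K ℕ.≤ L → Σ± L f ≈ Σ± K f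
  enlarge {K} {L} {f} supp K≤L = ≡.subst (λ M → Σ± M f ≈ Σ± K f) (ℕ.m∸n+n≡m K≤L) (go (L ℕ.∸ K))
    where
    go : ∀ d → Σ± (d ℕ.+ K) f ≈ Σ± K f
    go zero    = refl
    go (suc d) = begin
      Σ± (d ℕ.+ K) f + (f (+ suc (d ℕ.+ K)) + f -[1+ d ℕ.+ K ])
        ≈⟨ +-cong (go d) (+-cong (supp _ (s≤s (ℕ.m≤n+m K d))) (supp _ (s≤s (ℕ.m≤n+m K d)))) ⟩
      Σ± K f + (0# + 0#)  ≈⟨ +-congˡ (+-identityˡ 0#) ⟩
      Σ± K f + 0#         ≈⟨ +-identityʳ _ ⟩
      Σ± K f              ∎

  -- A sum over all of ℤ. Symmetric windows are not shift invariant; keeping the window inside the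
  -- record lets the index be shifted and reflected freely.
  record Sums (f : ℤ → Carrier) (s : Carrier) : Set where
    constructor sums
    field
      bound : ℕ
      supp  : Supp bound f
      total : Σ± bound f ≈ s
  open Sums public

  sums-at : ∀ {f s} (p : Sums f s) {K} → bound p ℕ.≤ K → Σ± K f ≈ s
  sums-at p b≤K = trans (enlarge (supp p) b≤K) (total p)

  supp-at : ∀ {f s} (p : Sums f s) {K} → bound p ℕ.≤ K → Supp K f
  supp-at p b≤K i K<i = supp p i (ℕ.≤-<-trans b≤K K<i)

  sums-cong : ∀ {f g s t} → (∀ i → f i ≈ g i) → s ≈ t → Sums f s → Sums g t
  sums-cong f≈g s≈t p = sums (bound p) (λ i b → trans (sym (f≈g i)) (supp p i b))
    (trans (sym (Σ±-cong (bound p) f≈g)) (trans (total p) s≈t))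

  sums-unique : ∀ {f g s t} → Sums f s → Sums g t → (∀ i → f i ≈ g i) → s ≈ t
  sums-unique {f} {g} {s} {t} p r f≈g = begin
    s       ≈⟨ sums-at p (ℕ.m≤m⊔n (bound p) (bound r)) ⟨
    Σ± K f  ≈⟨ Σ±-cong K f≈g ⟩
    Σ± K g  ≈⟨ sums-at r (ℕ.m≤n⊔m (bound p) (bound r)) ⟩
    t       ∎
    where
    K : ℕ
    K = bound p ℕ.⊔ bound r

  sums-+ : ∀ {f g s t} → Sums f s → Sums g t → Sums (λ i → f i + g i) (s + t)
  sums-+ {f} {g} p r = sums K
    (λ i K<i → trans (+-cong (supp-at p p≤ i K<i) (supp-at r r≤ i K<i)) (+-identityˡ 0#))
    (trans (Σ±-+ K f g) (+-cong (sums-at p p≤) (sums-at r r≤)))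
    where
    K : ℕ
    K = bound p ℕ.⊔ bound r
    p≤ : bound p ℕ.≤ K
    p≤ = ℕ.m≤m⊔n (bound p) (bound r)
    r≤ : bound r ℕ.≤ K
    r≤ = ℕ.m≤n⊔m (bound p) (bound r)

  sums-scale : ∀ {f s} a → Sums f s → Sums (λ i → a * f i) (a * s)
  sums-scale {f} a p = sums (bound p) (λ i b → trans (*-congˡ (supp p i b)) (zeroʳ a))
    (trans (Σ±-scale (bound p) a f) (*-congˡ (total p)))

  sums-neg : ∀ {f s} → Sums f s → Sums (λ i → f (ℤ.- i)) s
  sums-neg {f} p = sums (bound p) (λ i b → supp p (ℤ.- i) (≡.subst (bound p ℕ.<_) (≡.sym (ℤ.∣-i∣≡∣i∣ i)) b))
    (trans (Σ±-neg (bound p) f) (total p))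

  sums-suc : ∀ {f s} → Sums f s → Sums (λ i → f (1ℤ ℤ.+ i)) s
  -- The shifted support may reach -K - 1, hence the larger window.
  sums-suc {f} {s} p = sums (suc K) (λ i b → supp p (1ℤ ℤ.+ i) (bigger i b)) (begin
    Σ± (suc K) g                     ≈⟨ +-identityʳ _ ⟨
    Σ± (suc K) g + 0#                ≈⟨ +-congˡ (supp p -[1+ K ] ℕ.≤-refl) ⟨
    Σ± (suc K) g + f -[1+ K ]        ≈⟨ Σ±-suc (suc K) f ⟩
    Σ± (suc K) f + f (+ suc (suc K)) ≈⟨ +-cong (sums-at p (ℕ.n≤1+n K)) (supp p _ (ℕ.n<1+n _ ⟨ ℕ.<-trans ⟩ ℕ.n<1+n _)) ⟩
    s + 0#                           ≈⟨ +-identityʳ s ⟩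
    s                                ∎)
    where
    infixl 5 _⟨_⟩_
    _⟨_⟩_ : ∀ {A B C : Set} → A → (A → B → C) → B → C
    a ⟨ f ⟩ b = f a b
    K : ℕ
    K = bound p
    g : ℤ → Carrier
    g i = f (1ℤ ℤ.+ i)
    bigger : ∀ i → suc K ℕ.< ∣ i ∣ → K ℕ.< ∣ 1ℤ ℤ.+ i ∣
    bigger (+ n)            b = ℕ.<-trans (ℕ.<-trans (ℕ.n<1+n K) b) (ℕ.n<1+n n)
    bigger -[1+ zero ]      (s≤s ())
    bigger -[1+ suc n ]     (s≤s b) = b

  -- The reflection i ↦ -i conjugates the shift by 1 into the shift by -1.
  sums-pred : ∀ {f s} → Sums (λ i → f (1ℤ ℤ.+ i)) s → Sums f s
  sums-pred {f} p = sums-cong (λ i → reflexive (≡.cong f (lemma i))) refl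
    (sums-neg (sums-suc (sums-neg p)))
    where
    lemma : ∀ i → 1ℤ ℤ.+ ℤ.- (1ℤ ℤ.+ ℤ.- i) ≡ i
    lemma = solveℤ

  sums-shift : ∀ {f s} d → Sums f s → Sums (λ i → f (i ℤ.+ d)) s
  sums-shift {f} d p = sums-cong (λ i → reflexive (≡.cong f (ℤ.+-comm d i))) refl (go d p)
    where
    assoc : ∀ d i → d ℤ.+ (1ℤ ℤ.+ i) ≡ 1ℤ ℤ.+ d ℤ.+ i
    assoc = solveℤ
    go : ∀ {f s} d → Sums f s → Sums (λ i → f (d ℤ.+ i)) s
    go {f} (+ zero)     p = sums-cong (λ i → reflexive (≡.cong f (≡.sym (ℤ.+-identityˡ i)))) refl p
    go {f} (+ suc d)    p = sums-cong (λ i → reflexive (≡.cong f (assoc (+ d) i))) refl (sums-suc (go (+ d) p))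
    go {f} -[1+ zero ]  p = sums-pred (sums-cong (λ i → reflexive (≡.cong f (≡.sym (cancel i)))) refl p)
      where
      cancel : ∀ i → ℤ.-1ℤ ℤ.+ (1ℤ ℤ.+ i) ≡ i
      cancel = solveℤ
    go {f} -[1+ suc d ] p = sums-pred (sums-cong (λ i → reflexive (≡.cong f (≡.sym (assoc -[1+ suc d ] i)))) refl (go -[1+ d ] p))

  sums-0 : Sums (λ _ → 0#) 0#
  sums-0 = sums 0 (λ _ _ → refl) refl

  sums-single : ∀ {f} j → (∀ i → i ≢ j → f i ≈ 0#) → Sums f (f j)
  sums-single {f} j f≈0 = sums ∣ j ∣ (λ i b → f≈0 i λ { ≡.refl → ℕ.<-irrefl ≡.refl b }) (at-boundary j f≈0)
    where
    below : ∀ K → (∀ i → ∣ i ∣ ℕ.≤ K → f i ≈ 0#) → Σ± K f ≈ 0#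
    below zero    f≈0 = f≈0 (+ 0) z≤n
    below (suc K) f≈0 = begin
      Σ± K f + (f (+ suc K) + f -[1+ K ])
        ≈⟨ +-cong (below K λ i i≤K → f≈0 i (ℕ.m≤n⇒m≤1+n i≤K)) (+-cong (f≈0 _ ℕ.≤-refl) (f≈0 _ ℕ.≤-refl)) ⟩
      0# + (0# + 0#)  ≈⟨ +-identityˡ _ ⟩
      0# + 0#         ≈⟨ +-identityˡ _ ⟩
      0#              ∎
    smaller : ∀ {K} → ∀ i j → ∣ i ∣ ℕ.≤ K → ∣ j ∣ ≡ suc K → i ≢ j
    smaller i j i≤K j≡ ≡.refl = ℕ.<-irrefl j≡ (s≤s i≤K)
    at-boundary : ∀ j → (∀ i → i ≢ j → f i ≈ 0#) → Σ± ∣ j ∣ f ≈ f j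
    at-boundary (+ zero)  f≈0 = refl
    at-boundary (+ suc K) f≈0 = begin
      Σ± K f + (f (+ suc K) + f -[1+ K ])
        ≈⟨ +-cong (below K λ i i≤K → f≈0 i (smaller i (+ suc K) i≤K ≡.refl)) (+-congˡ (f≈0 _ λ ())) ⟩
      0# + (f (+ suc K) + 0#)  ≈⟨ +-identityˡ _ ⟩
      f (+ suc K) + 0#         ≈⟨ +-identityʳ _ ⟩
      f (+ suc K)              ∎
    at-boundary -[1+ K ]  f≈0 = begin
      Σ± K f + (f (+ suc K) + f -[1+ K ])
        ≈⟨ +-cong (below K λ i i≤K → f≈0 i (smaller i -[1+ K ] i≤K ≡.refl)) (+-congʳ (f≈0 _ λ ())) ⟩
      0# + (0# + f -[1+ K ])   ≈⟨ +-identityˡ _ ⟩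
      0# + f -[1+ K ]          ≈⟨ +-identityˡ _ ⟩
      f -[1+ K ]               ∎

module Σℤ = SymmetricSums ℤ.+-*-commutativeRing

*-annihilˡ : ∀ {i} j → i ≡ 0ℤ → i ℤ.* j ≡ 0ℤ
*-annihilˡ j ≡.refl = ℤ.*-zeroˡ j

*-annihilʳ : ∀ i {j} → j ≡ 0ℤ → i ℤ.* j ≡ 0ℤ
*-annihilʳ i ≡.refl = ℤ.*-zeroʳ i

-- Multiplication of arrays by θ

module Theta where
  open ≡ using (refl; sym; trans; cong; cong₂)
  open import Data.Integer.Base using (_+_; _*_; _-_; -_)
  open Σℤ
  open ≡-Reasoning

  Array : Set
  Array = ℤ → ℤ → ℤ

  -- f k n is the coefficient of zᵏ qⁿ
  record Vanishes (f : Array) : Set where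
    constructor mk
    field
      vanish : ∀ k j → f k -[1+ j ] ≡ 0ℤ
  open Vanishes public

  -- Multiplication by 1 - z.
  ∇ : Array → Array
  ∇ f k n = f k n - f (k - 1ℤ) n

  alternating : ℕ → ℤ
  alternating zero    = 1ℤ
  alternating (suc n) = - alternating n

  sgn : ℤ → ℤ
  sgn s = alternating ∣ s ∣

  triangle : ℕ → ℕ
  triangle zero    = 0
  triangle (suc n) = suc n ℕ.+ triangle n

  -- T s = s (s - 1) / 2
  T : ℤ → ℕ
  T (+ zero)  = 0
  T (+ suc n) = triangle n
  T -[1+ n ]  = triangle (suc n)

  sgn-suc : ∀ s → sgn (1ℤ + s) ≡ - sgn s
  sgn-suc (+ n)        = refl
  sgn-suc -[1+ zero ]  = refl
  sgn-suc -[1+ suc n ] = sym (ℤ.neg-involutive _)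

  T-suc : ∀ s → + T (1ℤ + s) ≡ + T s + s
  T-suc (+ zero)     = refl
  T-suc (+ suc n)    = cong +_ (ℕ.+-comm (suc n) (triangle n))
  T-suc -[1+ zero ]  = refl
  T-suc -[1+ suc n ] = cancel (+ suc (suc n)) (+ triangle (suc n))
    where
    cancel : ∀ a t → t ≡ a + t - a
    cancel = solveℤ

  T-reflect : ∀ s → T (1ℤ + (- s)) ≡ T s
  T-reflect (+ zero)        = refl
  T-reflect (+ suc zero)    = refl
  T-reflect (+ suc (suc n)) = refl
  T-reflect -[1+ n ]        = refl

  ≤triangle : ∀ n → n ℕ.≤ triangle n
  ≤triangle zero    = z≤n
  ≤triangle (suc n) = ℕ.m≤m+n (suc n) (triangle n)

  -- This makes `Θ` a finite sum: for ∣s∣ > n + 1 the exponent n - T s is negative. The extra 1 is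
  -- forced by s = 1, where T s = 0.
  ∣s∣≤1+T : ∀ s → ∣ s ∣ ℕ.≤ suc (T s)
  ∣s∣≤1+T (+ zero)  = z≤n
  ∣s∣≤1+T (+ suc n) = s≤s (≤triangle n)
  ∣s∣≤1+T -[1+ n ]  = ℕ.m≤n⇒m≤1+n (≤triangle (suc n))

  negative : ∀ {m e} → m ℕ.< e → ∃ λ j → + m - + e ≡ -[1+ j ]
  negative {m} {suc e} (s≤s m≤e) = e ℕ.∸ m , (begin
    + m - + suc e               ≡⟨ cong (λ x → + m - + suc x) (sym (ℕ.m+[n∸m]≡n m≤e)) ⟩
    + m - (1ℤ + (+ m + + (e ℕ.∸ m)))   ≡⟨ cancel (+ m) (+ (e ℕ.∸ m)) ⟩
    - (1ℤ + + (e ℕ.∸ m))        ∎)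
    where
    cancel : ∀ m d → m - (1ℤ + (m + d)) ≡ - (1ℤ + d)
    cancel = solveℤ

  negative-negative : ∀ m e → ∃ λ j → -[1+ m ] - + e ≡ -[1+ j ]
  negative-negative m zero    = m , refl
  negative-negative m (suc e) = suc (m ℕ.+ e) , refl

  vanish-< : ∀ {f} → Vanishes f → ∀ k {m e} → m ℕ.< e → f k (+ m - + e) ≡ 0ℤ
  vanish-< {f} van k m<e with negative m<e
  ... | j , eq = trans (cong (f k) eq) (vanish van k j)

  thetaTerm : Array → ℤ → ℤ → ℤ → ℤ
  thetaTerm f k n s = sgn s * f (k - s) (n - + T s)

  -- Multiplication by ∑ₛ (-1)ˢ zˢ q^(s(s-1)/2)
  Θ : Array → Array
  Θ f k n = Σ± (suc ∣ n ∣) (thetaTerm f k n)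

  Θ-sums : ∀ {f} → Vanishes f → ∀ k n → Sums (thetaTerm f k n) (Θ f k n)
  Θ-sums {f} van k n = sums (suc ∣ n ∣) (support n) refl
    where
    support : ∀ n → Supp (suc ∣ n ∣) (thetaTerm f k n)
    support (+ m) s m<s = *-annihilʳ (sgn s) (vanish-< van (k - s) (ℕ.≤-pred (ℕ.≤-trans m<s (∣s∣≤1+T s))))
    support -[1+ m ] s _ with negative-negative m (T s)
    ... | j , eq = *-annihilʳ (sgn s) (trans (cong (f (k - s)) eq) (vanish van (k - s) j))

  Θ-vanishes : ∀ {f} → Vanishes f → Vanishes (Θ f)
  Θ-vanishes {f} van = mk λ k j → trans (Σ±-cong (suc (suc j)) (zeroTerm k j)) (Σ±-0 (suc (suc j)))
    where
    zeroTerm : ∀ k j s → thetaTerm f k -[1+ j ] s ≡ 0ℤ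
    zeroTerm k j s with negative-negative j (T s)
    ... | i , eq = *-annihilʳ (sgn s) (trans (cong (f (k - s)) eq) (vanish van (k - s) i))

  Θ-cong : ∀ {f g} → (∀ k n → f k n ≡ g k n) → ∀ k n → Θ f k n ≡ Θ g k n
  Θ-cong f≡g k n = Σ±-cong (suc ∣ n ∣) λ s → cong (sgn s *_) (f≡g (k - s) (n - + T s))

  ∇-vanishes : ∀ {f} → Vanishes f → Vanishes (∇ f)
  ∇-vanishes van = mk λ k j → cong₂ _-_ (vanish van k j) (vanish van (k - 1ℤ) j)

  ∇-Θ : ∀ f k n → ∇ (Θ f) k n ≡ Θ (∇ f) k n
  ∇-Θ f k n = begin
    Σ± K (thetaTerm f k n) - Σ± K (thetaTerm f (k - 1ℤ) n)
      ≡⟨ cong (_+_ (Σ± K (thetaTerm f k n))) (ℤ.-1*i≡-i _) ⟨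
    Σ± K (thetaTerm f k n) + ℤ.-1ℤ * Σ± K (thetaTerm f (k - 1ℤ) n)
      ≡⟨ cong (_+_ (Σ± K (thetaTerm f k n))) (Σ±-scale K ℤ.-1ℤ (thetaTerm f (k - 1ℤ) n)) ⟨
    Σ± K (thetaTerm f k n) + Σ± K (λ s → ℤ.-1ℤ * thetaTerm f (k - 1ℤ) n s)
      ≡⟨ Σ±-+ K (thetaTerm f k n) _ ⟨
    Σ± K (λ s → thetaTerm f k n s + ℤ.-1ℤ * thetaTerm f (k - 1ℤ) n s)
      ≡⟨ Σ±-cong K (λ s → trans
           (cong (λ x → thetaTerm f k n s + ℤ.-1ℤ * (sgn s * f x (n - + T s))) (commute k s))
           (factor (sgn s) (f (k - s) (n - + T s)) (f (k - s - 1ℤ) (n - + T s)))) ⟩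
    Θ (∇ f) k n ∎
    where
    K : ℕ
    K = suc ∣ n ∣
    commute : ∀ k s → k - 1ℤ - s ≡ k - s - 1ℤ
    commute = solveℤ
    factor : ∀ a x y → a * x + ℤ.-1ℤ * (a * y) ≡ a * (x - y)
    factor = solveℤ

  -- Functional equation under z ↦ zq: the shift s ↦ s + 1 of the summation lowers d and e by 1.
  Θ-shear : ∀ {f p} ε d e → Vanishes f → Vanishes p →
    (∀ k n → f k n ≡ p k n + ε * f (k + d) (n - k - e)) →
    ∀ k n → Θ f k n ≡ Θ p k n + - ε * Θ f (k + (d - 1ℤ)) (n - k - (e - 1ℤ))
  Θ-shear {f} {p} ε d e vanf vanp eq k n = trans
    (sums-unique (Θ-sums vanf k n)
      (sums-+ (Θ-sums vanp k n) (sums-scale ε (sums-pred {g} (sums-cong shifted (ℤ.-1*i≡-i _) (sums-scale ℤ.-1ℤ (Θ-sums vanf k′ n′))))))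
      expand)
    (cong (_+_ (Θ p k n)) (trans (sym (ℤ.neg-distribʳ-* ε (Θ f k′ n′))) (ℤ.neg-distribˡ-* ε (Θ f k′ n′))))
    where
    k′ n′ : ℤ
    k′ = k + (d - 1ℤ)
    n′ = n - k - (e - 1ℤ)
    g : ℤ → ℤ
    g s = sgn s * f (k - s + d) (n - + T s - (k - s) - e)
    expand : ∀ s → thetaTerm f k n s ≡ thetaTerm p k n s + ε * g s
    expand s = trans (cong (sgn s *_) (eq (k - s) (n - + T s))) (distribute ε (sgn s) (p (k - s) (n - + T s)) _)
      where
      distribute : ∀ ε a x y → a * (x + ε * y) ≡ a * x + ε * (a * y)
      distribute = solveℤ
    -- By `T-suc` the s in `T (1ℤ + s)` cancels the s in `k - (1ℤ + s)`, so g at 1 + s is minus a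
    -- summand of `Θ f` at a point `k′` , `n′` that does not depend on s.
    shifted : ∀ s → ℤ.-1ℤ * thetaTerm f k′ n′ s ≡ g (1ℤ + s)
    shifted s = begin
      ℤ.-1ℤ * (sgn s * f (k′ - s) (n′ - + T s))
        ≡⟨ pull (sgn s) _ ⟩
      - sgn s * f (k′ - s) (n′ - + T s)
        ≡⟨ cong₂ (λ a b → a * f b (n′ - + T s)) (sym (sgn-suc s)) (index k s d) ⟩
      sgn (1ℤ + s) * f (k - (1ℤ + s) + d) (n′ - + T s)
        ≡⟨ cong (λ x → sgn (1ℤ + s) * f (k - (1ℤ + s) + d) x) (exponent k n s e (+ T s)) ⟩
      sgn (1ℤ + s) * f (k - (1ℤ + s) + d) (n - (+ T s + s) - (k - (1ℤ + s)) - e)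
        ≡⟨ cong (λ t → sgn (1ℤ + s) * f (k - (1ℤ + s) + d) (n - t - (k - (1ℤ + s)) - e)) (sym (T-suc s)) ⟩
      g (1ℤ + s) ∎
      where
      pull : ∀ a x → ℤ.-1ℤ * (a * x) ≡ - a * x
      pull = solveℤ
      index : ∀ k s d → k + (d - 1ℤ) - s ≡ k - (1ℤ + s) + d
      index = solveℤ
      exponent : ∀ k n s e t → n - k - (e - 1ℤ) - t ≡ n - (t + s) - (k - (1ℤ + s)) - e
      exponent = solveℤ

  ∇≡0⇒constant : ∀ {f} → (∀ k n → ∇ f k n ≡ 0ℤ) → ∀ k k′ n → f k n ≡ f k′ n
  ∇≡0⇒constant {f} ∇f≡0 k k′ n = trans (toZero k) (sym (toZero k′))
    where
    step : ∀ k → f (1ℤ + k) n ≡ f k n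
    step k = trans (ℤ.i-j≡0⇒i≡j (f (1ℤ + k) n) (f (1ℤ + k - 1ℤ) n) (∇f≡0 (1ℤ + k) n)) (cong (λ x → f x n) (cancel k))
      where
      cancel : ∀ k → 1ℤ + k - 1ℤ ≡ k
      cancel = solveℤ
    toZero : ∀ k → f k n ≡ f 0ℤ n
    toZero (+ zero)     = refl
    toZero (+ suc m)    = trans (step (+ m)) (toZero (+ m))
    toZero -[1+ zero ]  = sym (step -[1+ 0 ])
    toZero -[1+ suc m ] = trans (sym (step -[1+ suc m ])) (toZero -[1+ m ])

  -- The terms s and 1 - s cancel.
  Θ-constant : ∀ {f} → Vanishes f → (∀ k n → ∇ f k n ≡ 0ℤ) → ∀ k n → Θ f k n ≡ 0ℤ
  Θ-constant {f} van ∇f≡0 k n = self-negative _ (sums-unique (Θ-sums van k n)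
    (sums-scale ℤ.-1ℤ (sums-neg (sums-suc (Θ-sums van k n)))) reflect)
    where
    self-negative : ∀ i → i ≡ ℤ.-1ℤ * i → i ≡ 0ℤ
    self-negative (+ zero)  _ = refl
    self-negative (+ suc m) ()
    self-negative -[1+ m ]  ()
    reflect : ∀ s → thetaTerm f k n s ≡ ℤ.-1ℤ * thetaTerm f k n (1ℤ + (- s))
    reflect s = begin
      sgn s * f (k - s) (n - + T s)
        ≡⟨ cong₂ (λ x y → sgn s * f x (n - + y)) (refl {x = k - s}) (sym (T-reflect s)) ⟩
      sgn s * f (k - s) (n - + T (1ℤ + (- s)))
        ≡⟨ cong₂ _*_ (trans (cong alternating (sym (ℤ.∣-i∣≡∣i∣ s))) (trans (sym (ℤ.neg-involutive _)) (cong -_ (sym (sgn-suc (- s))))))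
             (∇≡0⇒constant {f} ∇f≡0 (k - s) (k - (1ℤ + (- s))) _) ⟩
      - sgn (1ℤ + (- s)) * f (k - (1ℤ + (- s))) (n - + T (1ℤ + (- s)))
        ≡⟨ pull (sgn (1ℤ + (- s))) _ ⟩
      ℤ.-1ℤ * thetaTerm f k n (1ℤ + (- s)) ∎
      where
      pull : ∀ a x → - a * x ≡ ℤ.-1ℤ * (a * x)
      pull = solveℤ

  ∇Θ≡0 : ∀ {f} → (∀ k n → Θ (∇ f) k n ≡ 0ℤ) → ∀ k n → ∇ (Θ f) k n ≡ 0ℤ
  ∇Θ≡0 {f} p k n = trans (∇-Θ f k n) (p k n)

  -- `∇ f` is constant in k, so one Θ kills it; since ∇ commutes with Θ, this says that `Θ f` is
  -- constant in k, and another Θ kills that.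
  Θ²-linear : ∀ {f} → Vanishes f → (∀ k n → ∇ (∇ f) k n ≡ 0ℤ) → ∀ k n → Θ (Θ f) k n ≡ 0ℤ
  Θ²-linear {f} van ∇²f≡0 = Θ-constant (Θ-vanishes van) (∇Θ≡0 {f} (Θ-constant (∇-vanishes van) ∇²f≡0))

  Θ³-quadratic : ∀ {f} → Vanishes f → (∀ k n → ∇ (∇ (∇ f)) k n ≡ 0ℤ) → ∀ k n → Θ (Θ (Θ f)) k n ≡ 0ℤ
  Θ³-quadratic {f} van ∇³f≡0 = Θ-constant (Θ-vanishes (Θ-vanishes van)) (∇Θ≡0 {Θ f} λ k n →
    trans (Θ-cong {∇ (Θ f)} {Θ (∇ f)} (∇-Θ f) k n) (Θ²-linear (∇-vanishes van) ∇³f≡0 k n))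

  -- From m, at most m + 1 steps of length ∣d∣ ≥ 1 lead below zero, where f vanishes. A negative
  -- period is read in the opposite direction.
  periodic⇒0 : (f : ℤ → ℤ) → (∀ j → f -[1+ j ] ≡ 0ℤ) → ∀ d → d ≢ 0ℤ → (∀ n → f n ≡ f (n - d)) → ∀ n → f n ≡ 0ℤ
  periodic⇒0 f van (+ zero) d≢0 _      n        = contradiction refl d≢0
  periodic⇒0 f van d        d≢0 period -[1+ j ] = van j
  periodic⇒0 f van (+ suc e) d≢0 period (+ m)   = begin
    f (+ m)                               ≡⟨ iterate (suc m) (+ m) ⟩
    f (+ m - + suc m * + suc e)           ≡⟨ cong (λ x → f (+ m - x)) (ℤ.pos-* (suc m) (suc e)) ⟨
    f (+ m - + (suc m ℕ.* suc e))         ≡⟨ vanish-< {λ _ → f} (mk λ _ → van) 0ℤ (ℕ.m≤m*n (suc m) (suc e)) ⟩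
    0ℤ                                    ∎
    where
    iterate : ∀ i n → f n ≡ f (n - + i * + suc e)
    iterate zero    n = cong f (sym (ℤ.+-identityʳ n))
    iterate (suc i) n = trans (iterate i n) (trans (period _) (cong f (collect n (+ i) (+ suc e))))
      where
      collect : ∀ n i e → n - i * e - e ≡ n - (1ℤ + i) * e
      collect = solveℤ
  periodic⇒0 f van -[1+ e ] d≢0 period (+ m)   =
    periodic⇒0 f van (+ suc e) (λ ()) (λ n → sym (trans (period (n - + suc e)) (cong f (cancel n (+ suc e))))) (+ m)
    where
    cancel : ∀ n e → n - e - - e ≡ n
    cancel = solveℤ

  -- One Θ kills the k-free term P and turns the shift (1 , 1) into (0 , 0). What remains is n ↦ n -
  -- k at fixed k, a genuine period unless k = 0.
  Θ-crank : ∀ {c : Array} {P : ℤ → ℤ} → Vanishes c → (∀ j → P -[1+ j ] ≡ 0ℤ) →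
    (∀ k n → c k n + c (k + 1ℤ) (n - k - 1ℤ) ≡ P n) → ∀ k n → k ≢ 0ℤ → Θ c k n ≡ 0ℤ
  Θ-crank {c} {P} van vanP recurrence k n k≢0 =
    periodic⇒0 (Θ c k) (vanish (Θ-vanishes van) k) k k≢0 period n
    where
    vanP′ : Vanishes (λ _ n → P n)
    vanP′ = mk λ _ → vanP
    shear : ∀ k n → c k n ≡ P n + ℤ.-1ℤ * c (k + 1ℤ) (n - k - 1ℤ)
    shear k n = isolate (c k n) _ (P n) (recurrence k n)
      where
      isolate : ∀ x y p → x + y ≡ p → x ≡ p + ℤ.-1ℤ * y
      isolate x y _ refl = cancel x y
        where
        cancel : ∀ x y → x ≡ x + y + ℤ.-1ℤ * y
        cancel = solveℤ
    period : ∀ n → Θ c k n ≡ Θ c k (n - k)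
    period n = begin
      Θ c k n
        ≡⟨ Θ-shear ℤ.-1ℤ 1ℤ 1ℤ van vanP′ shear k n ⟩
      Θ (λ _ n → P n) k n + 1ℤ * Θ c (k + 0ℤ) (n - k - 0ℤ)
        ≡⟨ cong₂ _+_ (Θ-constant vanP′ (λ _ n → ℤ.+-inverseʳ (P n)) k n) (ℤ.*-identityˡ _) ⟩
      0ℤ + Θ c (k + 0ℤ) (n - k - 0ℤ)
        ≡⟨ ℤ.+-identityˡ _ ⟩
      Θ c (k + 0ℤ) (n - k - 0ℤ)
        ≡⟨ cong₂ (Θ c) (ℤ.+-identityʳ k) (ℤ.+-identityʳ (n - k)) ⟩
      Θ c k (n - k) ∎

  heat : ℤ → ℤ → ℤ
  heat k n = + 6 * n + k * k + k

  -- The recurrence is assumed only after multiplication by `heat`, because without this factor it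
  -- fails for the rank at two points.
  Θ³-rank : ∀ {L : Array} {P : ℤ → ℤ} → Vanishes L → (∀ j → P -[1+ j ] ≡ 0ℤ) →
    (∀ k n → heat k n * (L k n + L (k + + 3) (n - k - + 2)) ≡ heat k n * P n) →
    ∀ k n → k ≢ 1ℤ → Θ (Θ (Θ (λ k n → heat k n * L k n))) k n ≡ 0ℤ
  Θ³-rank {L} {P} van vanP recurrence k n k≢1 =
    periodic⇒0 (F k) (vanish vanF k) (k - 1ℤ) (λ p → k≢1 (ℤ.i-j≡0⇒i≡j k 1ℤ p)) period n
    where
    h p F : Array
    h k n = heat k n * L k n
    p k n = heat k n * P n
    F = Θ (Θ (Θ h))
    vanh : Vanishes h
    vanh = mk λ k j → *-annihilʳ (heat k -[1+ j ]) (vanish van k j)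
    vanp : Vanishes p
    vanp = mk λ k j → *-annihilʳ (heat k -[1+ j ]) (vanP j)
    vanF : Vanishes F
    vanF = Θ-vanishes (Θ-vanishes (Θ-vanishes vanh))
    -- heat is invariant under (k , n) ↦ (k + 3 , n - k - 2).
    shear : ∀ k n → h k n ≡ p k n + ℤ.-1ℤ * h (k + + 3) (n - k - + 2)
    shear k n = begin
      heat k n * L k n
        ≡⟨ split (heat k n) (L k n) (L (k + + 3) (n - k - + 2)) ⟩
      heat k n * (L k n + L (k + + 3) (n - k - + 2)) + ℤ.-1ℤ * (heat k n * L (k + + 3) (n - k - + 2))
        ≡⟨ cong₂ (λ x y → x + ℤ.-1ℤ * (y * L (k + + 3) (n - k - + 2))) (recurrence k n) (invariant k n) ⟩
      p k n + ℤ.-1ℤ * h (k + + 3) (n - k - + 2) ∎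
      where
      split : ∀ a x y → a * x ≡ a * (x + y) + ℤ.-1ℤ * (a * y)
      split = solveℤ
      invariant : ∀ k n → + 6 * n + k * k + k ≡ + 6 * (n - k - + 2) + (k + + 3) * (k + + 3) + (k + + 3)
      invariant = solveℤ
    -- `heat` is quadratic in k with leading coefficient 1, and P is free of k.
    ∇³p≡0 : ∀ k n → ∇ (∇ (∇ p)) k n ≡ 0ℤ
    ∇³p≡0 k n = trans (cong₂ _-_ (∇²p k n) (∇²p (k - 1ℤ) n)) (ℤ.+-inverseʳ (+ 2 * P n))
      where
      ∇p : ∀ k n → ∇ p k n ≡ + 2 * k * P n
      ∇p k n = difference k n (P n)
        where
        difference : ∀ k n x → (+ 6 * n + k * k + k) * x - (+ 6 * n + (k - 1ℤ) * (k - 1ℤ) + (k - 1ℤ)) * x ≡ + 2 * k * x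
        difference = solveℤ
      ∇²p : ∀ k n → ∇ (∇ p) k n ≡ + 2 * P n
      ∇²p k n = trans (cong₂ _-_ (∇p k n) (∇p (k - 1ℤ) n)) (difference k (P n))
        where
        difference : ∀ k x → + 2 * k * x - + 2 * (k - 1ℤ) * x ≡ + 2 * x
        difference = solveℤ
    period : ∀ n → F k n ≡ F k (n - (k - 1ℤ))
    period n = begin
      F k n
        -- Read from the innermost use outwards, the shifts are (3 , 2), (2 , 1), (1 , 0) with signs
        -- -, +, -. The result is the shift (0 , -1) with sign +, that is, n ↦ n - k + 1.
        ≡⟨ Θ-shear ℤ.-1ℤ 1ℤ 0ℤ (Θ-vanishes (Θ-vanishes vanh)) (Θ-vanishes (Θ-vanishes vanp))
            (Θ-shear 1ℤ (+ 2) 1ℤ (Θ-vanishes vanh) (Θ-vanishes vanp)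
            (Θ-shear ℤ.-1ℤ (+ 3) (+ 2) vanh vanp shear)) k n ⟩
      Θ (Θ (Θ p)) k n + 1ℤ * F (k + 0ℤ) (n - k - ℤ.-1ℤ)
        ≡⟨ cong₂ _+_ (Θ³-quadratic vanp ∇³p≡0 k n) (ℤ.*-identityˡ _) ⟩
      0ℤ + F (k + 0ℤ) (n - k - ℤ.-1ℤ)
        ≡⟨ ℤ.+-identityˡ _ ⟩
      F (k + 0ℤ) (n - k - ℤ.-1ℤ)
        ≡⟨ cong₂ F (ℤ.+-identityʳ k) (regroup n k) ⟩
      F k (n - (k - 1ℤ)) ∎
      where
      regroup : ∀ n k → n - k - ℤ.-1ℤ ≡ n - (k - 1ℤ)
      regroup = solveℤ

-- Weighted sums over partitions

module Weights where
  open import Data.Integer.Base using (_+_; _-_; _*_; -_)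
  open ≡ using (refl; sym; trans; cong; cong₂; subst)
  open ≡-Reasoning

  ⟦_⟧ : ∀ {A : Set} → Dec A → ℤ
  ⟦ d ⟧ = if does d then 1ℤ else 0ℤ

  ⟦⟧-true : ∀ {A : Set} (d : Dec A) → A → ⟦ d ⟧ ≡ 1ℤ
  ⟦⟧-true (yes _) _ = refl
  ⟦⟧-true (no ¬a) a = contradiction a ¬a

  ⟦⟧-false : ∀ {A : Set} (d : Dec A) → ¬ A → ⟦ d ⟧ ≡ 0ℤ
  ⟦⟧-false (yes a) ¬a = contradiction a ¬a
  ⟦⟧-false (no _)  _  = refl

  ⟦⟧-cong : ∀ {A B : Set} (d : Dec A) (e : Dec B) → (A → B) → (B → A) → ⟦ d ⟧ ≡ ⟦ e ⟧
  ⟦⟧-cong (yes a) e f g = sym (⟦⟧-true e (f a))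
  ⟦⟧-cong (no ¬a) e f g = sym (⟦⟧-false e (¬a ∘ g))

  weight : (List ℕ → ℤ) → List (List ℕ) → ℤ
  weight w []         = 0ℤ
  weight w (xs ∷ xss) = w xs + weight w xss

  weight-++ : ∀ w xss yss → weight w (xss ++ yss) ≡ weight w xss + weight w yss
  weight-++ w []         yss = sym (ℤ.+-identityˡ _)
  weight-++ w (xs ∷ xss) yss = trans (cong (_+_ (w xs)) (weight-++ w xss yss)) (sym (ℤ.+-assoc (w xs) _ _))

  weight-map : ∀ w f xss → weight w (map f xss) ≡ weight (w ∘ f) xss
  weight-map w f []         = refl
  weight-map w f (xs ∷ xss) = cong (_+_ (w (f xs))) (weight-map w f xss)

  weight-filter : ∀ {P : Pred (List ℕ) _} (P? : Decidable P) xss → + length (filter P? xss) ≡ weight (λ xs → ⟦ P? xs ⟧) xss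
  weight-filter P? []         = refl
  weight-filter P? (xs ∷ xss) with does (P? xs)
  ... | true  = cong (_+_ 1ℤ) (weight-filter P? xss)
  ... | false = trans (weight-filter P? xss) (sym (ℤ.+-identityˡ _))

  private
    block : ℕ → ℕ → ℕ → List (List ℕ)
    block k n j = map (replicate j (suc k) ++_) (partitions≤ k (n ∸ j ℕ.* suc k))

  partitions≤-< : ∀ {k n} → n ℕ.< suc k → partitions≤ (suc k) n ≡ partitions≤ k n
  partitions≤-< {k} {n} n<k = begin
    concatMap (block k n) (upTo (suc (n / suc k)))  ≡⟨ cong (λ m → concatMap (block k n) (upTo (suc m))) (m<n⇒m/n≡0 n<k) ⟩
    block k n 0 ++ []                               ≡⟨ List.++-identityʳ _ ⟩
    block k n 0                                     ≡⟨ List.map-id (partitions≤ k n) ⟩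
    partitions≤ k n                                 ∎

  -- The multiplicity j of the part suc k is zero or positive; in the latter case removing one copy
  -- turns block j + 1 for suc k + n into block j for n.
  partitions≤-≥ : ∀ k n → partitions≤ (suc k) (suc k ℕ.+ n) ≡
    partitions≤ k (suc k ℕ.+ n) ++ map (suc k ∷_) (partitions≤ (suc k) n)
  partitions≤-≥ k n = begin
    concatMap (block k (suc k ℕ.+ n)) (upTo (suc ((suc k ℕ.+ n) / suc k)))
      ≡⟨ cong (λ m → concatMap (block k (suc k ℕ.+ n)) (upTo (suc m))) quotient ⟩
    block k (suc k ℕ.+ n) 0 ++ concatMap (block k (suc k ℕ.+ n)) (applyUpTo suc (suc (n / suc k)))
      ≡⟨ cong₂ _++_ (List.map-id (partitions≤ k (suc k ℕ.+ n))) (cong concat (trans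
           (List.map-applyUpTo suc (block k (suc k ℕ.+ n)) (suc (n / suc k)))
           (sym (List.map-upTo (block k (suc k ℕ.+ n) ∘ suc) (suc (n / suc k)))))) ⟩
    partitions≤ k (suc k ℕ.+ n) ++ concatMap (block k (suc k ℕ.+ n) ∘ suc) (upTo (suc (n / suc k)))
      ≡⟨ cong (partitions≤ k (suc k ℕ.+ n) ++_) (List.concatMap-cong next (upTo (suc (n / suc k)))) ⟩
    partitions≤ k (suc k ℕ.+ n) ++ concatMap (map (suc k ∷_) ∘ block k n) (upTo (suc (n / suc k)))
      ≡⟨ cong (partitions≤ k (suc k ℕ.+ n) ++_) (List.map-concatMap (suc k ∷_) (block k n) (upTo (suc (n / suc k)))) ⟨
    partitions≤ k (suc k ℕ.+ n) ++ map (suc k ∷_) (partitions≤ (suc k) n) ∎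
    where
    quotient : (suc k ℕ.+ n) / suc k ≡ suc (n / suc k)
    quotient = trans (m/n≡1+[m∸n]/n {suc k ℕ.+ n} {suc k} (ℕ.m≤m+n (suc k) n)) (cong (λ m → suc (m / suc k)) (ℕ.m+n∸m≡n (suc k) n))
    next : ∀ j → block k (suc k ℕ.+ n) (suc j) ≡ map (suc k ∷_) (block k n j)
    next j = trans (cong (λ m → map (replicate (suc j) (suc k) ++_) (partitions≤ k m))
                        (ℕ.[m+n]∸[m+o]≡n∸o (suc k) n (j ℕ.* suc k)))
                     (List.map-∘ (partitions≤ k (n ∸ j ℕ.* suc k)))

  -- Taking n in ℤ, with no partitions of n < 0, lets q-shifts be subtractions in ℤ.
  S : ℕ → ℤ → (List ℕ → ℤ) → ℤ
  S k (+ n)    w = weight w (partitions≤ k n)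
  S k -[1+ _ ] w = 0ℤ

  S-+ : ∀ k n w v → S k n (λ xs → w xs + v xs) ≡ S k n w + S k n v
  S-+ k -[1+ _ ] w v = refl
  S-+ k (+ n)    w v = go (partitions≤ k n)
    where
    interchange : ∀ a b c d → (a + b) + (c + d) ≡ (a + c) + (b + d)
    interchange = solveℤ
    go : ∀ xss → weight (λ xs → w xs + v xs) xss ≡ weight w xss + weight v xss
    go []         = refl
    go (xs ∷ xss) = trans (cong (_+_ (w xs + v xs)) (go xss)) (interchange (w xs) (v xs) _ _)

  S-scale : ∀ k n a w → S k n (λ xs → a * w xs) ≡ a * S k n w
  S-scale k -[1+ _ ] a w = sym (ℤ.*-zeroʳ a)
  S-scale k (+ n)    a w = go (partitions≤ k n)
    where
    go : ∀ xss → weight (λ xs → a * w xs) xss ≡ a * weight w xss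
    go []         = sym (ℤ.*-zeroʳ a)
    go (xs ∷ xss) = trans (cong (_+_ (a * w xs)) (go xss)) (sym (ℤ.*-distribˡ-+ a (w xs) _))

  S-≗ : ∀ k n {w v} → (∀ xs → w xs ≡ v xs) → S k n w ≡ S k n v
  S-≗ k -[1+ _ ] p = refl
  S-≗ k (+ n)    {w} {v} p = go (partitions≤ k n)
    where
    go : ∀ xss → weight w xss ≡ weight v xss
    go []         = refl
    go (xs ∷ xss) = cong₂ _+_ (p xs) (go xss)

  S-0 : ∀ k n → S k n (λ _ → 0ℤ) ≡ 0ℤ
  S-0 k n = trans (S-scale k n 0ℤ (λ _ → 0ℤ)) (ℤ.*-zeroˡ (S k n (λ _ → 0ℤ)))

  open Σℤ
  open Theta using (negative; negative-negative)

  S-Σ± : ∀ K k n (w : ℤ → List ℕ → ℤ) → S k n (λ xs → Σ± K (λ i → w i xs)) ≡ Σ± K (λ i → S k n (w i))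
  S-Σ± zero    k n w = refl
  S-Σ± (suc K) k n w = trans (S-+ k n _ _) (cong₂ _+_ (S-Σ± K k n w) (S-+ k n _ _))

  +-∸ : ∀ {m n} → n ℕ.≤ m → + m - + n ≡ + (m ∸ n)
  +-∸ {m} {n} n≤m = trans (ℤ.m-n≡m⊖n m n) (ℤ.⊖-≥ n≤m)

  -- Every counting argument below runs on this recursion: the part suc k is absent, or one copy of
  -- it is removed. It holds for all n in ℤ, as every term is 0 when n is negative.
  S-suc : ∀ k n w → S (suc k) n w ≡ S k n w + S (suc k) (n - + suc k) (w ∘ (suc k ∷_))
  S-suc k -[1+ m ] w with negative-negative m (suc k)
  ... | j , eq = cong (λ x → 0ℤ + S (suc k) x (w ∘ (suc k ∷_))) (sym eq)
  S-suc k (+ n) w with n ℕ.<? suc k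
  ... | yes n<k with negative n<k
  ...   | j , eq = begin
    weight w (partitions≤ (suc k) n)   ≡⟨ cong (weight w) (partitions≤-< n<k) ⟩
    S k (+ n) w                        ≡⟨ ℤ.+-identityʳ _ ⟨
    S k (+ n) w + 0ℤ                   ≡⟨ cong (λ x → S k (+ n) w + S (suc k) x (w ∘ (suc k ∷_))) eq ⟨
    S k (+ n) w + S (suc k) (+ n - + suc k) (w ∘ (suc k ∷_)) ∎
  S-suc k (+ n) w | no n≮k = begin
    weight w (partitions≤ (suc k) n)
      ≡⟨ cong (λ m → weight w (partitions≤ (suc k) m)) (ℕ.m+[n∸m]≡n k≤n) ⟨
    weight w (partitions≤ (suc k) (suc k ℕ.+ m))
      ≡⟨ cong (weight w) (partitions≤-≥ k m) ⟩
    weight w (partitions≤ k (suc k ℕ.+ m) ++ map (suc k ∷_) (partitions≤ (suc k) m))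
      ≡⟨ weight-++ w (partitions≤ k (suc k ℕ.+ m)) _ ⟩
    weight w (partitions≤ k (suc k ℕ.+ m)) + weight w (map (suc k ∷_) (partitions≤ (suc k) m))
      ≡⟨ cong₂ (λ x y → weight w (partitions≤ k x) + y) (ℕ.m+[n∸m]≡n k≤n) (weight-map w (suc k ∷_) (partitions≤ (suc k) m)) ⟩
    S k (+ n) w + S (suc k) (+ m) (w ∘ (suc k ∷_))
      ≡⟨ cong (λ x → S k (+ n) w + S (suc k) x (w ∘ (suc k ∷_))) (+-∸ k≤n) ⟨
    S k (+ n) w + S (suc k) (+ n - + suc k) (w ∘ (suc k ∷_)) ∎
    where
    k≤n : suc k ℕ.≤ n
    k≤n = ℕ.≮⇒≥ n≮k
    m : ℕ
    m = n ∸ suc k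

  -- The induction that fits `S-suc`: either the bound on the parts drops, or n drops by at least 1
  -- until it is negative.
  grid-induction : (Q : ℕ → ℤ → Set) → (∀ n → Q 0 n) → (∀ k j → Q k -[1+ j ]) →
    (∀ k n → Q k n → Q (suc k) (n - + suc k) → Q (suc k) n) → ∀ k n → Q k n
  grid-induction Q zero′ neg step k -[1+ j ] = neg k j
  grid-induction Q zero′ neg step k (+ n)    = go k (suc n) n (ℕ.n<1+n n)
    where
    go : ∀ k N n → n ℕ.< N → Q k (+ n)
    go zero    N       n n<N = zero′ (+ n)
    go (suc k) (suc N) n (s≤s n≤N) = step k (+ n) (go k (suc N) n (s≤s n≤N)) previous
      where
      previous : Q (suc k) (+ n - + suc k)
      previous with n ℕ.<? suc k
      ... | yes n<k = subst (Q (suc k)) (sym (proj₂ (negative n<k))) (neg (suc k) _)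
      ... | no  n≮k = subst (Q (suc k)) (sym (+-∸ (ℕ.≮⇒≥ n≮k)))
        (go (suc k) N (n ∸ suc k) (ℕ.≤-trans (ℕ.∸-monoʳ-< (s≤s z≤n) (ℕ.≮⇒≥ n≮k)) n≤N))

  -- The index n is an integer so that this predicate unfolds by the same subtraction as `S-suc`.
  data Part : ℕ → ℤ → List ℕ → Set where
    nil  : ∀ {k} → Part k 0ℤ []
    cons : ∀ {k a n xs} → a ℕ.< k → Part (suc a) (n - + suc a) xs → Part k n (suc a ∷ xs)

  Part-suc : ∀ {k n xs} → Part k n xs → Part (suc k) n xs
  Part-suc nil          = nil
  Part-suc (cons a<k p) = cons (ℕ.m<n⇒m<1+n a<k) p

  -- In contrast to `S-≗`, agreement is required only on actual partitions, so bounds on their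
  -- length and largest part become available.
  S-cong : ∀ k n {w v} → (∀ xs → Part k n xs → w xs ≡ v xs) → S k n w ≡ S k n v
  S-cong k n {w} {v} p = grid-induction
    (λ k n → ∀ w v → (∀ xs → Part k n xs → w xs ≡ v xs) → S k n w ≡ S k n v)
    (λ { (+ zero)  w v p → cong (_+ 0ℤ) (p [] nil)
       ; (+ suc n) w v p → refl
       ; -[1+ n ]  w v p → refl })
    (λ k j w v p → refl)
    (λ k n ih₁ ih₂ w v p → begin
      S (suc k) n w                                             ≡⟨ S-suc k n w ⟩
      S k n w + S (suc k) (n - + suc k) (w ∘ (suc k ∷_))
        ≡⟨ cong₂ _+_ (ih₁ w v λ xs part → p xs (Part-suc part))
                       (ih₂ _ _ λ xs part → p (suc k ∷ xs) (cons ℕ.≤-refl part)) ⟩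
      S k n v + S (suc k) (n - + suc k) (v ∘ (suc k ∷_))        ≡⟨ S-suc k n v ⟨
      S (suc k) n v                                             ∎)
    k n w v p

  S-stable : ∀ k d w → S (d ℕ.+ k) (+ k) w ≡ S k (+ k) w
  S-stable k zero    w = refl
  S-stable k (suc d) w = trans (cong (weight w) (partitions≤-< (s≤s (ℕ.m≤n+m k d)))) (S-stable k d w)

  S-zero : ∀ n w → S 0 n w ≡ ⟦ n ℤ.≟ 0ℤ ⟧ * w []
  S-zero (+ zero)  w = trans (ℤ.+-identityʳ (w [])) (sym (ℤ.*-identityˡ (w [])))
  S-zero (+ suc n) w = sym (ℤ.*-zeroˡ (w []))
  S-zero -[1+ n ]  w = sym (ℤ.*-zeroˡ (w []))

  S-zeros : ∀ k n {w} → (∀ xs → Part k n xs → w xs ≡ 0ℤ) → S k n w ≡ 0ℤ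
  S-zeros k n p = trans (S-cong k n p) (S-0 k n)

  -- Inequalities are rearranged through the difference of their sides, which leaves an equation for
  -- the ring solver.
  ⟦≤⟧-cong : ∀ i j i′ j′ → j - i ≡ j′ - i′ → ⟦ i ℤ.≤? j ⟧ ≡ ⟦ i′ ℤ.≤? j′ ⟧
  ⟦≤⟧-cong i j i′ j′ eq = ⟦⟧-cong (i ℤ.≤? j) (i′ ℤ.≤? j′)
    (λ i≤j → ℤ.0≤i-j⇒j≤i (subst (0ℤ ℤ.≤_) eq (ℤ.i≤j⇒0≤j-i i≤j)))
    (λ i≤j → ℤ.0≤i-j⇒j≤i (subst (0ℤ ℤ.≤_) (sym eq) (ℤ.i≤j⇒0≤j-i i≤j)))

  ⟦≡⟧-cong : ∀ i j i′ j′ → i - j ≡ i′ - j′ → ⟦ i ℤ.≟ j ⟧ ≡ ⟦ i′ ℤ.≟ j′ ⟧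
  ⟦≡⟧-cong i j i′ j′ eq = ⟦⟧-cong (i ℤ.≟ j) (i′ ℤ.≟ j′) (forward eq) (forward (sym eq))
    where
    forward : ∀ {i j i′ j′} → i - j ≡ i′ - j′ → i ≡ j → i′ ≡ j′
    forward {i} {i′ = i′} {j′} eq refl = ℤ.i-j≡0⇒i≡j i′ j′ (trans (sym eq) (ℤ.+-inverseʳ i))

  ⟦≰⟧ : ∀ i j → ⟦ 1ℤ + j ℤ.≤? i ⟧ ≡ 1ℤ - ⟦ i ℤ.≤? j ⟧
  ⟦≰⟧ i j with i ℤ.≤? j
  ... | yes i≤j = ⟦⟧-false (1ℤ + j ℤ.≤? i) λ j<i → ℤ.<⇒≱ (ℤ.suc[i]≤j⇒i<j j<i) i≤j
  ... | no  i≰j = ⟦⟧-true (1ℤ + j ℤ.≤? i) (ℤ.i<j⇒suc[i]≤j (ℤ.≰⇒> i≰j))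

  ⟦≤⟧-split : ∀ i j → ⟦ i ℤ.≤? j ⟧ ≡ ⟦ i ℤ.≤? j - 1ℤ ⟧ + ⟦ i ℤ.≟ j ⟧
  ⟦≤⟧-split i j with i ℤ.≟ j
  ... | yes refl = trans (⟦⟧-true (i ℤ.≤? i) ℤ.≤-refl) (cong (_+ 1ℤ) (sym (⟦⟧-false (i ℤ.≤? i - 1ℤ)
                       λ i≤ → ℤ.<-irrefl refl (ℤ.≤-<-trans i≤ (ℤ.suc[i]≤j⇒i<j (ℤ.≤-reflexive (suc-pred i)))))))
    where
    suc-pred : ∀ i → 1ℤ + (i - 1ℤ) ≡ i
    suc-pred = solveℤ
  ... | no i≢j = trans (⟦⟧-cong (i ℤ.≤? j) (i ℤ.≤? j - 1ℤ)
      (λ i≤j → subst (ℤ._≤ j - 1ℤ) (cancel i) (ℤ.+-monoˡ-≤ ℤ.-1ℤ (ℤ.i<j⇒suc[i]≤j (ℤ.≤∧≢⇒< i≤j i≢j))))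
      (λ i≤ → ℤ.≤-trans i≤ (ℤ.i≤j⇒i-k≤j (+ 1) ℤ.≤-refl)))
      (sym (ℤ.+-identityʳ _))
    where
    cancel : ∀ i → 1ℤ + i + ℤ.-1ℤ ≡ i
    cancel = solveℤ

  Part-length : ∀ {k n xs} → Part k n xs → ∃ λ d → n ≡ + (length xs ℕ.+ d)
  Part-length nil = 0 , refl
  Part-length {n = n} {xs = _ ∷ xs} (cons {a = a} _ p) with Part-length p
  ... | d , eq = a ℕ.+ d , move n (+ a) (+ length xs) (+ d) eq
    where
    move : ∀ n a l d → n - (1ℤ + a) ≡ l + d → n ≡ 1ℤ + (l + (a + d))
    move n a l d eq = trans (add n a) (trans (cong (_+ (1ℤ + a)) eq) (reorder a l d))
      where
      add : ∀ n a → n ≡ n - (1ℤ + a) + (1ℤ + a)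
      add = solveℤ
      reorder : ∀ a l d → l + d + (1ℤ + a) ≡ 1ℤ + (l + (a + d))
      reorder = solveℤ

  length≤ : ∀ {k m xs} → Part k (+ m) xs → length xs ℕ.≤ m
  length≤ {xs = xs} p with Part-length p
  ... | d , refl = ℕ.m≤m+n (length xs) d

  largest≤ : ∀ {k n xs} → Part k n xs → largest xs ℕ.≤ k
  largest≤ nil          = z≤n
  largest≤ (cons a<k p) = ℕ.⊔-lub a<k (ℕ.≤-trans (largest≤ p) a<k)

  S-largest≤ : ∀ d c n w → S (d ℕ.+ c) n (λ xs → ⟦ + largest xs ℤ.≤? + c ⟧ * w xs) ≡ S c n w
  S-largest≤ zero    c n w = S-cong c n λ xs p → trans
    (cong (_* w xs) (⟦⟧-true (+ largest xs ℤ.≤? + c) (ℤ.+≤+ (largest≤ p)))) (ℤ.*-identityˡ (w xs))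
  S-largest≤ (suc d) c n w = trans (S-suc (d ℕ.+ c) n _) (trans (cong₂ _+_ (S-largest≤ d c n w)
    (S-zeros _ (n - + suc (d ℕ.+ c)) λ xs _ → *-annihilˡ (w (suc (d ℕ.+ c) ∷ xs)) (⟦⟧-false (+ largest (suc (d ℕ.+ c) ∷ xs) ℤ.≤? + c) λ { (ℤ.+≤+ l≤c) →
        ℕ.<-irrefl refl (ℕ.≤-trans (s≤s (ℕ.m≤n+m c d)) (ℕ.≤-trans (ℕ.m≤m⊔n (suc (d ℕ.+ c)) (largest xs)) l≤c)) }))) (ℤ.+-identityʳ _))

  -- The value 0 at negative bounds lets the width of a box range over ℤ, so that index shifts need
  -- no side conditions.
  Sᶻ : ℤ → ℤ → (List ℕ → ℤ) → ℤ
  Sᶻ (+ c)    n w = S c n w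
  Sᶻ -[1+ _ ] n w = 0ℤ

  partitions-largest≤ : ∀ c m w → S m (+ m) (λ xs → ⟦ + largest xs ℤ.≤? c ⟧ * w xs) ≡ Sᶻ c (+ m) w
  partitions-largest≤ -[1+ c ] m w = S-zeros m (+ m) λ xs _ → *-annihilˡ (w xs) (⟦⟧-false (+ largest xs ℤ.≤? -[1+ c ]) λ ())
  partitions-largest≤ (+ c) m w = trans (sym (S-stable m c _))
    (trans (cong (λ k → S k (+ m) (λ xs → ⟦ + largest xs ℤ.≤? + c ⟧ * w xs)) (ℕ.+-comm c m)) (S-largest≤ m c (+ m) w))

  -- Largest part exactly a + 1 is the difference of the bounds a + 1 and a, and `S-suc` expresses
  -- this difference through the removal of one part.
  partitions-largest≡ : ∀ a m w →
    S m (+ m) (λ xs → ⟦ + largest xs ℤ.≟ + suc a ⟧ * w xs) ≡ S (suc a) (+ m - + suc a) (w ∘ (suc a ∷_))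
  partitions-largest≡ a m w = cancelˡ (S a (+ m) w) (begin
    S a (+ m) w + S m (+ m) (λ xs → ⟦ + largest xs ℤ.≟ + suc a ⟧ * w xs)
      ≡⟨ cong (_+ S m (+ m) (λ xs → ⟦ + largest xs ℤ.≟ + suc a ⟧ * w xs)) (partitions-largest≤ (+ a) m w) ⟨
    S m (+ m) (λ xs → ⟦ + largest xs ℤ.≤? + a ⟧ * w xs) + S m (+ m) (λ xs → ⟦ + largest xs ℤ.≟ + suc a ⟧ * w xs)
      ≡⟨ S-+ m (+ m) _ _ ⟨
    S m (+ m) (λ xs → ⟦ + largest xs ℤ.≤? + a ⟧ * w xs + ⟦ + largest xs ℤ.≟ + suc a ⟧ * w xs)
      ≡⟨ S-≗ m (+ m) (λ xs → trans (sym (ℤ.*-distribʳ-+ (w xs) ⟦ + largest xs ℤ.≤? + a ⟧ _))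
           (cong (_* w xs) (sym (⟦≤⟧-split (+ largest xs) (+ suc a))))) ⟩
    S m (+ m) (λ xs → ⟦ + largest xs ℤ.≤? + suc a ⟧ * w xs)
      ≡⟨ partitions-largest≤ (+ suc a) m w ⟩
    S (suc a) (+ m) w
      ≡⟨ S-suc a (+ m) w ⟩
    S a (+ m) w + S (suc a) (+ m - + suc a) (w ∘ (suc a ∷_)) ∎)
    where
    cancelˡ : ∀ x {y z} → x + y ≡ x + z → y ≡ z
    cancelˡ x {y} {z} eq = trans (peel x y) (trans (cong (_- x) eq) (sym (peel x z)))
      where
      peel : ∀ x y → y ≡ x + y - x
      peel = solveℤ

-- Rank counts and Dyson's recurrence

module RankCounts where
  open import Data.Integer.Base using (_+_; _-_; _*_; -_)
  open ≡ using (refl; sym; trans; cong; cong₂)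
  open Weights
  open Σℤ
  open Theta using (Array; Vanishes; mk; ∇; heat; negative; negative-negative)
  open ≡-Reasoning

  len len≤ : ℤ → List ℕ → ℤ
  len  s xs = ⟦ + length xs ℤ.≟ s ⟧
  len≤ s xs = ⟦ + length xs ℤ.≤? s ⟧

  len-∷ : ∀ s x xs → len s (x ∷ xs) ≡ len (s - 1ℤ) xs
  len-∷ s x xs = ⟦≡⟧-cong (+ length (x ∷ xs)) s (+ length xs) (s - 1ℤ) (move (+ length xs) s)
    where
    move : ∀ l s → 1ℤ + l - s ≡ l - (s - 1ℤ)
    move = solveℤ

  len≤-∷ : ∀ s x xs → len≤ s (x ∷ xs) ≡ len≤ (s - 1ℤ) xs
  len≤-∷ s x xs = ⟦≤⟧-cong (+ length (x ∷ xs)) s (+ length xs) (s - 1ℤ) (move (+ length xs) s)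
    where
    move : ∀ l s → s - (1ℤ + l) ≡ s - 1ℤ - l
    move = solveℤ

  -- Removing the first column of a Young diagram with exactly s rows.
  column : ∀ a s n → S (suc a) n (len s) ≡ S a (n - s) (len≤ s)
  column a s n = grid-induction Q (λ _ → tt) negatives step (suc a) n s
    where
    Q : ℕ → ℤ → Set
    Q zero    n = ⊤
    Q (suc a) n = ∀ s → S (suc a) n (len s) ≡ S a (n - s) (len≤ s)
    negatives : ∀ k j → Q k -[1+ j ]
    negatives zero    j = tt
    negatives (suc a) j (+ s) with negative-negative j s
    ... | i , eq = cong (λ x → S a x (len≤ (+ s))) (sym eq)
    negatives (suc a) j -[1+ s ] = sym (S-zeros a (-[1+ j ] - -[1+ s ]) λ _ _ → refl)
    unfold : ∀ k n s → S (suc k) n (len s) ≡ S k n (len s) + S (suc k) (n - + suc k) (len (s - 1ℤ))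
    unfold k n s = trans (S-suc k n (len s)) (cong (_+_ (S k n (len s))) (S-≗ (suc k) (n - + suc k) (len-∷ s (suc k))))
    unfold≤ : ∀ k n s → S (suc k) n (len≤ s) ≡ S k n (len≤ s) + S (suc k) (n - + suc k) (len≤ (s - 1ℤ))
    unfold≤ k n s = trans (S-suc k n (len≤ s)) (cong (_+_ (S k n (len≤ s))) (S-≗ (suc k) (n - + suc k) (len≤-∷ s (suc k))))
    step : ∀ k n → Q k n → Q (suc k) (n - + suc k) → Q (suc k) n
    -- Bound 1 is the true base case: at bound 0 the induction carries no information, and both
    -- sides reduce to sums over the empty partition.
    step zero n _ ih s = begin
      S 1 n (len s)
        ≡⟨ unfold 0 n s ⟩
      S 0 n (len s) + S 1 (n - 1ℤ) (len (s - 1ℤ))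
        ≡⟨ cong₂ _+_ (S-zero n (len s)) (trans (ih (s - 1ℤ)) (S-zero (n - 1ℤ - (s - 1ℤ)) (len≤ (s - 1ℤ)))) ⟩
      ⟦ n ℤ.≟ 0ℤ ⟧ * len s [] + ⟦ n - 1ℤ - (s - 1ℤ) ℤ.≟ 0ℤ ⟧ * len≤ (s - 1ℤ) []
        ≡⟨ cong (λ x → ⟦ n ℤ.≟ 0ℤ ⟧ * len s [] + ⟦ x ℤ.≟ 0ℤ ⟧ * len≤ (s - 1ℤ) []) (cancel n s) ⟩
      ⟦ n ℤ.≟ 0ℤ ⟧ * len s [] + ⟦ n - s ℤ.≟ 0ℤ ⟧ * len≤ (s - 1ℤ) []
        ≡⟨ cases s ⟩
      ⟦ n - s ℤ.≟ 0ℤ ⟧ * len≤ s []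
        ≡⟨ S-zero (n - s) (len≤ s) ⟨
      S 0 (n - s) (len≤ s) ∎
      where
      cancel : ∀ n s → n - 1ℤ - (s - 1ℤ) ≡ n - s
      cancel = solveℤ
      cases : ∀ s → ⟦ n ℤ.≟ 0ℤ ⟧ * len s [] + ⟦ n - s ℤ.≟ 0ℤ ⟧ * len≤ (s - 1ℤ) [] ≡ ⟦ n - s ℤ.≟ 0ℤ ⟧ * len≤ s []
      cases (+ zero)  = trans (cong₂ _+_ (cong (λ x → ⟦ x ℤ.≟ 0ℤ ⟧ * 1ℤ) (sym (ℤ.+-identityʳ n)))
                          (ℤ.*-zeroʳ ⟦ n - 0ℤ ℤ.≟ 0ℤ ⟧)) (ℤ.+-identityʳ _)
      cases (+ suc s) = trans (cong (_+ ⟦ n - + suc s ℤ.≟ 0ℤ ⟧ * 1ℤ) (ℤ.*-zeroʳ ⟦ n ℤ.≟ 0ℤ ⟧)) (ℤ.+-identityˡ _)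
      cases -[1+ s ]  = trans (cong₂ _+_ (ℤ.*-zeroʳ ⟦ n ℤ.≟ 0ℤ ⟧) (ℤ.*-zeroʳ ⟦ n - -[1+ s ] ℤ.≟ 0ℤ ⟧)) (sym (ℤ.*-zeroʳ ⟦ n - -[1+ s ] ℤ.≟ 0ℤ ⟧))
    step (suc a) n ih₁ ih₂ s = begin
      S (suc (suc a)) n (len s)
        ≡⟨ unfold (suc a) n s ⟩
      S (suc a) n (len s) + S (suc (suc a)) (n - + suc (suc a)) (len (s - 1ℤ))
        ≡⟨ cong₂ _+_ (ih₁ s) (ih₂ (s - 1ℤ)) ⟩
      S a (n - s) (len≤ s) + S (suc a) (n - + suc (suc a) - (s - 1ℤ)) (len≤ (s - 1ℤ))
        ≡⟨ cong (λ x → S a (n - s) (len≤ s) + S (suc a) x (len≤ (s - 1ℤ))) (regroup n (+ suc a) s) ⟩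
      S a (n - s) (len≤ s) + S (suc a) (n - s - + suc a) (len≤ (s - 1ℤ))
        ≡⟨ unfold≤ a (n - s) s ⟨
      S (suc a) (n - s) (len≤ s) ∎
      where
      regroup : ∀ n a s → n - (1ℤ + a) - (s - 1ℤ) ≡ n - s - a
      regroup = solveℤ

  -- For a, s ≥ 0 the coefficient of qⁿ in the Gaussian binomial of a + s over s, and 0 for all
  -- other a, s.
  box : ℤ → ℤ → ℤ → ℤ
  box a s n = Sᶻ a n (len≤ s)

  box-negative-total : ∀ a s j → box a s -[1+ j ] ≡ 0ℤ
  box-negative-total (+ a)    s j = refl
  box-negative-total -[1+ a ] s j = refl

  box-negative-length : ∀ a s n → box a -[1+ s ] n ≡ 0ℤ
  box-negative-length (+ a)    s n = S-zeros a n λ _ _ → refl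
  box-negative-length -[1+ a ] s n = refl

  pTotal : ℤ → ℤ
  pTotal n = S ∣ n ∣ n (λ _ → 1ℤ)

  L : Array
  L k n = S ∣ n ∣ n (λ xs → ⟦ rank xs ℤ.≤? k ⟧)

  L-vanishes : Vanishes L
  L-vanishes = mk λ _ _ → refl

  ∇L≡N : ∀ k n → ∇ L k (+ n) ≡ N k n
  ∇L≡N k n = begin
    L k (+ n) - L (k - 1ℤ) (+ n)
      ≡⟨ cong (_- L (k - 1ℤ) (+ n)) (trans (S-≗ n (+ n) (λ xs → ⟦≤⟧-split (rank xs) k)) (S-+ n (+ n) _ _)) ⟩
    L (k - 1ℤ) (+ n) + S n (+ n) (λ xs → ⟦ rank xs ℤ.≟ k ⟧) - L (k - 1ℤ) (+ n)
      ≡⟨ cancel (L (k - 1ℤ) (+ n)) _ ⟩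
    S n (+ n) (λ xs → ⟦ rank xs ℤ.≟ k ⟧)
      ≡⟨ weight-filter (λ xs → rank xs ℤ.≟ k) (partitions n) ⟨
    N k n ∎
    where
    cancel : ∀ x y → x + y - x ≡ y
    cancel = solveℤ

  -- The empty partition has no first column and no first row to remove.
  emptyColumn emptyRow : ℤ → ℤ → ℤ
  emptyColumn k n = ⟦ k ℤ.≟ 0ℤ ⟧ * ⟦ n ℤ.≟ 0ℤ ⟧
  emptyRow    k n = ⟦ k ℤ.≟ ℤ.-1ℤ ⟧ * ⟦ n ℤ.≟ 0ℤ ⟧

  -- With ℓ parts, rank ≤ k means largest part ≤ ℓ + k; without the first column there remain at
  -- most ℓ parts, all ≤ ℓ + k - 1. With largest part a, rank > k means at most a - k - 1 parts;
  -- without the largest one there remain at most a - k - 2 parts, all ≤ a.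
  byLength byLargest : ℤ → ℤ → ℤ → ℤ
  byLength  k n ℓ = box (ℓ + k - 1ℤ) ℓ (n - ℓ)
  byLargest k n a = box a (a - k - + 2) (n - a)

  -- At c = 0 the box would have width -1 and counts nothing, whereas the empty partition has parts
  -- ≤ 0; the last term restores it.
  length-column : ∀ c ℓ n → Sᶻ c n (len ℓ) ≡ box (c - 1ℤ) ℓ (n - ℓ) + ⟦ c ℤ.≟ 0ℤ ⟧ * (⟦ n ℤ.≟ 0ℤ ⟧ * len ℓ [])
  length-column (+ zero)  ℓ n = trans (S-zero n (len ℓ)) (trans (sym (ℤ.*-identityˡ _)) (sym (ℤ.+-identityˡ _)))
  length-column (+ suc c) ℓ n = trans (column c ℓ n) (sym (ℤ.+-identityʳ _))
  length-column -[1+ c ]  ℓ n = refl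

  -- The two sums are exchanged: each partition contributes only at ℓ = `length xs`. The correction
  -- is concentrated at ℓ = 0, the length of the empty partition.
  L-byLength : ∀ k n → Sums (byLength k n) (L k n - emptyColumn k n)
  L-byLength k -[1+ j ] = sums-cong (λ ℓ → sym (zeroTerm ℓ)) (sym zero-total) sums-0
    where
    zero-total : L k -[1+ j ] - emptyColumn k -[1+ j ] ≡ 0ℤ
    zero-total = cong (λ x → 0ℤ - x) (ℤ.*-zeroʳ ⟦ k ℤ.≟ 0ℤ ⟧)
    zeroTerm : ∀ ℓ → byLength k -[1+ j ] ℓ ≡ 0ℤ
    zeroTerm (+ ℓ) with negative-negative j ℓ
    ... | i , eq = trans (cong (box (+ ℓ + k - 1ℤ) (+ ℓ)) eq) (box-negative-total (+ ℓ + k - 1ℤ) (+ ℓ) i)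
    zeroTerm -[1+ ℓ ] = box-negative-length (-[1+ ℓ ] + k - 1ℤ) ℓ (-[1+ j ] - -[1+ ℓ ])
  L-byLength k (+ m) = sums-cong isolate (cong (_+_ (L k (+ m))) (ℤ.-1*i≡-i _))
    (sums-+ exact (sums-scale ℤ.-1ℤ exception))
    where
    w : ℤ → List ℕ → ℤ
    w ℓ xs = ⟦ + largest xs ℤ.≤? ℓ + k ⟧ * len ℓ xs
    exceptional : ℤ → ℤ
    exceptional ℓ = ⟦ ℓ + k ℤ.≟ 0ℤ ⟧ * (⟦ + m ℤ.≟ 0ℤ ⟧ * len ℓ [])
    exception : Sums exceptional (emptyColumn k (+ m))
    exception = sums-cong (λ _ → refl)
      (cong₂ _*_ (cong (λ x → ⟦ x ℤ.≟ 0ℤ ⟧) (ℤ.+-identityˡ k)) (ℤ.*-identityʳ ⟦ + m ℤ.≟ 0ℤ ⟧))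
      (sums-single {exceptional} 0ℤ λ ℓ ℓ≢0 → trans (cong (λ x → ⟦ ℓ + k ℤ.≟ 0ℤ ⟧ * (⟦ + m ℤ.≟ 0ℤ ⟧ * x))
        (⟦⟧-false (0ℤ ℤ.≟ ℓ) (ℓ≢0 ∘ sym))) (*-annihilʳ ⟦ ℓ + k ℤ.≟ 0ℤ ⟧ (ℤ.*-zeroʳ ⟦ + m ℤ.≟ 0ℤ ⟧)))
    isolate : ∀ ℓ → S m (+ m) (w ℓ) + ℤ.-1ℤ * exceptional ℓ ≡ byLength k (+ m) ℓ
    isolate ℓ = trans (cong (_+ ℤ.-1ℤ * exceptional ℓ)
        (trans (partitions-largest≤ (ℓ + k) m (len ℓ)) (length-column (ℓ + k) ℓ (+ m))))
      (cancel (byLength k (+ m) ℓ) (exceptional ℓ))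
      where
      cancel : ∀ x y → x + y + ℤ.-1ℤ * y ≡ x
      cancel = solveℤ
    exact : Sums (λ ℓ → S m (+ m) (w ℓ)) (L k (+ m))
    exact = sums m
      (λ ℓ m<ℓ → S-zeros m (+ m) λ xs p → *-annihilʳ ⟦ + largest xs ℤ.≤? ℓ + k ⟧ (⟦⟧-false (+ length xs ℤ.≟ ℓ) λ { refl → ℕ.<⇒≱ m<ℓ (length≤ p) }))
      (trans (sym (S-Σ± m m (+ m) w)) (S-cong m (+ m) λ xs p → trans
        (sums-at (sums-single {λ ℓ → w ℓ xs} (+ length xs) λ ℓ ℓ≢ → *-annihilʳ ⟦ + largest xs ℤ.≤? ℓ + k ⟧ (⟦⟧-false (+ length xs ℤ.≟ ℓ) (ℓ≢ ∘ sym))) (length≤ p))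
        (trans (cong (⟦ + largest xs ℤ.≤? + length xs + k ⟧ *_) (⟦⟧-true (+ length xs ℤ.≟ + length xs) refl))
        (trans (ℤ.*-identityʳ _) (⟦≤⟧-cong (+ largest xs) (+ length xs + k) (rank xs) k (move (+ largest xs) (+ length xs) k))))))
      where
      move : ∀ a l k → l + k - a ≡ k - (a - l)
      move = solveℤ

  -- Partitions of rank > k are sorted by their largest part a. For a > 0 a row can be removed; only
  -- a = 0 needs a correction.
  L-byLargest : ∀ k n → Sums (byLargest k n) (pTotal n - L k n - emptyRow k n)
  L-byLargest k -[1+ j ] = sums-cong (λ a → sym (zeroTerm a)) (sym zero-total) sums-0
    where
    zero-total : 0ℤ - emptyRow k -[1+ j ] ≡ 0ℤ
    zero-total = cong (λ x → 0ℤ - x) (ℤ.*-zeroʳ ⟦ k ℤ.≟ ℤ.-1ℤ ⟧)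
    zeroTerm : ∀ a → byLargest k -[1+ j ] a ≡ 0ℤ
    zeroTerm (+ a) with negative-negative j a
    ... | i , eq = cong (box (+ a) (+ a - k - + 2)) eq
    zeroTerm -[1+ a ] = refl
  L-byLargest k (+ m) = sums-cong isolate (cong (_+_ (pTotal (+ m) - L k (+ m))) (ℤ.-1*i≡-i _))
    (sums-+ exact (sums-scale ℤ.-1ℤ exception))
    where
    w : ℤ → List ℕ → ℤ
    w a xs = ⟦ + largest xs ℤ.≟ a ⟧ * len≤ (a - k - 1ℤ) xs
    exceptional : ℤ → ℤ
    exceptional a = ⟦ a ℤ.≟ 0ℤ ⟧ * emptyRow k (+ m)
    exception : Sums exceptional (emptyRow k (+ m))
    exception = sums-cong (λ _ → refl) (ℤ.*-identityˡ _)
      (sums-single {exceptional} 0ℤ λ a a≢0 → *-annihilˡ (emptyRow k (+ m)) (⟦⟧-false (a ℤ.≟ 0ℤ) a≢0))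
    -- Removing a row would lower the bound on the length from -k - 1 to -k - 2; on the empty
    -- partition the two bounds disagree only at k = -1.
    emptyCase : ∀ k → len≤ (0ℤ - k - 1ℤ) [] ≡ len≤ (0ℤ - k - + 2) [] + ⟦ k ℤ.≟ ℤ.-1ℤ ⟧
    emptyCase (+ zero)            = refl
    emptyCase (+ suc k)           = refl
    emptyCase -[1+ zero ]         = refl
    emptyCase -[1+ suc zero ]     = refl
    emptyCase -[1+ suc (suc k) ]  = refl
    isolate : ∀ a → S m (+ m) (w a) + ℤ.-1ℤ * exceptional a ≡ byLargest k (+ m) a
    isolate (+ zero) = begin
      S m (+ m) (w 0ℤ) + ℤ.-1ℤ * exceptional 0ℤ
        ≡⟨ cong (_+ ℤ.-1ℤ * exceptional 0ℤ) (S-≗ m (+ m) λ xs → cong (_* len≤ (0ℤ - k - 1ℤ) xs)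
             (⟦⟧-cong (+ largest xs ℤ.≟ 0ℤ) (+ largest xs ℤ.≤? 0ℤ) ℤ.≤-reflexive (λ l≤0 → ℤ.≤-antisym l≤0 (ℤ.+≤+ z≤n)))) ⟩
      S m (+ m) (λ xs → ⟦ + largest xs ℤ.≤? 0ℤ ⟧ * len≤ (0ℤ - k - 1ℤ) xs) + ℤ.-1ℤ * exceptional 0ℤ
        ≡⟨ cong (_+ ℤ.-1ℤ * exceptional 0ℤ) (trans (partitions-largest≤ 0ℤ m _) (S-zero (+ m) _)) ⟩
      ⟦ + m ℤ.≟ 0ℤ ⟧ * len≤ (0ℤ - k - 1ℤ) [] + ℤ.-1ℤ * exceptional 0ℤ
        ≡⟨ cong (λ x → ⟦ + m ℤ.≟ 0ℤ ⟧ * x + ℤ.-1ℤ * exceptional 0ℤ) (emptyCase k) ⟩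
      ⟦ + m ℤ.≟ 0ℤ ⟧ * (len≤ (0ℤ - k - + 2) [] + ⟦ k ℤ.≟ ℤ.-1ℤ ⟧) + ℤ.-1ℤ * (1ℤ * (⟦ k ℤ.≟ ℤ.-1ℤ ⟧ * ⟦ + m ℤ.≟ 0ℤ ⟧))
        ≡⟨ cancel ⟦ + m ℤ.≟ 0ℤ ⟧ (len≤ (0ℤ - k - + 2) []) ⟦ k ℤ.≟ ℤ.-1ℤ ⟧ ⟩
      ⟦ + m ℤ.≟ 0ℤ ⟧ * len≤ (0ℤ - k - + 2) []
        ≡⟨ S-zero (+ m) _ ⟨
      S 0 (+ m) (len≤ (0ℤ - k - + 2))
        ≡⟨ cong (λ x → S 0 x (len≤ (0ℤ - k - + 2))) (ℤ.+-identityʳ (+ m)) ⟨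
      byLargest k (+ m) 0ℤ ∎
      where
      cancel : ∀ a b c → a * (b + c) + ℤ.-1ℤ * (1ℤ * (c * a)) ≡ a * b
      cancel = solveℤ
    isolate (+ suc a) = begin
      S m (+ m) (w (+ suc a)) + 0ℤ
        ≡⟨ ℤ.+-identityʳ _ ⟩
      S m (+ m) (w (+ suc a))
        ≡⟨ partitions-largest≡ a m (len≤ (+ suc a - k - 1ℤ)) ⟩
      S (suc a) (+ m - + suc a) (λ xs → len≤ (+ suc a - k - 1ℤ) (suc a ∷ xs))
        ≡⟨ S-≗ (suc a) (+ m - + suc a) (λ xs → trans (len≤-∷ (+ suc a - k - 1ℤ) (suc a) xs) (cong (λ s → len≤ s xs) (regroup (+ suc a) k))) ⟩
      byLargest k (+ m) (+ suc a) ∎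
      where
      regroup : ∀ a k → a - k - 1ℤ - 1ℤ ≡ a - k - + 2
      regroup = solveℤ
    isolate -[1+ a ] = trans (ℤ.+-identityʳ _) (S-zeros m (+ m) λ xs _ → refl)
    exact : Sums (λ a → S m (+ m) (w a)) (pTotal (+ m) - L k (+ m))
    exact = sums m
      (λ a m<a → S-zeros m (+ m) λ xs p → *-annihilˡ (len≤ (a - k - 1ℤ) xs) (⟦⟧-false (+ largest xs ℤ.≟ a) λ { refl → ℕ.<⇒≱ m<a (largest≤ p) }))
      (begin
        Σ± m (λ a → S m (+ m) (w a))
          ≡⟨ S-Σ± m m (+ m) w ⟨
        S m (+ m) (λ xs → Σ± m (λ a → w a xs))
          ≡⟨ S-cong m (+ m) (λ xs p → trans
               (sums-at (sums-single {λ a → w a xs} (+ largest xs) λ a a≢ → *-annihilˡ (len≤ (a - k - 1ℤ) xs) (⟦⟧-false (+ largest xs ℤ.≟ a) (a≢ ∘ sym))) (largest≤ p))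
               (trans (cong (_* len≤ (+ largest xs - k - 1ℤ) xs) (⟦⟧-true (+ largest xs ℤ.≟ + largest xs) refl))
               (trans (ℤ.*-identityˡ _)
               (trans (⟦≤⟧-cong (+ length xs) (+ largest xs - k - 1ℤ) (1ℤ + k) (rank xs) (move (+ largest xs) (+ length xs) k))
               (trans (⟦≰⟧ (rank xs) k) (cong (_+_ 1ℤ) (sym (ℤ.-1*i≡-i ⟦ rank xs ℤ.≤? k ⟧)))))))) ⟩
        S m (+ m) (λ xs → 1ℤ + ℤ.-1ℤ * ⟦ rank xs ℤ.≤? k ⟧)
          ≡⟨ S-+ m (+ m) _ _ ⟩
        pTotal (+ m) + S m (+ m) (λ xs → ℤ.-1ℤ * ⟦ rank xs ℤ.≤? k ⟧)
          ≡⟨ cong (_+_ (pTotal (+ m))) (trans (S-scale m (+ m) ℤ.-1ℤ _) (ℤ.-1*i≡-i _)) ⟩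
        pTotal (+ m) - L k (+ m) ∎)
      where
      move : ∀ a l k → a - k - 1ℤ - l ≡ a - l - (1ℤ + k)
      move = solveℤ

  -- Both sides count boxes, transposed by a = ℓ + k + 2.
  L-recurrence : ∀ k n → pTotal n - L k n - emptyRow k n ≡ L (k + + 3) (n - k - + 2) - emptyColumn (k + + 3) (n - k - + 2)
  L-recurrence k n = sums-unique (sums-shift (k + + 2) (L-byLargest k n)) (L-byLength (k + + 3) (n - k - + 2))
    λ ℓ → box-cong (first ℓ k) (second ℓ k) (third n k ℓ)
    where
    box-cong : ∀ {a b c a′ b′ c′} → a ≡ a′ → b ≡ b′ → c ≡ c′ → box a b c ≡ box a′ b′ c′
    box-cong refl refl refl = refl
    first : ∀ ℓ k → ℓ + (k + + 2) ≡ ℓ + (k + + 3) - 1ℤ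
    first = solveℤ
    second : ∀ ℓ k → ℓ + (k + + 2) - k - + 2 ≡ ℓ
    second = solveℤ
    third : ∀ n k ℓ → n - (ℓ + (k + + 2)) ≡ n - k - + 2 - ℓ
    third = solveℤ

  -- The factor vanishes at the two exceptions (k , n) = (-1 , 0) and (-3 , -1).
  heat-recurrence : ∀ k n → heat k n * (L k n + L (k + + 3) (n - k - + 2)) ≡ heat k n * pTotal n
  heat-recurrence k n = begin
    heat k n * (L k n + L (k + + 3) (n - k - + 2))
      ≡⟨ split (heat k n) (L k n) _ (emptyColumn (k + + 3) (n - k - + 2)) ⟩
    heat k n * (L k n + (L (k + + 3) (n - k - + 2) - emptyColumn (k + + 3) (n - k - + 2)))
      + heat k n * emptyColumn (k + + 3) (n - k - + 2)
      ≡⟨ cong₂ (λ x y → heat k n * (L k n + x) + y) (sym (L-recurrence k n)) columnException ⟩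
    heat k n * (L k n + (pTotal n - L k n - emptyRow k n)) + 0ℤ
      ≡⟨ collect (heat k n) (L k n) (pTotal n) (emptyRow k n) ⟩
    heat k n * pTotal n - heat k n * emptyRow k n
      ≡⟨ cong (λ x → heat k n * pTotal n - x) rowException ⟩
    heat k n * pTotal n - 0ℤ
      ≡⟨ ℤ.+-identityʳ _ ⟩
    heat k n * pTotal n ∎
    where
    split : ∀ h l x e → h * (l + x) ≡ h * (l + (x - e)) + h * e
    split = solveℤ
    collect : ∀ h l p e → h * (l + (p - l - e)) + 0ℤ ≡ h * p - h * e
    collect = solveℤ
    rowException : heat k n * emptyRow k n ≡ 0ℤ
    rowException with k ℤ.≟ ℤ.-1ℤ | n ℤ.≟ 0ℤ
    ... | yes refl | yes refl = refl
    ... | yes _      | no _       = ℤ.*-zeroʳ (heat k n)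
    ... | no _       | yes _      = ℤ.*-zeroʳ (heat k n)
    ... | no _       | no _       = ℤ.*-zeroʳ (heat k n)
    columnException : heat k n * emptyColumn (k + + 3) (n - k - + 2) ≡ 0ℤ
    columnException with k + + 3 ℤ.≟ 0ℤ | n - k - + 2 ℤ.≟ 0ℤ
    ... | no _     | yes _  = ℤ.*-zeroʳ (heat k n)
    ... | no _     | no _   = ℤ.*-zeroʳ (heat k n)
    ... | yes _    | no _   = ℤ.*-zeroʳ (heat k n)
    ... | yes k+3≡0 | yes n-k-2≡0 = trans (cong₂ (λ k n → heat k n * 1ℤ) k≡-3 n≡-1) refl
      where
      k≡-3 : k ≡ -[1+ 2 ]
      k≡-3 = ℤ.i-j≡0⇒i≡j k -[1+ 2 ] k+3≡0
      back : ∀ n → n ≡ n - -[1+ 2 ] - + 2 - 1ℤ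
      back = solveℤ
      n≡-1 : n ≡ ℤ.-1ℤ
      n≡-1 = trans (back n) (cong (_- 1ℤ) (trans (cong (λ k → n - k - + 2) (sym k≡-3)) n-k-2≡0))

  -- The shifted point of `L-recurrence` has n - k - 2 < 0 and contributes nothing.
  L-high : ∀ n k → n ℕ.≤ k → L (+ k) (+ n) ≡ pTotal (+ n)
  L-high n k n≤k = begin
    L (+ k) (+ n)
      ≡⟨ isolate (pTotal (+ n)) (L (+ k) (+ n)) ⟩
    pTotal (+ n) - (pTotal (+ n) - L (+ k) (+ n) - 0ℤ)
      ≡⟨ cong (λ x → pTotal (+ n) - x) (trans (L-recurrence (+ k) (+ n)) zeros) ⟩
    pTotal (+ n) - 0ℤ
      ≡⟨ ℤ.+-identityʳ _ ⟩
    pTotal (+ n) ∎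
    where
    isolate : ∀ p l → l ≡ p - (p - l - 0ℤ)
    isolate = solveℤ
    regroup : ∀ n k → n - k - + 2 ≡ n - (k + + 2)
    regroup = solveℤ
    zeros : L (+ k + + 3) (+ n - + k - + 2) - emptyColumn (+ k + + 3) (+ n - + k - + 2) ≡ 0ℤ
    zeros with negative {n} {k ℕ.+ 2} (ℕ.≤-<-trans n≤k (ℕ.m<m+n k (s≤s z≤n)))
    ... | j , eq rewrite trans (regroup (+ n) (+ k)) eq = cong (λ x → 0ℤ - x) (ℤ.*-zeroʳ ⟦ + k + + 3 ℤ.≟ 0ℤ ⟧)

  -- `L-recurrence` is read backwards: `k′` , `n′` is the point whose shift is (-[1+ k ] , n), and
  -- there n′ < 0.
  L-low : ∀ n k → n ℕ.≤ k → L -[1+ k ] (+ n) ≡ 0ℤ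
  L-low n k n≤k = begin
    L -[1+ k ] (+ n)
      ≡⟨ cong₂ L (index -[1+ k ]) (exponent (+ n) (+ k)) ⟩
    L (k′ + + 3) (n′ - k′ - + 2)
      ≡⟨ ℤ.+-identityʳ _ ⟨
    L (k′ + + 3) (n′ - k′ - + 2) - 0ℤ
      ≡⟨ cong (λ x → L (k′ + + 3) (n′ - k′ - + 2) - ⟦ x ℤ.≟ 0ℤ ⟧ * ⟦ n′ - k′ - + 2 ℤ.≟ 0ℤ ⟧) (index -[1+ k ]) ⟩
    L (k′ + + 3) (n′ - k′ - + 2) - emptyColumn (k′ + + 3) (n′ - k′ - + 2)
      ≡⟨ L-recurrence k′ n′ ⟨
    pTotal n′ - L k′ n′ - emptyRow k′ n′
      ≡⟨ zeros ⟩
    0ℤ ∎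
    where
    k′ n′ : ℤ
    k′ = -[1+ k ] - + 3
    n′ = + n - (+ k + + 2)
    index : ∀ k → k ≡ k - + 3 + + 3
    index = solveℤ
    exponent : ∀ n k → n ≡ n - (k + + 2) - (- (1ℤ + k) - + 3) - + 2
    exponent = solveℤ
    zeros : pTotal n′ - L k′ n′ - emptyRow k′ n′ ≡ 0ℤ
    zeros with negative {n} {k ℕ.+ 2} (ℕ.≤-<-trans n≤k (ℕ.m<m+n k (s≤s z≤n)))
    ... | j , eq rewrite eq = cong (λ x → 0ℤ - x) (ℤ.*-zeroʳ ⟦ k′ ℤ.≟ ℤ.-1ℤ ⟧)

-- Cauchy products of sequences indexed by ℤ

module Convolution where
  open import Data.Integer.Base using (_+_; _-_; _*_; -_)
  open ≡ using (refl; trans; cong; cong₂)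
  open Σℤ
  open Theta using (negative; negative-negative)
  open ≡-Reasoning

  infixl 7 _⋆_

  -- For causal f and g the window ∣n∣ loses nothing: f vanishes at i < 0 and g at n - i < 0.
  _⋆_ : (f g : ℤ → ℤ) → ℤ → ℤ
  (f ⋆ g) n = Σ± ∣ n ∣ λ i → f i * g (n - i)

  record Causal (f : ℤ → ℤ) : Set where
    constructor mk
    field
      causal : ∀ j → f -[1+ j ] ≡ 0ℤ
  open Causal public

  causal-shift : ∀ {f} d → Causal f → Causal (λ n → f (n - + d))
  causal-shift {f} d c = mk λ j → trans (cong f (proj₂ (negative-negative j d))) (causal c _)

  ⋆-sums : ∀ {f g} → Causal f → Causal g → ∀ n → Sums (λ i → f i * g (n - i)) ((f ⋆ g) n)
  ⋆-sums {f} {g} cf cg n = sums ∣ n ∣ (supports n) refl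
    where
    supports : ∀ n → Supp ∣ n ∣ (λ i → f i * g (n - i))
    supports (+ m) (+ x) m<x = *-annihilʳ (f (+ x)) (trans (cong g (proj₂ (negative m<x))) (causal cg _))
    supports -[1+ m ] (+ x) _ = *-annihilʳ (f (+ x)) (trans (cong g (proj₂ (negative-negative m x))) (causal cg _))
    supports n -[1+ x ] _ = *-annihilˡ (g (n - -[1+ x ])) (causal cf x)

  ⋆-causal : ∀ {f g} → Causal f → Causal g → Causal (f ⋆ g)
  ⋆-causal {f} {g} cf cg = mk λ j → trans (Σ±-cong (suc j) (zeros j)) (Σ±-0 (suc j))
    where
    zeros : ∀ j i → f i * g (-[1+ j ] - i) ≡ 0ℤ
    zeros j (+ x) = *-annihilʳ (f (+ x)) (trans (cong g (proj₂ (negative-negative j x))) (causal cg _))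
    zeros j -[1+ x ] = *-annihilˡ (g (-[1+ j ] - -[1+ x ])) (causal cf x)

  ⋆-comm : ∀ {f g} → Causal f → Causal g → ∀ n → (f ⋆ g) n ≡ (g ⋆ f) n
  ⋆-comm {f} {g} cf cg n = sums-unique (sums-shift (- n) (sums-neg (⋆-sums cf cg n))) (⋆-sums cg cf n)
    λ i → trans (ℤ.*-comm (f (- (i + - n))) _) (cong₂ (λ x y → g x * f y) (first n i) (second n i))
    where
    first : ∀ n i → n - (- (i + - n)) ≡ i
    first = solveℤ
    second : ∀ n i → - (i + - n) ≡ n - i
    second = solveℤ

  ⋆-congˡ : ∀ f f′ g → (∀ i → f i ≡ f′ i) → ∀ n → (f ⋆ g) n ≡ (f′ ⋆ g) n
  ⋆-congˡ f f′ g f≡f′ n = Σ±-cong ∣ n ∣ λ i → cong (_* g (n - i)) (f≡f′ i)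

  ⋆-distribʳ : ∀ f h g n → ((λ i → f i + h i) ⋆ g) n ≡ (f ⋆ g) n + (h ⋆ g) n
  ⋆-distribʳ f h g n = trans (Σ±-cong ∣ n ∣ λ i → ℤ.*-distribʳ-+ (g (n - i)) (f i) (h i)) (Σ±-+ ∣ n ∣ _ _)

  ⋆-shift : ∀ {f g} d → Causal f → Causal g → Causal (λ i → f (i - d)) → ∀ n → ((λ i → f (i - d)) ⋆ g) n ≡ (f ⋆ g) (n - d)
  ⋆-shift {f} {g} d cf cg cf′ n = sums-unique (sums-shift d (⋆-sums cf′ cg n)) (⋆-sums cf cg (n - d))
    λ i → cong₂ (λ x y → f x * g y) (first i d) (second n i d)
    where
    first : ∀ i d → i + d - d ≡ i
    first = solveℤ
    second : ∀ n i d → n - (i + d) ≡ n - d - i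
    second = solveℤ

  open Weights using (⟦_⟧; ⟦⟧-false)

  δ⋆ : ∀ {g} a → Causal g → ∀ n → ((λ i → ⟦ i ℤ.≟ 0ℤ ⟧ * a) ⋆ g) n ≡ a * g n
  δ⋆ {g} a cg n = sums-unique (⋆-sums {λ i → ⟦ i ℤ.≟ 0ℤ ⟧ * a} (mk λ _ → ℤ.*-zeroˡ a) cg n)
    (sums-cong (λ _ → refl) (cong₂ (λ x y → x * g y) (ℤ.*-identityˡ a) (ℤ.+-identityʳ n))
      (sums-single {λ i → ⟦ i ℤ.≟ 0ℤ ⟧ * a * g (n - i)} 0ℤ λ i i≢0 →
        trans (cong (λ x → x * a * g (n - i)) (⟦⟧-false (i ℤ.≟ 0ℤ) i≢0))
                (*-annihilˡ (g (n - i)) (ℤ.*-zeroˡ a))))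
    λ _ → refl

-- The sums over rectangles and the crank recurrence

module CrankCounts where
  open import Data.Integer.Base using (_+_; _-_; _*_; -_)
  open ≡ using (refl; sym; trans; cong; cong₂; subst)
  open Weights
  open Σℤ
  open Theta using (Vanishes; mk; vanish; ∇; negative; negative-negative)
  open Convolution using (_⋆_; Causal; causal; ⋆-causal; ⋆-comm; ⋆-congˡ; ⋆-distribʳ; ⋆-shift; δ⋆; causal-shift)
  private module Conv = Convolution
  open RankCounts using (pTotal)
  open ≡-Reasoning

  -- The coefficients of 1 / (q)ₖ, with the convention that this is 0 for k < 0.
  p : ℤ → ℤ → ℤ
  p k n = Sᶻ k n (λ _ → 1ℤ)

  p-causal : ∀ k → Causal (p k)
  p-causal (+ k)    = Conv.mk λ _ → refl
  p-causal -[1+ k ] = Conv.mk λ _ → refl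

  -- 1 / (q)ₖ = 1 / (q)ₖ₋₁ + qᵏ / (q)ₖ. By the convention for negative indices it holds at k = 0
  -- too, so sums over all a in ℤ can be split term by term.
  p-recurrence : ∀ k n → p k n ≡ p (k - 1ℤ) n + p k (n - k)
  p-recurrence (+ zero)  n = trans (cong (p 0ℤ) (sym (ℤ.+-identityʳ n))) (sym (ℤ.+-identityˡ _))
  p-recurrence (+ suc k) n = S-suc k n (λ _ → 1ℤ)
  p-recurrence -[1+ k ]  n = refl

  p-shift-causal : ∀ k → Causal (λ n → p k (n - k))
  p-shift-causal (+ k)    = causal-shift k (p-causal (+ k))
  p-shift-causal -[1+ k ] = Conv.mk λ _ → refl

  -- The coefficients of 1 / ((q)ₐ (q)_b).
  D : ℤ → ℤ → ℤ → ℤ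
  D a b = p a ⋆ p b

  D-comm : ∀ a b n → D a b n ≡ D b a n
  D-comm a b = ⋆-comm (p-causal a) (p-causal b)

  D-recˡ : ∀ a b n → D a b n ≡ D (a - 1ℤ) b n + D a b (n - a)
  D-recˡ a b n = begin
    (p a ⋆ p b) n
      ≡⟨ ⋆-congˡ (p a) (λ i → p (a - 1ℤ) i + p a (i - a)) (p b) (p-recurrence a) n ⟩
    ((λ i → p (a - 1ℤ) i + p a (i - a)) ⋆ p b) n
      ≡⟨ ⋆-distribʳ (p (a - 1ℤ)) (λ i → p a (i - a)) (p b) n ⟩
    D (a - 1ℤ) b n + ((λ i → p a (i - a)) ⋆ p b) n
      ≡⟨ cong (_+_ (D (a - 1ℤ) b n)) (⋆-shift a (p-causal a) (p-causal b) (p-shift-causal a) n) ⟩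
    D (a - 1ℤ) b n + D a b (n - a) ∎

  D-recʳ : ∀ a b n → D a b n ≡ D a (b - 1ℤ) n + D a b (n - b)
  D-recʳ a b n = trans (D-comm a b n) (trans (D-recˡ b a n) (cong₂ _+_ (D-comm (b - 1ℤ) a n) (D-comm b a (n - b))))

  D-causal : ∀ a b → Causal (D a b)
  D-causal a b = ⋆-causal (p-causal a) (p-causal b)

  D-negativeˡ : ∀ a b n → D -[1+ a ] b n ≡ 0ℤ
  D-negativeˡ a b n = trans (Σ±-cong ∣ n ∣ λ i → ℤ.*-zeroˡ (p b (n - i))) (Σ±-0 ∣ n ∣)

  D-negativeʳ : ∀ a b n → D a -[1+ b ] n ≡ 0ℤ
  D-negativeʳ a b n = trans (D-comm a -[1+ b ] n) (D-negativeˡ b a n)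

  D-0 : ∀ b n → D 0ℤ b n ≡ p b n
  D-0 b n = trans (⋆-congˡ (p 0ℤ) (λ i → ⟦ i ℤ.≟ 0ℤ ⟧ * 1ℤ) (p b) (λ i → S-zero i (λ _ → 1ℤ)) n) (trans (δ⋆ 1ℤ (p-causal b) n) (ℤ.*-identityˡ _))

  D-zero : ∀ a b n → (∀ x y → a ≡ + x → b ≡ + y → ∃ λ j → n ≡ -[1+ j ]) → D a b n ≡ 0ℤ
  D-zero -[1+ a ] b        n _   = D-negativeˡ a b n
  D-zero (+ a)    -[1+ b ] n _   = D-negativeʳ (+ a) b n
  D-zero (+ a)    (+ b)    n neg with neg a b refl refl
  ... | j , refl = causal (D-causal (+ a) (+ b)) j

  exponent : ℤ → ℤ → ℤ → ℤ → ℤ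
  exponent n a b e = n - a * b - e

  exponent-negative : ∀ m x y e → m ℕ.< x ℕ.* y ℕ.+ e → ∃ λ j → exponent (+ m) (+ x) (+ y) (+ e) ≡ -[1+ j ]
  exponent-negative m x y e m< with negative m<
  ... | j , eq = j , trans (trans (cong (λ z → + m - z - + e) (sym (ℤ.pos-* x y))) (regroup (+ m) (+ (x ℕ.* y)) (+ e))) eq
    where
    regroup : ∀ m z e → m - z - e ≡ m - (z + e)
    regroup = solveℤ

  exponent-negative′ : ∀ m x y e → ∃ λ j → exponent -[1+ m ] (+ x) (+ y) (+ e) ≡ -[1+ j ]
  exponent-negative′ m x y e with negative-negative m (x ℕ.* y ℕ.+ e)
  ... | j , eq = j , trans (trans (cong (λ z → -[1+ m ] - z - + e) (sym (ℤ.pos-* x y))) (regroup -[1+ m ] (+ (x ℕ.* y)) (+ e))) eq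
    where
    regroup : ∀ m z e → m - z - e ≡ m - (z + e)
    regroup = solveℤ

  -- ∑ₐ q^(ab + e) / (q)ₐ(q)_b over b - a = k, where e = e(a, b).
  rectangle : (ℤ → ℤ → ℤ) → ℤ → ℤ → ℤ → ℤ
  rectangle e k n a = D a (a + k) (exponent n a (a + k) (e a (a + k)))

  rectangleSum : (ℤ → ℤ → ℤ) → ℤ → ℤ → ℤ
  rectangleSum e k n = Σ± (∣ n ∣ ℕ.+ ∣ k ∣) (rectangle e k n)

  Monotone : (ℤ → ℤ → ℤ) → Set
  Monotone e = ∀ x y → ∃ λ z → e (+ x) (+ y) ≡ + z

  rectangle-sums : ∀ e → Monotone e → ∀ k n → Sums (rectangle e k n) (rectangleSum e k n)
  rectangle-sums e mono k n = sums (∣ n ∣ ℕ.+ ∣ k ∣) supports refl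
    where
    small : ∀ x y → x ℕ.> ∣ n ∣ ℕ.+ ∣ k ∣ → + x + k ≡ + y → ∀ n → x ℕ.> ∣ n ∣ → ∀ z → ∃ λ j → exponent n (+ x) (+ y) (+ z) ≡ -[1+ j ]
    small x y       x> eq -[1+ m ] m<x z = exponent-negative′ m x y z
    small x (suc y) x> eq (+ m)    m<x z = exponent-negative m x (suc y) z
      (ℕ.<-≤-trans m<x (ℕ.≤-trans (ℕ.m≤m*n x (suc y)) (ℕ.m≤m+n _ z)))
    -- At b = 0 the product ab gives no lower bound on the exponent. This happens only at a = -k,
    -- which is why the window contains ∣k∣.
    small x zero    x> eq (+ m)    m<x z = contradiction (x≡∣k∣ eq) (ℕ.>⇒≢ (ℕ.≤-<-trans (ℕ.m≤n+m ∣ k ∣ ∣ n ∣) x>))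
      where
      x≡∣k∣ : + x + k ≡ 0ℤ → x ≡ ∣ k ∣
      x≡∣k∣ eq = trans (cong ∣_∣ (trans (isolate (+ x) k) (trans (cong (_- k) eq) (ℤ.+-identityˡ (- k))))) (ℤ.∣-i∣≡∣i∣ k)
        where
        isolate : ∀ x k → x ≡ x + k - k
        isolate = solveℤ
    supports : Supp (∣ n ∣ ℕ.+ ∣ k ∣) (rectangle e k n)
    supports -[1+ a ] _  = D-negativeˡ a (-[1+ a ] + k) (exponent n -[1+ a ] (-[1+ a ] + k) (e -[1+ a ] (-[1+ a ] + k)))
    supports (+ x)    x> = D-zero (+ x) (+ x + k) (exponent n (+ x) (+ x + k) (e (+ x) (+ x + k))) λ { x′ y refl eq →
      let z , e≡ = mono x y
          j , neg = small x y x> eq n (ℕ.≤-<-trans (ℕ.m≤m+n ∣ n ∣ ∣ k ∣) x>) z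
      in j , trans (cong (λ b → exponent n (+ x) b (e (+ x) b)) eq) (trans (cong (exponent n (+ x) (+ y)) e≡) neg) }

  rectangle-causal : ∀ e → Monotone e → ∀ k j → rectangleSum e k -[1+ j ] ≡ 0ℤ
  rectangle-causal e mono k j = trans (Σ±-cong (suc j ℕ.+ ∣ k ∣) zeros) (Σ±-0 (suc j ℕ.+ ∣ k ∣))
    where
    zeros : ∀ a → rectangle e k -[1+ j ] a ≡ 0ℤ
    zeros a = D-zero a (a + k) (exponent -[1+ j ] a (a + k) (e a (a + k))) λ { x y refl eq →
      let z , e≡ = mono x y
          i , neg = exponent-negative′ j x y z
      in i , trans (cong (λ b → exponent -[1+ j ] (+ x) b (e (+ x) b)) eq) (trans (cong (exponent -[1+ j ] (+ x) (+ y)) e≡) neg) }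

  -- W k is the generating function of the partitions with crank ≤ k.
  X W V Y : ℤ → ℤ → ℤ
  X = rectangleSum λ a b → 0ℤ
  W = rectangleSum λ a b → a
  V = rectangleSum λ a b → a + b
  Y = rectangleSum λ a b → a + a

  X-sums : ∀ k n → Sums (rectangle (λ a b → 0ℤ) k n) (X k n)
  X-sums = rectangle-sums (λ a b → 0ℤ) λ x y → 0 , refl

  W-sums : ∀ k n → Sums (rectangle (λ a b → a) k n) (W k n)
  W-sums = rectangle-sums (λ a b → a) λ x y → x , refl

  V-sums : ∀ k n → Sums (rectangle (λ a b → a + b) k n) (V k n)
  V-sums = rectangle-sums (λ a b → a + b) λ x y → x ℕ.+ y , refl

  Y-sums : ∀ k n → Sums (rectangle (λ a b → a + a) k n) (Y k n)
  Y-sums = rectangle-sums (λ a b → a + a) λ x y → x ℕ.+ x , refl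

  D-≡ : ∀ {a b n a′ b′ n′} → a ≡ a′ → b ≡ b′ → n ≡ n′ → D a b n ≡ D a′ b′ n′
  D-≡ refl refl refl = refl

  -- The factor 1 / (q)ₐ is split into 1 / (q)ₐ₋₁ and qᵃ / (q)ₐ. In the former a becomes a + 1, and
  -- (a + 1)(a + 1 + k) = a (a + k + 1) + a + (k + 1) yields W at k + 1.
  X-splitˡ : ∀ k n → X k n ≡ W (k + 1ℤ) (n - k - 1ℤ) + W k n
  X-splitˡ k n = sums-unique (X-sums k n)
    (sums-+ (sums-pred {λ a → D (a - 1ℤ) (a + k) (exponent n a (a + k) 0ℤ)}
      (sums-cong (λ i → D-≡ (first i) (second i k) (third n i k)) refl (W-sums (k + 1ℤ) (n - k - 1ℤ)))) (W-sums k n))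
    λ a → trans (D-recˡ a (a + k) (exponent n a (a + k) 0ℤ)) (cong (λ x → D (a - 1ℤ) (a + k) (exponent n a (a + k) 0ℤ) + D a (a + k) x) (drop n a k))
    where
    first : ∀ i → i ≡ 1ℤ + i - 1ℤ
    first = solveℤ
    second : ∀ i k → i + (k + 1ℤ) ≡ 1ℤ + i + k
    second = solveℤ
    third : ∀ n i k → n - k - 1ℤ - i * (i + (k + 1ℤ)) - i ≡ n - (1ℤ + i) * (1ℤ + i + k) - 0ℤ
    third = solveℤ
    drop : ∀ n a k → n - a * (a + k) - 0ℤ - a ≡ n - a * (a + k) - a
    drop = solveℤ

  -- Here the factor 1 / (q)_b with b = a + k + 1 is split; a b = a (a + k) + a yields W at k.
  X-splitʳ : ∀ k n → X (k + 1ℤ) n ≡ W k n + W (k + 1ℤ) (n - k - 1ℤ)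
  X-splitʳ k n = sums-unique (X-sums (k + 1ℤ) n) (sums-+ (W-sums k n) (W-sums (k + 1ℤ) (n - k - 1ℤ)))
    λ a → trans (D-recʳ a (a + (k + 1ℤ)) (exponent n a (a + (k + 1ℤ)) 0ℤ)) (cong₂ _+_
      (D-≡ (refl {x = a}) (first a k) (second n a k)) (cong (D a (a + (k + 1ℤ))) (third n a k)))
    where
    first : ∀ a k → a + (k + 1ℤ) - 1ℤ ≡ a + k
    first = solveℤ
    second : ∀ n a k → n - a * (a + (k + 1ℤ)) - 0ℤ ≡ n - a * (a + k) - a
    second = solveℤ
    third : ∀ n a k → n - a * (a + (k + 1ℤ)) - 0ℤ - (a + (k + 1ℤ)) ≡ n - k - 1ℤ - a * (a + (k + 1ℤ)) - a
    third = solveℤ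

  -- Splitting the factor of a in X k and the factor of b in X (k + 1) produces the same two sums.
  X-suc : ∀ k n → X (k + 1ℤ) n ≡ X k n
  X-suc k n = trans (X-splitʳ k n) (trans (ℤ.+-comm (W k n) _) (sym (X-splitˡ k n)))

  X-constant : ∀ k n → X k n ≡ X 0ℤ n
  X-constant (+ zero)     n = refl
  X-constant (+ suc k)    n = trans (trans (cong (λ k → X k n) (ℤ.+-comm 1ℤ (+ k))) (X-suc (+ k) n)) (X-constant (+ k) n)
  X-constant -[1+ zero ]  n = sym (X-suc -[1+ 0 ] n)
  X-constant -[1+ suc k ] n = trans (sym (X-suc -[1+ suc k ] n)) (X-constant -[1+ k ] n)

  -- Since X does not depend on k, it may be computed at k = m. There every term with a > 0 has
  -- exponent a (a + m) > m, and a = 0 leaves the count of partitions of m into parts ≤ m.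
  X≡pTotal : ∀ k n → X k n ≡ pTotal n
  X≡pTotal k -[1+ j ] = rectangle-causal (λ a b → 0ℤ) (λ x y → 0 , refl) k j
  X≡pTotal k (+ m) = trans (trans (X-constant k (+ m)) (sym (X-constant (+ m) (+ m))))
    (sums-unique (X-sums (+ m) (+ m)) (sums-cong (λ _ → refl) value (sums-single {rectangle (λ a b → 0ℤ) (+ m) (+ m)} 0ℤ zeros)) λ _ → refl)
    where
    value : D 0ℤ (0ℤ + + m) (exponent (+ m) 0ℤ (0ℤ + + m) 0ℤ) ≡ pTotal (+ m)
    value = trans (D-0 (+ m) _) (cong (p (+ m)) (simplify (+ m)))
      where
      simplify : ∀ m → m - 0ℤ - 0ℤ ≡ m
      simplify = solveℤ
    zeros : ∀ a → a ≢ 0ℤ → rectangle (λ a b → 0ℤ) (+ m) (+ m) a ≡ 0ℤ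
    zeros (+ zero)  a≢0 = contradiction refl a≢0
    zeros (+ suc x) _   = D-zero (+ suc x) (+ suc x + + m) (exponent (+ m) (+ suc x) (+ suc x + + m) 0ℤ) λ { _ _ refl refl →
      exponent-negative m (suc x) (suc x ℕ.+ m) 0 (ℕ.<-≤-trans (s≤s (ℕ.m≤n+m m x)) (ℕ.≤-trans (ℕ.m≤m+n (suc x ℕ.+ m) _) (ℕ.m≤m+n _ 0))) }
    zeros -[1+ x ]  _   = D-negativeˡ x (-[1+ x ] + + m) (exponent (+ m) -[1+ x ] (-[1+ x ] + + m) 0ℤ)

  W-recurrence : ∀ k n → W k n + W (k + 1ℤ) (n - k - 1ℤ) ≡ pTotal n
  W-recurrence k n = trans (ℤ.+-comm (W k n) _) (trans (sym (X-splitˡ k n)) (X≡pTotal k n))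

  W-vanishes : Vanishes W
  W-vanishes = mk (rectangle-causal (λ a b → a) λ x y → x , refl)

  W-high : ∀ n k → n ℕ.≤ k → W (+ k) (+ n) ≡ pTotal (+ n)
  W-high n k n≤k with negative {n} {k ℕ.+ 1} (ℕ.≤-<-trans n≤k (ℕ.m<m+n k (s≤s z≤n)))
  ... | j , eq = begin
    W (+ k) (+ n)                                          ≡⟨ ℤ.+-identityʳ _ ⟨
    W (+ k) (+ n) + 0ℤ                                     ≡⟨ cong (_+_ (W (+ k) (+ n))) (vanish W-vanishes (+ k + 1ℤ) j) ⟨
    W (+ k) (+ n) + W (+ k + 1ℤ) -[1+ j ]                  ≡⟨ cong (λ x → W (+ k) (+ n) + W (+ k + 1ℤ) x) (trans (regroup (+ n) (+ k)) eq) ⟨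
    W (+ k) (+ n) + W (+ k + 1ℤ) (+ n - + k - 1ℤ)          ≡⟨ W-recurrence (+ k) (+ n) ⟩
    pTotal (+ n)                                           ∎
    where
    regroup : ∀ n k → n - k - 1ℤ ≡ n - (k + 1ℤ)
    regroup = solveℤ

  -- A nonzero term needs b = a - k - 1 ≥ 0, so a > k ≥ n, and its exponent ab + a already exceeds
  -- n.
  W-low : ∀ n k → n ℕ.≤ k → W -[1+ k ] (+ n) ≡ 0ℤ
  W-low n k n≤k = trans (Σ±-cong (n ℕ.+ suc k) zeros) (Σ±-0 (n ℕ.+ suc k))
    where
    zeros : ∀ a → rectangle (λ a b → a) -[1+ k ] (+ n) a ≡ 0ℤ
    zeros a = D-zero a (a + -[1+ k ]) (exponent (+ n) a (a + -[1+ k ]) a) λ { x y refl eq →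
      let j , neg = exponent-negative n x y x (ℕ.<-≤-trans (ℕ.≤-<-trans n≤k (k<x x y eq)) (ℕ.m≤n+m x (x ℕ.* y)))
      in j , trans (cong (λ b → exponent (+ n) (+ x) b (+ x)) eq) neg }
      where
      isolate : ∀ x k → x ≡ 1ℤ + k + (x - (1ℤ + k))
      isolate = solveℤ
      k<x : ∀ x y → + x + -[1+ k ] ≡ + y → k ℕ.< x
      k<x x y eq = subst (k ℕ.<_) (sym (ℤ.+-injective (trans (isolate (+ x) (+ k)) (cong (_+_ (1ℤ + + k)) eq)))) (s≤s (ℕ.m≤m+n k y))

  -- ∇ W = (1 - q) V: splitting the factor of b in W k and the factor of a in W (k - 1) leaves the
  -- common part Y (k - 1), which cancels, and V k against q V k.
  ∇W≡V : ∀ k n → ∇ W k n ≡ V k n - V k (n - 1ℤ)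
  ∇W≡V k n = trans (cong₂ _-_ upper lower) (cancel (Y (k - 1ℤ) n) (V k n) (V k (n - 1ℤ)))
    where
    cancel : ∀ y v v′ → (y + v) - (v′ + y) ≡ v - v′
    cancel = solveℤ
    upper : W k n ≡ Y (k - 1ℤ) n + V k n
    upper = sums-unique (W-sums k n) (sums-+ (Y-sums (k - 1ℤ) n) (V-sums k n))
      λ a → trans (D-recʳ a (a + k) (exponent n a (a + k) a)) (cong₂ _+_ (D-≡ (refl {x = a}) (first a k) (second n a k))
        (cong (D a (a + k)) (third n a k)))
      where
      first : ∀ a k → a + k - 1ℤ ≡ a + (k - 1ℤ)
      first = solveℤ
      second : ∀ n a k → n - a * (a + k) - a ≡ n - a * (a + (k - 1ℤ)) - (a + a)
      second = solveℤ
      third : ∀ n a k → n - a * (a + k) - a - (a + k) ≡ n - a * (a + k) - (a + (a + k))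
      third = solveℤ
    lower : W (k - 1ℤ) n ≡ V k (n - 1ℤ) + Y (k - 1ℤ) n
    lower = sums-unique (W-sums (k - 1ℤ) n)
      (sums-+ (sums-pred {λ a → D (a - 1ℤ) (a + (k - 1ℤ)) (exponent n a (a + (k - 1ℤ)) a)}
        (sums-cong (λ i → D-≡ (first i) (second i k) (third n i k)) refl (V-sums k (n - 1ℤ)))) (Y-sums (k - 1ℤ) n))
      λ a → trans (D-recˡ a (a + (k - 1ℤ)) (exponent n a (a + (k - 1ℤ)) a)) (cong (λ x → D (a - 1ℤ) (a + (k - 1ℤ)) (exponent n a (a + (k - 1ℤ)) a) + D a (a + (k - 1ℤ)) x) (fourth n a k))
      where
      first : ∀ i → i ≡ 1ℤ + i - 1ℤ
      first = solveℤ
      second : ∀ i k → i + k ≡ 1ℤ + i + (k - 1ℤ)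
      second = solveℤ
      third : ∀ n i k → n - 1ℤ - i * (i + k) - (i + (i + k)) ≡ n - (1ℤ + i) * (1ℤ + i + (k - 1ℤ)) - (1ℤ + i)
      third = solveℤ
      fourth : ∀ n a k → n - a * (a + (k - 1ℤ)) - a - a ≡ n - a * (a + (k - 1ℤ)) - (a + a)
      fourth = solveℤ

-- The crank, sorted by the number of ones

module CrankStatistics where
  open import Data.Integer.Base using (_+_; _-_; _*_; -_)
  open ≡ using (refl; sym; trans; cong; cong₂; subst)
  open Weights
  open Σℤ
  open Theta using (mk; ∇; negative; negative-negative)
  open Convolution using (_⋆_; Causal; causal; ⋆-causal; ⋆-comm; ⋆-congˡ; ⋆-distribʳ; ⋆-shift; δ⋆; causal-shift)
  private module Conv = Convolution
  open RankCounts using (len; len≤; len-∷; column)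
  open CrankCounts
  open ≡-Reasoning

  ω : List ℕ → ℕ
  ω xs = length (filter (ℕ._≟ 1) xs)

  above : ℕ → List ℕ → ℕ
  above j xs = length (filter (j ℕ.<?_) xs)

  ones : ℕ → List ℕ → ℤ
  ones j xs = ⟦ + ω xs ℤ.≟ + j ⟧

  aboves : ℕ → ℤ → List ℕ → ℤ
  aboves j s xs = ⟦ + above j xs ℤ.≟ s ⟧

  ω≤length : ∀ xs → ω xs ℕ.≤ length xs
  ω≤length xs = List.length-filter (ℕ._≟ 1) xs

  private
    cancelTwo : ∀ x y z → (x + y) - (x + z) ≡ y - z
    cancelTwo = solveℤ

  -- Prescribing j ones replaces the factor 1 / (1 - q) of 1 / (q)ₖ₊₁ by qʲ; the difference on the
  -- right is multiplication by 1 - q.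
  S-ones : ∀ k j n → S (suc k) n (ones j) ≡ p (+ suc k) (n - + j) - p (+ suc k) (n - + j - 1ℤ)
  S-ones k j n = grid-induction Q (λ _ → tt) negatives step (suc k) n j
    where
    Q : ℕ → ℤ → Set
    Q zero    n = ⊤
    Q (suc k) n = ∀ j → S (suc k) n (ones j) ≡ p (+ suc k) (n - + j) - p (+ suc k) (n - + j - 1ℤ)
    negatives : ∀ k i → Q k -[1+ i ]
    negatives zero    i = tt
    negatives (suc k) i j with negative-negative i j
    ... | l , eq rewrite eq = refl
    p₁ : ∀ n → p 1ℤ n - p 1ℤ (n - 1ℤ) ≡ ⟦ n ℤ.≟ 0ℤ ⟧ * 1ℤ
    p₁ n = trans (cong (_- p 1ℤ (n - 1ℤ)) (p-recurrence 1ℤ n)) (trans (cancel (p 0ℤ n) (p 1ℤ (n - 1ℤ))) (S-zero n (λ _ → 1ℤ)))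
      where
      cancel : ∀ x y → x + y - y ≡ x
      cancel = solveℤ
    step : ∀ k n → Q k n → Q (suc k) (n - + suc k) → Q (suc k) n
    step zero n _ ih zero = begin
      S 1 n (ones 0)
        ≡⟨ S-suc 0 n (ones 0) ⟩
      S 0 n (ones 0) + S 1 (n - 1ℤ) (λ xs → ones 0 (1 ∷ xs))
        ≡⟨ cong₂ _+_ (S-zero n (ones 0)) (S-zeros 1 (n - 1ℤ) λ _ _ → refl) ⟩
      ⟦ n ℤ.≟ 0ℤ ⟧ * 1ℤ + 0ℤ
        ≡⟨ ℤ.+-identityʳ _ ⟩
      ⟦ n ℤ.≟ 0ℤ ⟧ * 1ℤ
        ≡⟨ p₁ n ⟨
      p 1ℤ n - p 1ℤ (n - 1ℤ)
        ≡⟨ cong (λ x → p 1ℤ x - p 1ℤ (x - 1ℤ)) (ℤ.+-identityʳ n) ⟨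
      p 1ℤ (n - 0ℤ) - p 1ℤ (n - 0ℤ - 1ℤ) ∎
    step zero n _ ih (suc j) = begin
      S 1 n (ones (suc j))
        ≡⟨ S-suc 0 n (ones (suc j)) ⟩
      S 0 n (ones (suc j)) + S 1 (n - 1ℤ) (λ xs → ones (suc j) (1 ∷ xs))
        ≡⟨ cong₂ _+_ (trans (S-zero n (ones (suc j))) (ℤ.*-zeroʳ ⟦ n ℤ.≟ 0ℤ ⟧)) (S-≗ 1 (n - 1ℤ) λ xs →
             ⟦≡⟧-cong (1ℤ + + ω xs) (1ℤ + + j) (+ ω xs) (+ j) (cancelTwo 1ℤ (+ ω xs) (+ j))) ⟩
      0ℤ + S 1 (n - 1ℤ) (ones j)
        ≡⟨ ℤ.+-identityˡ _ ⟩
      S 1 (n - 1ℤ) (ones j)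
        ≡⟨ ih j ⟩
      p 1ℤ (n - 1ℤ - + j) - p 1ℤ (n - 1ℤ - + j - 1ℤ)
        ≡⟨ cong (λ x → p 1ℤ x - p 1ℤ (x - 1ℤ)) (regroup n (+ j)) ⟩
      p 1ℤ (n - + suc j) - p 1ℤ (n - + suc j - 1ℤ) ∎
      where
      regroup : ∀ n j → n - 1ℤ - j ≡ n - (1ℤ + j)
      regroup = solveℤ
    step (suc k) n ih₁ ih₂ j = begin
      S (suc (suc k)) n (ones j)
        ≡⟨ S-suc (suc k) n (ones j) ⟩
      S (suc k) n (ones j) + S (suc (suc k)) (n - K) (ones j)
        ≡⟨ cong₂ _+_ (ih₁ j) (ih₂ j) ⟩
      p (+ suc k) (n - + j) - p (+ suc k) (n - + j - 1ℤ) + (p K (n - K - + j) - p K (n - K - + j - 1ℤ))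
        ≡⟨ cong₂ (λ x y → p (+ suc k) (n - + j) - p (+ suc k) (n - + j - 1ℤ) + (p K x - p K y))
             (first n K (+ j)) (second n K (+ j)) ⟩
      p (+ suc k) (n - + j) - p (+ suc k) (n - + j - 1ℤ) + (p K (n - + j - K) - p K (n - + j - 1ℤ - K))
        ≡⟨ regroup (p (+ suc k) (n - + j)) (p (+ suc k) (n - + j - 1ℤ)) (p K (n - + j - K)) (p K (n - + j - 1ℤ - K)) ⟩
      (p (+ suc k) (n - + j) + p K (n - + j - K)) - (p (+ suc k) (n - + j - 1ℤ) + p K (n - + j - 1ℤ - K))
        ≡⟨ cong₂ _-_ (p-recurrence K (n - + j)) (p-recurrence K (n - + j - 1ℤ)) ⟨
      p K (n - + j) - p K (n - + j - 1ℤ) ∎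
      where
      K : ℤ
      K = + suc (suc k)
      first : ∀ n K j → n - K - j ≡ n - j - K
      first = solveℤ
      second : ∀ n K j → n - K - j - 1ℤ ≡ n - j - 1ℤ - K
      second = solveℤ
      regroup : ∀ a b c d → a - b + (c - d) ≡ (a + c) - (b + d)
      regroup = solveℤ

  S-length≤0 : ∀ a m → S a m (len≤ 0ℤ) ≡ S 0 m (λ _ → 1ℤ)
  S-length≤0 zero    m = trans (S-zero m (len≤ 0ℤ)) (sym (S-zero m (λ _ → 1ℤ)))
  S-length≤0 (suc a) m = trans (S-suc a m (len≤ 0ℤ)) (trans (cong₂ _+_ (S-length≤0 a m)
    (S-zeros (suc a) (m - + suc a) λ _ _ → refl)) (ℤ.+-identityʳ _))

  -- Conjugation, proved by induction on s: partitions with exactly s + 1 parts lose a column and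
  -- again fall under the claim. The assumption m ≤ a says that the bound on the parts is no
  -- restriction.
  S-length≤ : ∀ s m a → m ℤ.≤ + a → S a m (len≤ (+ s)) ≡ S s m (λ _ → 1ℤ)
  S-length≤ s m a = grid-induction (λ s m → ∀ a → m ℤ.≤ + a → S a m (len≤ (+ s)) ≡ S s m (λ _ → 1ℤ))
    (λ m a _ → S-length≤0 a m) (λ _ _ _ _ → refl) step s m a
    where
    Goal : ℕ → ℤ → Set
    Goal s m = ∀ a → m ℤ.≤ + a → S a m (len≤ (+ s)) ≡ S s m (λ _ → 1ℤ)
    step : ∀ s m → Goal s m → Goal (suc s) (m - + suc s) → Goal (suc s) m
    step s m ih₁ ih₂ a m≤a = begin
      S a m (len≤ (+ suc s))
        ≡⟨ S-≗ a m (λ xs → ⟦≤⟧-split (+ length xs) (+ suc s)) ⟩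
      S a m (λ xs → len≤ (+ s) xs + len (+ suc s) xs)
        ≡⟨ S-+ a m (len≤ (+ s)) (len (+ suc s)) ⟩
      S a m (len≤ (+ s)) + S a m (len (+ suc s))
        ≡⟨ cong₂ _+_ (ih₁ a m≤a) (exact a m≤a) ⟩
      S s m (λ _ → 1ℤ) + S (suc s) (m - + suc s) (λ _ → 1ℤ)
        ≡⟨ S-suc s m (λ _ → 1ℤ) ⟨
      S (suc s) m (λ _ → 1ℤ) ∎
      where
      exact : ∀ a → m ℤ.≤ + a → S a m (len (+ suc s)) ≡ S (suc s) (m - + suc s) (λ _ → 1ℤ)
      -- The bound drops by 1 and the total by s + 1 ≥ 1, so the bound stays harmless.
      exact (suc a) m≤a = trans (column a (+ suc s) m) (ih₂ a (ℤ.+-mono-≤ m≤a (ℤ.-≤- {m = s} z≤n)))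
      exact zero    m≤a = trans (S-zero m (len (+ suc s))) (trans (ℤ.*-zeroʳ ⟦ m ℤ.≟ 0ℤ ⟧) (sym (none m m≤a)))
        where
        none : ∀ m → m ℤ.≤ 0ℤ → S (suc s) (m - + suc s) (λ _ → 1ℤ) ≡ 0ℤ
        none (+ zero)  _           = refl
        none (+ suc m) (ℤ.+≤+ ())
        none -[1+ m ]  _           = refl

  -- Removing the first column turns exactly s parts into parts ≤ s of the conjugate.
  S-length : ∀ i s x → x ℕ.≤ i → S i (+ x) (len (+ s)) ≡ p (+ s) (+ x - + s)
  S-length zero    zero    zero z≤n = refl
  S-length zero    (suc s) zero z≤n = refl
  S-length (suc i) zero    x    x≤i = trans (column i 0ℤ (+ x)) (S-length≤0 i (+ x - 0ℤ))
  S-length (suc i) (suc s) x    x≤i = trans (column i (+ suc s) (+ x))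
    (S-length≤ (suc s) (+ x - + suc s) i (ℤ.+-mono-≤ (ℤ.+≤+ x≤i) (ℤ.-≤- {m = s} z≤n)))

  lengthCount : ℕ → ℤ → ℤ → ℤ
  lengthCount i s x = S i x (len s)

  lengthCount-causal : ∀ i s → Causal (lengthCount i s)
  lengthCount-causal i s = Conv.mk λ _ → refl

  lengthCount-negative : ∀ i s x → lengthCount i -[1+ s ] x ≡ 0ℤ
  lengthCount-negative i s x = S-zeros i x λ _ _ → refl

  -- Parts > j, each diminished by j, and parts ≤ j are chosen independently.
  module _ (j : ℕ) where
    J : ℕ
    J = suc j

    onesCount : ℤ → ℤ
    onesCount x = S J x (ones J)

    onesCount-causal : Causal onesCount
    onesCount-causal = Conv.mk λ _ → refl

    ω-∷ : ∀ x xs → J ℕ.< x → ω (x ∷ xs) ≡ ω xs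
    ω-∷ x xs J<x = cong length (List.filter-reject (ℕ._≟ 1) {x} {xs} λ { refl → ℕ.<⇒≱ J<x (s≤s z≤n) })

    above-∷ : ∀ x xs → J ℕ.< x → above J (x ∷ xs) ≡ suc (above J xs)
    above-∷ x xs J<x = cong length (List.filter-accept (J ℕ.<?_) {x} {xs} J<x)

    above-none : ∀ {k n xs} → k ℕ.≤ J → Part k n xs → above J xs ≡ 0
    above-none k≤J nil = refl
    above-none {xs = _ ∷ xs} k≤J (cons {a = a} a<k p) = trans
      (cong length (List.filter-reject (J ℕ.<?_) {suc a} {xs} (ℕ.≤⇒≯ (ℕ.≤-trans a<k k≤J))))
      (above-none (ℕ.≤-trans a<k k≤J) p)

    both : ℤ → List ℕ → ℤ
    both s xs = ones J xs * aboves J s xs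

    both-∷ : ∀ s x xs → J ℕ.< x → both s (x ∷ xs) ≡ both (s - 1ℤ) xs
    both-∷ s x xs J<x = cong₂ _*_ (cong (λ m → ⟦ + m ℤ.≟ + J ⟧) (ω-∷ x xs J<x))
      (trans (cong (λ m → ⟦ + m ℤ.≟ s ⟧) (above-∷ x xs J<x))
        (⟦≡⟧-cong (1ℤ + + above J xs) s (+ above J xs) (s - 1ℤ) (move (+ above J xs) s)))
      where
      move : ∀ l s → 1ℤ + l - s ≡ l - (s - 1ℤ)
      move = solveℤ

    -- A part i + J is cut into i and J: the piece i goes to a partition with exactly s parts and
    -- bound i, and the pieces J add up to s J. The remaining parts are ≤ J and contain all J ones.
    S-both : ∀ i n s → S (i ℕ.+ J) n (both s) ≡ (lengthCount i s ⋆ onesCount) (n - s * + J)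
    S-both i n s = grid-induction Q (λ { _ zero () ; _ (suc i) () }) negatives step (i ℕ.+ J) n i refl s
      where
      -- Writing k as i + J makes the claim empty below k = J, where the induction starts.
      Q : ℕ → ℤ → Set
      Q k n = ∀ i → k ≡ i ℕ.+ J → ∀ s → S k n (both s) ≡ (lengthCount i s ⋆ onesCount) (n - s * + J)
      none : ∀ i s n → (lengthCount i -[1+ s ] ⋆ onesCount) n ≡ 0ℤ
      none i s n = trans (Σ±-cong ∣ n ∣ λ x → *-annihilˡ (onesCount (n - x)) (lengthCount-negative i s x)) (Σ±-0 ∣ n ∣)
      negatives : ∀ k m → Q k -[1+ m ]
      negatives k m i _ -[1+ s ] = sym (none i s (-[1+ m ] - -[1+ s ] * + J))
      negatives k m i _ (+ s) with negative-negative m (s ℕ.* J)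
      ... | l , eq = sym (trans (cong (lengthCount i (+ s) ⋆ onesCount) (trans (cong (λ x → -[1+ m ] - x) (sym (ℤ.pos-* s J))) eq))
        (causal (⋆-causal (lengthCount-causal i (+ s)) onesCount-causal) l))
      base : ∀ n s → S J n (both s) ≡ (lengthCount 0 s ⋆ onesCount) (n - s * + J)
      base n s = begin
        S J n (both s)
          ≡⟨ S-cong J n (λ xs part → trans (cong (λ m → ones J xs * ⟦ + m ℤ.≟ s ⟧) (above-none ℕ.≤-refl part)) (ℤ.*-comm (ones J xs) _)) ⟩
        S J n (λ xs → len s [] * ones J xs)
          ≡⟨ S-scale J n (len s []) (ones J) ⟩
        len s [] * onesCount n
          ≡⟨ shifted s ⟩
        len s [] * onesCount (n - s * + J)
          ≡⟨ δ⋆ (len s []) onesCount-causal (n - s * + J) ⟨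
        ((λ x → ⟦ x ℤ.≟ 0ℤ ⟧ * len s []) ⋆ onesCount) (n - s * + J)
          ≡⟨ ⋆-congˡ (lengthCount 0 s) _ onesCount (λ x → S-zero x (len s)) (n - s * + J) ⟨
        (lengthCount 0 s ⋆ onesCount) (n - s * + J) ∎
        where
        shifted : ∀ s → len s [] * onesCount n ≡ len s [] * onesCount (n - s * + J)
        shifted (+ zero)  = cong (λ x → 1ℤ * onesCount x) (sym (ℤ.+-identityʳ n))
        shifted (+ suc s) = refl
        shifted -[1+ s ]  = refl
      step : ∀ k n → Q k n → Q (suc k) (n - + suc k) → Q (suc k) n
      step k n ih₁ ih₂ zero    refl s = base n s
      step k n ih₁ ih₂ (suc i) refl s = begin
        S (suc k) n (both s)
          ≡⟨ S-suc k n (both s) ⟩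
        S k n (both s) + S (suc k) (n - + suc k) (λ xs → both s (suc k ∷ xs))
          ≡⟨ cong (_+_ (S k n (both s))) (S-≗ (suc k) (n - + suc k) λ xs → both-∷ s (suc k) xs (s≤s (ℕ.m≤n+m J i))) ⟩
        S k n (both s) + S (suc k) (n - + suc k) (both (s - 1ℤ))
          ≡⟨ cong₂ _+_ (ih₁ i refl s) (ih₂ (suc i) refl (s - 1ℤ)) ⟩
        (lengthCount i s ⋆ onesCount) m + (lengthCount (suc i) (s - 1ℤ) ⋆ onesCount) (n - + suc k - (s - 1ℤ) * + J)
          ≡⟨ cong (λ x → (lengthCount i s ⋆ onesCount) m + (lengthCount (suc i) (s - 1ℤ) ⋆ onesCount) x) (regroup n (+ suc i) (+ J) s) ⟩
        (lengthCount i s ⋆ onesCount) m + (lengthCount (suc i) (s - 1ℤ) ⋆ onesCount) (m - + suc i)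
          ≡⟨ cong (_+_ ((lengthCount i s ⋆ onesCount) m)) (⋆-shift {lengthCount (suc i) (s - 1ℤ)} (+ suc i) (lengthCount-causal (suc i) (s - 1ℤ)) onesCount-causal
               (causal-shift (suc i) (lengthCount-causal (suc i) (s - 1ℤ))) m) ⟨
        (lengthCount i s ⋆ onesCount) m + ((λ x → lengthCount (suc i) (s - 1ℤ) (x - + suc i)) ⋆ onesCount) m
          ≡⟨ ⋆-distribʳ (lengthCount i s) (λ x → lengthCount (suc i) (s - 1ℤ) (x - + suc i)) onesCount m ⟨
        ((λ x → lengthCount i s x + lengthCount (suc i) (s - 1ℤ) (x - + suc i)) ⋆ onesCount) m
          ≡⟨ ⋆-congˡ (lengthCount (suc i) s) _ onesCount (λ x → trans (S-suc i x (len s))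
               (cong (_+_ (lengthCount i s x)) (S-≗ (suc i) (x - + suc i) (len-∷ s (suc i))))) m ⟨
        (lengthCount (suc i) s ⋆ onesCount) m ∎
        where
        m : ℤ
        m = n - s * + J
        regroup : ∀ n i J s → n - (i + J) - (s - 1ℤ) * J ≡ n - s * J - i
        regroup = solveℤ

    onesCount≡ : ∀ x → onesCount x ≡ p (+ J) (x - + J) - p (+ J) (x - + J - 1ℤ)
    onesCount≡ = S-ones j J

    -- The s parts above J contribute q^(Js) qˢ / (q)ₛ, the others (1 - q) qᴶ / (q)_J. The factor 1
    -- - q accounts for the difference, and Js + J + s is the exponent in V.
    S-crank : ∀ n s → S n (+ n) (both s) ≡ D (+ J) s (+ n - + J * s - (+ J + s)) - D (+ J) s (+ n - 1ℤ - + J * s - (+ J + s))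
    S-crank n -[1+ s ] = trans (S-zeros n (+ n) λ xs _ → ℤ.*-zeroʳ (ones J xs))
      (sym (cong₂ _-_ (D-negativeʳ (+ J) s (exponent (+ n) (+ J) -[1+ s ] (+ J + -[1+ s ]))) (D-negativeʳ (+ J) s (exponent (+ n - 1ℤ) (+ J) -[1+ s ] (+ J + -[1+ s ])))))
    S-crank n (+ s) = begin
      S n (+ n) (both (+ s))
        ≡⟨ trans (sym (S-stable n J (both (+ s)))) (cong (λ k → S k (+ n) (both (+ s))) (ℕ.+-comm J n)) ⟩
      S (n ℕ.+ J) (+ n) (both (+ s))
        ≡⟨ S-both n (+ n) (+ s) ⟩
      (lengthCount n (+ s) ⋆ onesCount) m
        ≡⟨ Σ±-cong ∣ m ∣ stable ⟩
      (f ⋆ onesCount) m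
        ≡⟨ ⋆-comm f-causal onesCount-causal m ⟩
      (onesCount ⋆ f) m
        ≡⟨ ⋆-congˡ onesCount (λ x → g x + ℤ.-1ℤ * g (x - 1ℤ)) f
             (λ x → trans (onesCount≡ x) (cong₂ _+_ (refl {x = g x}) (trans (cong (λ y → - p (+ J) y) (swap x (+ J))) (sym (ℤ.-1*i≡-i _))))) m ⟩
      ((λ x → g x + ℤ.-1ℤ * g (x - 1ℤ)) ⋆ f) m
        ≡⟨ ⋆-distribʳ g (λ x → ℤ.-1ℤ * g (x - 1ℤ)) f m ⟩
      (g ⋆ f) m + ((λ x → ℤ.-1ℤ * g (x - 1ℤ)) ⋆ f) m
        ≡⟨ cong (_+_ ((g ⋆ f) m)) (trans (Σ±-cong ∣ m ∣ λ x → ℤ.*-assoc ℤ.-1ℤ (g (x - 1ℤ)) (f (m - x)))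
             (trans (Σ±-scale ∣ m ∣ ℤ.-1ℤ _) (ℤ.-1*i≡-i _))) ⟩
      (g ⋆ f) m - ((λ x → g (x - 1ℤ)) ⋆ f) m
        ≡⟨ cong (λ x → (g ⋆ f) m - x) (⋆-shift {g} {f} 1ℤ g-causal f-causal (causal-shift 1 g-causal) m) ⟩
      (g ⋆ f) m - (g ⋆ f) (m - 1ℤ)
        ≡⟨ cong₂ _-_ (trans (g⋆f m) (cong (D (+ J) (+ s)) (first (+ n) (+ s) (+ J))))
             (trans (g⋆f (m - 1ℤ)) (cong (D (+ J) (+ s)) (second (+ n) (+ s) (+ J)))) ⟩
      D (+ J) (+ s) (+ n - + J * + s - (+ J + + s)) - D (+ J) (+ s) (+ n - 1ℤ - + J * + s - (+ J + + s)) ∎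
      where
      m : ℤ
      m = + n - + s * + J
      f g : ℤ → ℤ
      f x = p (+ s) (x - + s)
      g x = p (+ J) (x - + J)
      f-causal : Causal f
      f-causal = p-shift-causal (+ s)
      g-causal : Causal g
      g-causal = p-shift-causal (+ J)
      swap : ∀ x J → x - J - 1ℤ ≡ x - 1ℤ - J
      swap = solveℤ
      first : ∀ n s J → n - s * J - s - J ≡ n - J * s - (J + s)
      first = solveℤ
      second : ∀ n s J → n - s * J - 1ℤ - s - J ≡ n - 1ℤ - J * s - (J + s)
      second = solveℤ
      g⋆f : ∀ x → (g ⋆ f) x ≡ D (+ J) (+ s) (x - + s - + J)
      g⋆f x = begin
        (g ⋆ f) x                        ≡⟨ ⋆-comm g-causal f-causal x ⟩
        (f ⋆ g) x                        ≡⟨ ⋆-shift {p (+ s)} (+ s) (p-causal (+ s)) g-causal f-causal x ⟩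
        (p (+ s) ⋆ g) (x - + s)          ≡⟨ ⋆-comm (p-causal (+ s)) g-causal (x - + s) ⟩
        (g ⋆ p (+ s)) (x - + s)          ≡⟨ ⋆-shift {p (+ J)} (+ J) (p-causal (+ J)) (p-causal (+ s)) g-causal (x - + s) ⟩
        D (+ J) (+ s) (x - + s - + J)    ∎
      -- The part bound n is invisible only for x ≤ n. For larger x both products vanish, because
      -- `m - x` is negative.
      stable : ∀ x → lengthCount n (+ s) x * onesCount (m - x) ≡ f x * onesCount (m - x)
      stable -[1+ x ] = cong (_* onesCount (m - -[1+ x ])) (sym (causal f-causal x))
      stable (+ x) with x ℕ.≤? n
      ... | yes x≤n = cong (_* onesCount (m - + x)) (S-length n s x x≤n)
      ... | no  x≰n with negative {n} {s ℕ.* J ℕ.+ x} (ℕ.<-≤-trans (ℕ.≰⇒> x≰n) (ℕ.m≤n+m x (s ℕ.* J)))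
      ...   | l , eq = trans (vanishing (lengthCount n (+ s) (+ x))) (sym (vanishing (f (+ x))))
        where
        regroup : ∀ n z x → n - z - x ≡ n - (z + x)
        regroup = solveℤ
        m-x : m - + x ≡ -[1+ l ]
        m-x = trans (cong (λ z → + n - z - + x) (sym (ℤ.pos-* s J))) (trans (regroup (+ n) (+ (s ℕ.* J)) (+ x)) eq)
        vanishing : ∀ a → a * onesCount (m - + x) ≡ 0ℤ
        vanishing a = trans (cong (λ y → a * onesCount y) m-x) (ℤ.*-zeroʳ a)

  -- Gives a name to the local function of `crank`, so that it can be analysed at a given number of
  -- ones.
  crankOf : ℕ → List ℕ → ℤ
  crankOf zero    xs = + largest xs
  crankOf (suc j) xs = + above (suc j) xs - + suc j

  crank≡crankOf : ∀ xs → crank xs ≡ crankOf (ω xs) xs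
  crank≡crankOf xs with length (filter (ℕ._≟ 1) xs)
  ... | zero  = refl
  ... | suc j = refl

  -- The bracket for crank k, restricted to partitions with i ones; its sum is to be matched with
  -- the term a = i of (1 - q) V.
  crankWeight : ℤ → ℤ → List ℕ → ℤ
  crankWeight k (+ zero)  xs = ⟦ + largest xs ℤ.≟ k ⟧ * ones 0 xs
  crankWeight k (+ suc j) xs = ones (suc j) xs * aboves (suc j) (+ suc j + k) xs
  crankWeight k -[1+ j ]  xs = 0ℤ

  crankWeight-ω : ∀ k xs → crankWeight k (+ ω xs) xs ≡ ⟦ crank xs ℤ.≟ k ⟧
  crankWeight-ω k xs = trans (value (ω xs) refl) (cong (λ c → ⟦ c ℤ.≟ k ⟧) (sym (crank≡crankOf xs)))
    where
    move : ∀ a j k → a - (j + k) ≡ a - j - k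
    move = solveℤ
    value : ∀ m → ω xs ≡ m → crankWeight k (+ m) xs ≡ ⟦ crankOf m xs ℤ.≟ k ⟧
    value zero    eq = trans (cong (⟦ + largest xs ℤ.≟ k ⟧ *_) (⟦⟧-true (+ ω xs ℤ.≟ 0ℤ) (cong +_ eq))) (ℤ.*-identityʳ _)
    value (suc j) eq = trans (cong (_* aboves (suc j) (+ suc j + k) xs) (⟦⟧-true (+ ω xs ℤ.≟ + suc j) (cong +_ eq)))
      (trans (ℤ.*-identityˡ _) (⟦≡⟧-cong (+ above (suc j) xs) (+ suc j + k) (+ above (suc j) xs - + suc j) k (move (+ above (suc j) xs) (+ suc j) k)))

  crankWeight-other : ∀ k i xs → i ≢ + ω xs → crankWeight k i xs ≡ 0ℤ
  crankWeight-other k (+ zero)  xs i≢ω = *-annihilʳ ⟦ + largest xs ℤ.≟ k ⟧ (⟦⟧-false (+ ω xs ℤ.≟ 0ℤ) (i≢ω ∘ sym))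
  crankWeight-other k (+ suc j) xs i≢ω = *-annihilˡ (aboves (suc j) (+ suc j + k) xs) (⟦⟧-false (+ ω xs ℤ.≟ + suc j) (i≢ω ∘ sym))
  crankWeight-other k -[1+ j ]  xs i≢ω = refl

  crankCount : ℤ → ℕ → ℤ
  crankCount k n = S n (+ n) (λ xs → ⟦ crank xs ℤ.≟ k ⟧)

  crankCount-sums : ∀ k n → Sums (λ i → S n (+ n) (crankWeight k i)) (crankCount k n)
  crankCount-sums k n = sums n
    (λ i n<i → S-zeros n (+ n) λ xs part → crankWeight-other k i xs λ { refl → ℕ.<⇒≱ n<i (ℕ.≤-trans (ω≤length xs) (length≤ part)) })
    (trans (sym (S-Σ± n n (+ n) (crankWeight k))) (S-cong n (+ n) λ xs part → trans
      (sums-at (sums-single {λ i → crankWeight k i xs} (+ ω xs) λ i → crankWeight-other k i xs) (ℕ.≤-trans (ω≤length xs) (length≤ part)))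
      (crankWeight-ω k xs)))

  -- Without ones the crank is the largest part k, and for k ≥ 2 removing it leads to `S-ones`. For
  -- k = 0 and k = 1 both sides are 0, which uses that the partitioned number is at least 2.
  noOnes : ∀ k n → S (2 ℕ.+ n) (+ (2 ℕ.+ n)) (crankWeight k 0ℤ) ≡ p k (+ (2 ℕ.+ n) - k) - p k (+ (2 ℕ.+ n) - k - 1ℤ)
  noOnes -[1+ k ] n = S-zeros (2 ℕ.+ n) (+ (2 ℕ.+ n)) λ _ _ → refl
  noOnes (+ zero) n = trans (S-≗ (2 ℕ.+ n) (+ (2 ℕ.+ n)) λ xs → cong (_* ones 0 xs)
      (⟦⟧-cong (+ largest xs ℤ.≟ 0ℤ) (+ largest xs ℤ.≤? 0ℤ) ℤ.≤-reflexive (λ l≤0 → ℤ.≤-antisym l≤0 (ℤ.+≤+ z≤n))))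
    (partitions-largest≤ 0ℤ (2 ℕ.+ n) (ones 0))
  noOnes (+ suc zero) n = trans (partitions-largest≡ 0 (2 ℕ.+ n) (ones 0)) (trans
    (S-zeros 1 (+ (1 ℕ.+ n)) λ _ _ → refl)
    (sym (trans (cong (_- p 1ℤ (+ n)) (p-recurrence 1ℤ (+ suc n))) (cancel (p 1ℤ (+ n))))))
    where
    cancel : ∀ x → 0ℤ + x - x ≡ 0ℤ
    cancel = solveℤ
  noOnes (+ suc (suc k)) n = trans (partitions-largest≡ (suc k) (2 ℕ.+ n) (ones 0)) (trans
    (S-ones (suc k) 0 (+ (2 ℕ.+ n) - + suc (suc k)))
    (cong (λ x → p (+ suc (suc k)) x - p (+ suc (suc k)) (x - 1ℤ)) (ℤ.+-identityʳ (+ (2 ℕ.+ n) - + suc (suc k)))))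

  crankTerm : ℤ → ℤ → ℤ → ℤ
  crankTerm k n a = rectangle (λ a b → a + b) k n a + ℤ.-1ℤ * rectangle (λ a b → a + b) k (n - 1ℤ) a

  crankTerm-sums : ∀ k n → Sums (crankTerm k n) (∇ W k n)
  crankTerm-sums k n = sums-cong (λ _ → refl) (trans (cong (_+_ (V k n)) (ℤ.-1*i≡-i _)) (sym (∇W≡V k n)))
    (sums-+ (V-sums k n) (sums-scale ℤ.-1ℤ (V-sums k (n - 1ℤ))))

  crankTerm-0 : ∀ k n → crankTerm k n 0ℤ ≡ p k (n - k) - p k (n - k - 1ℤ)
  crankTerm-0 k n = cong₂ _+_ (D-00 n (n - k) (first n k))
      (trans (ℤ.-1*i≡-i _) (cong -_ (D-00 (n - 1ℤ) (n - k - 1ℤ) (second n k))))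
    where
    D-00 : ∀ x y → x - 0ℤ - (0ℤ + k) ≡ y → D 0ℤ (0ℤ + k) (x - 0ℤ - (0ℤ + (0ℤ + k))) ≡ p k y
    D-00 x y eq = trans (D-0 (0ℤ + k) _) (cong₂ p (ℤ.+-identityˡ k) (trans (cong (λ b → x - 0ℤ - b) (ℤ.+-identityˡ (0ℤ + k))) eq))
    first : ∀ n k → n - 0ℤ - (0ℤ + k) ≡ n - k
    first = solveℤ
    second : ∀ n k → n - 1ℤ - 0ℤ - (0ℤ + k) ≡ n - k - 1ℤ
    second = solveℤ

  crankTerm-zero : ∀ k m a → m ℕ.< a → crankTerm k (+ m) (+ a) ≡ 0ℤ
  crankTerm-zero k m a m<a = cong₂ (λ x y → x + ℤ.-1ℤ * y) (vanishing (+ m) (exponent-negative m))  (vanishing (+ m - 1ℤ) (before m m<a))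
    where
    vanishing : ∀ n → (∀ x y e → m ℕ.< x ℕ.* y ℕ.+ e → ∃ λ j → exponent n (+ x) (+ y) (+ e) ≡ -[1+ j ]) →
      rectangle (λ a b → a + b) k n (+ a) ≡ 0ℤ
    vanishing n neg = D-zero (+ a) (+ a + k) (exponent n (+ a) (+ a + k) (+ a + (+ a + k))) λ { x y refl eq →
      let j , e = neg x y (x ℕ.+ y) (ℕ.<-≤-trans m<a (ℕ.≤-trans (ℕ.m≤m+n x y) (ℕ.m≤n+m (x ℕ.+ y) (x ℕ.* y))))
      in j , trans (cong (λ b → exponent n (+ x) b (+ x + b)) eq) e }
    before : ∀ m → m ℕ.< a → ∀ x y e → m ℕ.< x ℕ.* y ℕ.+ e → ∃ λ j → exponent (+ m - 1ℤ) (+ x) (+ y) (+ e) ≡ -[1+ j ]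
    before zero    _   x y e _  = exponent-negative′ 0 x y e
    before (suc m) m<a x y e m< = exponent-negative m x y e (ℕ.<-trans (ℕ.n<1+n m) m<)

  crankTerm-negative : ∀ k n a → crankTerm k n -[1+ a ] ≡ 0ℤ
  crankTerm-negative k n a = cong₂ (λ x y → x + ℤ.-1ℤ * y) (D-negativeˡ a b (exponent n -[1+ a ] b (-[1+ a ] + b))) (D-negativeˡ a b (exponent (n - 1ℤ) -[1+ a ] b (-[1+ a ] + b)))
    where
    b : ℤ
    b = -[1+ a ] + k

  M-≥2 : ∀ k n → M k (suc (suc n)) ≡ + length (filter (λ xs → crank xs ℤ.≟ k) (partitions (suc (suc n))))
  M-≥2 (+ zero)        n = refl
  M-≥2 (+ suc zero)    n = refl
  M-≥2 (+ suc (suc k)) n = refl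
  M-≥2 -[1+ zero ]     n = refl
  M-≥2 -[1+ suc k ]    n = refl

  -- For n ≥ 2 the terms agree one by one, with a as the number of ones. At n = 0 and n = 1 the
  -- conventional values of M, including M(0,1) = -1, are the coefficients of (1 - q) V.
  ∇W≡M : ∀ k n → ∇ W k (+ n) ≡ M k n
  ∇W≡M k 0 = trans (sums-unique (crankTerm-sums k 0ℤ) (sums-single {crankTerm k 0ℤ} 0ℤ zeros) λ _ → refl)
    (trans (crankTerm-0 k 0ℤ) (value k))
    where
    zeros : ∀ a → a ≢ 0ℤ → crankTerm k 0ℤ a ≡ 0ℤ
    zeros (+ zero)  a≢0 = contradiction refl a≢0
    zeros (+ suc a) _   = crankTerm-zero k 0 (suc a) (s≤s z≤n)
    zeros -[1+ a ]  _   = crankTerm-negative k 0ℤ a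
    value : ∀ k → p k (0ℤ - k) - p k (0ℤ - k - 1ℤ) ≡ M k 0
    value (+ zero)        = refl
    value (+ suc zero)    = refl
    value (+ suc (suc k)) = refl
    value -[1+ zero ]     = refl
    value -[1+ suc k ]    = refl
  ∇W≡M k 1 = trans (sums-unique (crankTerm-sums k 1ℤ) (sums 1 supports refl) λ _ → refl)
    (trans (cong₂ (λ x y → x + (crankTerm k 1ℤ 1ℤ + y)) (crankTerm-0 k 1ℤ) (crankTerm-negative k 1ℤ 0)) (value k))
    where
    supports : Supp 1 (crankTerm k 1ℤ)
    supports (+ a)    1<a = crankTerm-zero k 1 a 1<a
    supports -[1+ a ] _   = crankTerm-negative k 1ℤ a
    -- The term a = 1 has exponent 1 + 2b with b = 1 + k, so at n = 1 it survives only for b = 0.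
    off : ∀ k → k ≢ ℤ.-1ℤ → crankTerm k 1ℤ 1ℤ ≡ 0ℤ
    off k k≢-1 = cong₂ (λ x y → x + ℤ.-1ℤ * y) (vanishing 1 (s≤s ∘ positive)) (vanishing 0 λ _ → s≤s z≤n)
      where
      positive : ∀ {y} → 1ℤ + k ≡ + y → 1 ℕ.≤ y ℕ.+ 0 ℕ.+ y
      positive {zero}  eq = contradiction (trans (isolate k) (cong (_- 1ℤ) eq)) k≢-1
        where
        isolate : ∀ k → k ≡ 1ℤ + k - 1ℤ
        isolate = solveℤ
      positive {suc y} eq = s≤s z≤n
      vanishing : ∀ m → (∀ {y} → 1ℤ + k ≡ + y → m ℕ.< 1 ℕ.+ (y ℕ.+ 0 ℕ.+ y)) → rectangle (λ a b → a + b) k (+ m) 1ℤ ≡ 0ℤ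
      vanishing m m< = D-zero 1ℤ (1ℤ + k) (exponent (+ m) 1ℤ (1ℤ + k) (1ℤ + (1ℤ + k))) λ { _ y refl eq →
        let j , e = exponent-negative m 1 y (suc y) (subst (m ℕ.<_) (sym (ℕ.+-suc (y ℕ.+ 0) y)) (m< eq))
        in j , trans (cong (λ b → exponent (+ m) 1ℤ b (1ℤ + b)) eq) e }
    value : ∀ k → p k (1ℤ - k) - p k (1ℤ - k - 1ℤ) + (crankTerm k 1ℤ 1ℤ + 0ℤ) ≡ M k 1
    value -[1+ zero ]     = refl
    value (+ zero)        = cong (λ x → ℤ.-1ℤ + (x + 0ℤ)) (off 0ℤ λ ())
    value (+ suc zero)    = cong (λ x → 1ℤ + (x + 0ℤ)) (off 1ℤ λ ())
    value (+ suc (suc k)) = cong (λ x → 0ℤ + (x + 0ℤ)) (off (+ suc (suc k)) λ ())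
    value -[1+ suc k ]    = cong (λ x → 0ℤ + (x + 0ℤ)) (off -[1+ suc k ] λ ())
  ∇W≡M k (suc (suc n)) = trans (sums-unique (crankTerm-sums k (+ suc (suc n))) (crankCount-sums k (suc (suc n))) terms)
    (sym (trans (M-≥2 k n) (weight-filter (λ xs → crank xs ℤ.≟ k) (partitions (suc (suc n))))))
    where
    terms : ∀ a → crankTerm k (+ suc (suc n)) a ≡ S (suc (suc n)) (+ suc (suc n)) (crankWeight k a)
    terms (+ zero)  = trans (crankTerm-0 k (+ suc (suc n))) (sym (noOnes k n))
    terms (+ suc j) = sym (trans (S-crank j (suc (suc n)) (+ suc j + k))
      (cong (_+_ (rectangle (λ a b → a + b) k (+ suc (suc n)) (+ suc j))) (sym (ℤ.-1*i≡-i _))))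
    terms -[1+ a ]  = trans (crankTerm-negative k (+ suc (suc n)) a) (sym (S-zeros (suc (suc n)) (+ suc (suc n)) λ _ _ → refl))

-- Laurent polynomials inside ℚ(z)

module Laurent where
  open RationalFunction using (RatFun; num; den; _≃_; *≡*; const; poly; Z; Z⁻¹; Z^_; d/dZ; _+_; _*_; -_) public
  open RationalFunctionField using (fromCross; d/dZ-cong; d/dZ-*; d/dZ-+; almostRing)
  private module P where
    open Polynomial public using (_+_; _*_; -_)
    open PolynomialRing public
  open P using (_≋_; mk)
  ring : CommutativeRing _ _
  ring = RationalFunctionField.ring
  open CommutativeRing ring public
    using (setoid; refl; sym; trans; reflexive; +-cong; *-cong; *-congˡ; *-congʳ; +-congˡ; +-congʳ; -‿cong; *-assoc; *-comm; *-identityˡ; *-identityʳ; +-identityˡ; +-identityʳ; zeroˡ; zeroʳ; distribˡ; distribʳ; -‿inverseʳ; semiring)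
  open SetoidReasoning setoid
  module ΣF = SymmetricSums ring
  open SemiringSum semiring using (sum; sum-cong-≋)

  poly-cong : ∀ {p r} → p ≋ r → poly p ≃ poly r
  poly-cong p≋r = fromCross (P.*-congʳ p≋r)

  poly-+ : ∀ p r → poly (p P.+ r) ≃ poly p + poly r
  poly-+ p r = fromCross (lemma p r (1ℤ ∷ []))
    where
    lemma : ∀ p r o → (p P.+ r) P.* (o P.* o) ≋ (p P.* o P.+ r P.* o) P.* o
    lemma = solve-∀ P.almostRing

  poly-* : ∀ p r → poly (p P.* r) ≃ poly p * poly r
  poly-* p r = fromCross (P.*-congˡ {p P.* r} (P.*-identityˡ (1ℤ ∷ [])))

  poly-neg : ∀ p → poly (P.- p) ≃ - poly p
  poly-neg p = refl

  const-+ : ∀ a b → const (a ℤ.+ b) ≃ const a + const b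
  const-+ a b = poly-+ (a ∷ []) (b ∷ [])

  const-* : ∀ a b → const (a ℤ.* b) ≃ const a * const b
  const-* a b = trans (poly-cong (mk λ { zero → ≡.sym (ℤ.+-identityʳ (a ℤ.* b)) ; (suc k) → ≡.refl })) (poly-* (a ∷ []) (b ∷ []))

  const-neg : ∀ a → const (ℤ.- a) ≃ - const a
  const-neg a = poly-neg (a ∷ [])

  const-1* : ∀ f → const ℤ.-1ℤ * f ≃ - f
  const-1* f = trans (*-congʳ {f} (const-neg 1ℤ)) (-1*x≈-x f)
    where open import Algebra.Properties.Ring (CommutativeRing.ring ring) using (-1*x≈-x)

  Z*Z⁻¹ : Z * Z⁻¹ ≃ const 1ℤ
  Z*Z⁻¹ = *≡* λ { 0 → ≡.refl ; 1 → ≡.refl ; 2 → ≡.refl ; (suc (suc (suc k))) → ≡.refl }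

  Z^suc : ∀ i → Z^ (1ℤ ℤ.+ i) ≃ Z * Z^ i
  Z^suc (+ n)        = refl
  Z^suc -[1+ zero ]  = sym (trans (*-congˡ {Z} (*-identityʳ Z⁻¹)) Z*Z⁻¹)
  Z^suc -[1+ suc n ] = sym (trans (sym (*-assoc Z Z⁻¹ (Z^ -[1+ n ]))) (trans (*-congʳ Z*Z⁻¹) (*-identityˡ (Z^ -[1+ n ]))))

  Z^-cong : ∀ {i j} → i ≡ j → Z^ i ≃ Z^ j
  Z^-cong ≡.refl = refl

  Z-cancel : ∀ {f g} → Z * f ≃ Z * g → f ≃ g
  Z-cancel {f} {g} Zf≃Zg = begin
    f              ≈⟨ recover f ⟩
    Z⁻¹ * (Z * f)  ≈⟨ *-congˡ {Z⁻¹} {Z * f} {Z * g} Zf≃Zg ⟩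
    Z⁻¹ * (Z * g)  ≈⟨ recover g ⟨
    g              ∎
    where
    recover : ∀ f → f ≃ Z⁻¹ * (Z * f)
    recover f = begin
      f              ≈⟨ *-identityˡ f ⟨
      const 1ℤ * f   ≈⟨ *-congʳ {f} (trans (*-comm Z⁻¹ Z) Z*Z⁻¹) ⟨
      Z⁻¹ * Z * f    ≈⟨ *-assoc Z⁻¹ Z f ⟩
      Z⁻¹ * (Z * f)  ∎

  ℤ-induction : (Q : ℤ → Set) → Q 0ℤ → (∀ i → Q i → Q (1ℤ ℤ.+ i)) → (∀ i → Q (1ℤ ℤ.+ i) → Q i) → ∀ i → Q i
  ℤ-induction Q q₀ up down (+ zero)     = q₀
  ℤ-induction Q q₀ up down (+ suc n)    = up (+ n) (ℤ-induction Q q₀ up down (+ n))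
  ℤ-induction Q q₀ up down -[1+ zero ]  = down -[1+ 0 ] q₀
  ℤ-induction Q q₀ up down -[1+ suc n ] = down -[1+ suc n ] (ℤ-induction Q q₀ up down -[1+ n ])

  Z^-+ : ∀ i j → Z^ (i ℤ.+ j) ≃ Z^ i * Z^ j
  Z^-+ i j = ℤ-induction (λ i → Z^ (i ℤ.+ j) ≃ Z^ i * Z^ j)
    (trans (Z^-cong (ℤ.+-identityˡ j)) (sym (*-identityˡ (Z^ j))))
    (λ i ih → begin
      Z^ (1ℤ ℤ.+ i ℤ.+ j)     ≈⟨ Z^-cong (ℤ.+-assoc 1ℤ i j) ⟩
      Z^ (1ℤ ℤ.+ (i ℤ.+ j))   ≈⟨ Z^suc (i ℤ.+ j) ⟩
      Z * Z^ (i ℤ.+ j)        ≈⟨ *-congˡ {Z} ih ⟩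
      Z * (Z^ i * Z^ j)       ≈⟨ *-assoc Z (Z^ i) (Z^ j) ⟨
      Z * Z^ i * Z^ j         ≈⟨ *-congʳ {Z^ j} (Z^suc i) ⟨
      Z^ (1ℤ ℤ.+ i) * Z^ j    ∎)
    (λ i ih → Z-cancel (begin
      Z * Z^ (i ℤ.+ j)        ≈⟨ Z^suc (i ℤ.+ j) ⟨
      Z^ (1ℤ ℤ.+ (i ℤ.+ j))   ≈⟨ Z^-cong (ℤ.+-assoc 1ℤ i j) ⟨
      Z^ (1ℤ ℤ.+ i ℤ.+ j)     ≈⟨ ih ⟩
      Z^ (1ℤ ℤ.+ i) * Z^ j    ≈⟨ *-congʳ {Z^ j} (Z^suc i) ⟩
      Z * Z^ i * Z^ j         ≈⟨ *-assoc Z (Z^ i) (Z^ j) ⟩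
      Z * (Z^ i * Z^ j)       ∎))
    i

  d/dZ-const : ∀ a → d/dZ (const a) ≃ const 0ℤ
  d/dZ-const a = *≡* λ { 0 → numerator a ; (suc zero) → ≡.refl ; (suc (suc k)) → ≡.refl }
    where
    numerator : ∀ a → (0ℤ ℤ.+ 0ℤ ℤ.+ ℤ.- (a ℤ.* 0ℤ ℤ.+ 0ℤ)) ℤ.* 1ℤ ℤ.+ 0ℤ ≡ 0ℤ
    numerator = solveℤ

  θZ : RatFun → RatFun
  θZ f = Z * d/dZ f

  θZ-cong : ∀ {f g} → f ≃ g → θZ f ≃ θZ g
  θZ-cong f≃g = *-congˡ {Z} (d/dZ-cong f≃g)

  θZ-+ : ∀ f g → θZ (f + g) ≃ θZ f + θZ g
  θZ-+ f g = trans (*-congˡ {Z} (d/dZ-+ f g)) (distribˡ Z (d/dZ f) (d/dZ g))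

  θZ-* : ∀ f g → θZ (f * g) ≃ θZ f * g + f * θZ g
  θZ-* f g = trans (*-congˡ {Z} (d/dZ-* f g)) (rearrange Z f g (d/dZ f) (d/dZ g))
    where
    rearrange : ∀ Z f g f′ g′ → Z * (f′ * g + f * g′) ≃ Z * f′ * g + f * (Z * g′)
    rearrange = solve-∀ almostRing

  θZ-const : ∀ a → θZ (const a) ≃ const 0ℤ
  θZ-const a = trans (*-congˡ {Z} (d/dZ-const a)) (zeroʳ Z)

  θZ-scale : ∀ a f → θZ (const a * f) ≃ const a * θZ f
  θZ-scale a f = trans (θZ-* (const a) f) (trans (+-congʳ {const a * θZ f} {θZ (const a) * f} {const 0ℤ} (trans (*-congʳ {f} {θZ (const a)} {const 0ℤ} (θZ-const a)) (zeroˡ f))) (+-identityˡ _))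

  θZ-neg : ∀ f → θZ (- f) ≃ - θZ f
  θZ-neg f = trans (θZ-cong (sym (const-1* f))) (trans (θZ-scale ℤ.-1ℤ f) (const-1* (θZ f)))

  θZ-Z : θZ Z ≃ Z
  θZ-Z = *≡* λ { 0 → ≡.refl ; 1 → ≡.refl ; 2 → ≡.refl ; 3 → ≡.refl ; (suc (suc (suc (suc k)))) → ≡.refl }

  -- The product rule links i and i + 1 in both directions; going down, the common factor `Z` is
  -- cancelled, so `Z⁻¹` need not be differentiated.
  θZ-Z^ : ∀ i → θZ (Z^ i) ≃ const i * Z^ i
  θZ-Z^ = ℤ-induction (λ i → θZ (Z^ i) ≃ const i * Z^ i)
    (trans (θZ-const 1ℤ) (sym (zeroˡ (const 1ℤ))))
    (λ i ih → begin
      θZ (Z^ (1ℤ ℤ.+ i))                  ≈⟨ leibniz i ⟩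
      Z * Z^ i + Z * θZ (Z^ i)            ≈⟨ +-congˡ {Z * Z^ i} (*-congˡ {Z} ih) ⟩
      Z * Z^ i + Z * (const i * Z^ i)     ≈⟨ collect i ⟩
      const (1ℤ ℤ.+ i) * Z^ (1ℤ ℤ.+ i)    ∎)
    (λ i ih → Z-cancel (cancelˡ (Z * Z^ i) (begin
      Z * Z^ i + Z * θZ (Z^ i)            ≈⟨ leibniz i ⟨
      θZ (Z^ (1ℤ ℤ.+ i))                  ≈⟨ ih ⟩
      const (1ℤ ℤ.+ i) * Z^ (1ℤ ℤ.+ i)    ≈⟨ collect i ⟨
      Z * Z^ i + Z * (const i * Z^ i)     ∎)))
    where
    leibniz : ∀ i → θZ (Z^ (1ℤ ℤ.+ i)) ≃ Z * Z^ i + Z * θZ (Z^ i)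
    leibniz i = trans (θZ-cong (Z^suc i)) (trans (θZ-* Z (Z^ i)) (+-congʳ {Z * θZ (Z^ i)} {θZ Z * Z^ i} {Z * Z^ i} (*-congʳ {Z^ i} {θZ Z} {Z} θZ-Z)))
    factor : ∀ Z w c → Z * w + Z * (c * w) ≃ (const 1ℤ + c) * (Z * w)
    factor = solve-∀ almostRing
    collect : ∀ i → Z * Z^ i + Z * (const i * Z^ i) ≃ const (1ℤ ℤ.+ i) * Z^ (1ℤ ℤ.+ i)
    collect i = trans (factor Z (Z^ i) (const i)) (*-cong (sym (const-+ 1ℤ i)) (sym (Z^suc i)))
    cancelˡ : ∀ f {g h} → f + g ≃ f + h → g ≃ h
    cancelˡ f {g} {h} eq = begin
      g               ≈⟨ peel f g ⟩
      f + g + - f     ≈⟨ +-congʳ { - f} {f + g} {f + h} eq ⟩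
      f + h + - f     ≈⟨ peel f h ⟨
      h               ∎
      where
      peel : ∀ f g → g ≃ f + g + - f
      peel = solve-∀ almostRing

  monomial : (ℤ → ℤ) → ℤ → RatFun
  monomial a i = const (a i) * Z^ i

  -- Exhibits f as a Laurent polynomial. Through this relation equalities of rational functions are
  -- reduced to equalities of integers.
  HasCoefficients : (ℤ → ℤ) → RatFun → Set
  HasCoefficients a f = ΣF.Sums (monomial a) f

  coefficients-cong : ∀ {a b f} → (∀ i → a i ≡ b i) → HasCoefficients a f → HasCoefficients b f
  coefficients-cong {a} {b} a≡b = ΣF.sums-cong (λ i → reflexive (≡.cong (λ x → const x * Z^ i) (a≡b i))) refl

  coefficients-unique : ∀ {a f g} → HasCoefficients a f → HasCoefficients a g → f ≃ g
  coefficients-unique p r = ΣF.sums-unique p r λ _ → refl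

  coefficients-+ : ∀ {a b f g} → HasCoefficients a f → HasCoefficients b g → HasCoefficients (λ i → a i ℤ.+ b i) (f + g)
  coefficients-+ {a} {b} p r = ΣF.sums-cong
    (λ i → trans (sym (distribʳ (Z^ i) (const (a i)) (const (b i)))) (*-congʳ {Z^ i} (sym (const-+ (a i) (b i))))) refl (ΣF.sums-+ p r)

  coefficients-scale : ∀ {a f} c → HasCoefficients a f → HasCoefficients (λ i → c ℤ.* a i) (const c * f)
  coefficients-scale {a} c p = ΣF.sums-cong
    (λ i → trans (sym (*-assoc (const c) (const (a i)) (Z^ i))) (*-congʳ {Z^ i} (sym (const-* c (a i))))) refl (ΣF.sums-scale (const c) p)

  coefficients-shift : ∀ {a f} s → HasCoefficients a f → HasCoefficients (λ i → a (i ℤ.- s)) (Z^ s * f)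
  coefficients-shift {a} s p = ΣF.sums-cong move refl (ΣF.sums-shift (ℤ.- s) (ΣF.sums-scale (Z^ s) p))
    where
    swap : ∀ f g h → f * (g * h) ≃ g * (f * h)
    swap = solve-∀ almostRing
    back : ∀ s i → s ℤ.+ (i ℤ.- s) ≡ i
    back = solveℤ
    move : ∀ i → Z^ s * monomial a (i ℤ.- s) ≃ monomial (λ i → a (i ℤ.- s)) i
    move i = trans (swap (Z^ s) (const (a (i ℤ.- s))) (Z^ (i ℤ.- s)))
      (*-congˡ {const (a (i ℤ.- s))} (trans (sym (Z^-+ s (i ℤ.- s))) (Z^-cong (back s i))))

  coefficients-0 : HasCoefficients (λ _ → 0ℤ) (const 0ℤ)
  coefficients-0 = ΣF.sums-cong (λ i → sym (zeroˡ (Z^ i))) refl ΣF.sums-0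

  coefficients-θZ : ∀ {a f} → HasCoefficients a f → HasCoefficients (λ i → i ℤ.* a i) (θZ f)
  coefficients-θZ {a} {f} p = ΣF.sums (ΣF.bound p)
    (λ i b → trans (sym (derivative i)) (trans (θZ-cong (ΣF.supp p i b)) (θZ-const 0ℤ)))
    (trans (sym (θZ-Σ± (ΣF.bound p))) (θZ-cong (ΣF.total p)))
    where
    swap : ∀ f g h → f * (g * h) ≃ g * f * h
    swap = solve-∀ almostRing
    derivative : ∀ i → θZ (monomial a i) ≃ monomial (λ i → i ℤ.* a i) i
    derivative i = begin
      θZ (const (a i) * Z^ i)        ≈⟨ θZ-scale (a i) (Z^ i) ⟩
      const (a i) * θZ (Z^ i)        ≈⟨ *-congˡ {const (a i)} (θZ-Z^ i) ⟩
      const (a i) * (const i * Z^ i) ≈⟨ swap (const (a i)) (const i) (Z^ i) ⟩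
      const i * const (a i) * Z^ i   ≈⟨ *-congʳ {Z^ i} (const-* i (a i)) ⟨
      const (i ℤ.* a i) * Z^ i       ∎
    θZ-Σ± : ∀ K → θZ (ΣF.Σ± K (monomial a)) ≃ ΣF.Σ± K (monomial (λ i → i ℤ.* a i))
    θZ-Σ± zero    = derivative 0ℤ
    θZ-Σ± (suc K) = trans (θZ-+ (ΣF.Σ± K (monomial a)) (monomial a (+ suc K) + monomial a -[1+ K ])) (+-cong (θZ-Σ± K)
      (trans (θZ-+ (monomial a (+ suc K)) (monomial a -[1+ K ])) (+-cong (derivative (+ suc K)) (derivative -[1+ K ]))))

  coefficients-Σ± : ∀ K {a : ℤ → ℤ → ℤ} {f : ℤ → RatFun} → (∀ s → HasCoefficients (a s) (f s)) →
    HasCoefficients (λ i → Σℤ.Σ± K (λ s → a s i)) (ΣF.Σ± K f)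
  coefficients-Σ± zero    p = p 0ℤ
  coefficients-Σ± (suc K) {a} p = coefficients-+ {λ i → Σℤ.Σ± K (λ s → a s i)} {λ i → a (+ suc K) i ℤ.+ a -[1+ K ] i}
    (coefficients-Σ± K p) (coefficients-+ {a (+ suc K)} {a -[1+ K ]} (p (+ suc K)) (p -[1+ K ]))

  coefficients-monomial : ∀ {a} j → (∀ i → i ≢ j → a i ≡ 0ℤ) → HasCoefficients a (const (a j) * Z^ j)
  coefficients-monomial {a} j a≡0 = ΣF.sums-single {monomial a} j
    λ i i≢j → trans (*-congʳ {Z^ i} (reflexive (≡.cong const (a≡0 i i≢j)))) (zeroˡ (Z^ i))

  sum-snoc : ∀ n (f : ℕ → RatFun) → sum {suc n} (f ∘ toℕ) ≃ sum {n} (f ∘ toℕ) + f n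
  sum-snoc zero    f = trans (+-identityʳ (f 0)) (sym (+-identityˡ (f 0)))
  sum-snoc (suc n) f = trans (+-congˡ {f 0} (sum-snoc n (f ∘ suc))) (sym (CommutativeRing.+-assoc ring (f 0) (sum {n} (f ∘ suc ∘ toℕ)) (f (suc n))))

  -- Both windows grow by one index at each end: the lowest is the head of the finite sum, and
  -- `sum-snoc` exposes the highest.
  laurent-Σ± : ∀ n (f : ℤ → RatFun) → sum {suc (2 ℕ.* n)} (λ i → f (toℕ i ⊖ n)) ≃ ΣF.Σ± n f
  laurent-Σ± zero    f = +-identityʳ (f 0ℤ)
  laurent-Σ± (suc n) f = begin
    sum {suc (2 ℕ.* suc n)} (λ i → f (toℕ i ⊖ suc n))
      ≈⟨ reflexive (≡.cong (λ m → sum {suc m} (λ i → f (toℕ i ⊖ suc n))) (double n)) ⟩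
    f -[1+ n ] + sum {suc (suc (2 ℕ.* n))} (λ i → f (suc (toℕ i) ⊖ suc n))
      ≈⟨ +-congˡ {f -[1+ n ]} (sum-cong-≋ {suc (suc (2 ℕ.* n))} λ i → reflexive (≡.cong f (ℤ.[1+m]⊖[1+n]≡m⊖n (toℕ i) n))) ⟩
    f -[1+ n ] + sum {suc (suc (2 ℕ.* n))} (λ i → f (toℕ i ⊖ n))
      ≈⟨ +-congˡ {f -[1+ n ]} (sum-snoc (suc (2 ℕ.* n)) (λ i → f (i ⊖ n))) ⟩
    f -[1+ n ] + (sum {suc (2 ℕ.* n)} (λ i → f (toℕ i ⊖ n)) + f (suc (2 ℕ.* n) ⊖ n))
      ≈⟨ +-congˡ {f -[1+ n ]} (+-cong (laurent-Σ± n f) (reflexive (≡.cong f last))) ⟩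
    f -[1+ n ] + (ΣF.Σ± n f + f (+ suc n))
      ≈⟨ rotate (f -[1+ n ]) (ΣF.Σ± n f) (f (+ suc n)) ⟩
    ΣF.Σ± n f + (f (+ suc n) + f -[1+ n ]) ∎
    where
    double : ∀ n → 2 ℕ.* suc n ≡ suc (suc (2 ℕ.* n))
    double n = ≡.cong suc (ℕ.+-suc n (n ℕ.+ 0))
    last : suc (2 ℕ.* n) ⊖ n ≡ + suc n
    last = ≡.trans (ℤ.⊖-≥ {suc (2 ℕ.* n)} {n} (ℕ.m≤n⇒m≤1+n (ℕ.m≤m+n n (n ℕ.+ 0))))
      (≡.cong +_ (≡.trans (≡.cong (ℕ._∸ n) (≡.trans (≡.cong suc (≡.cong (n ℕ.+_) (ℕ.+-identityʳ n))) (≡.sym (ℕ.+-suc n n)))) (ℕ.m+n∸m≡n n (suc n))))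
    rotate : ∀ a b c → a + (b + c) ≃ b + (c + a)
    rotate = solve-∀ almostRing

  laurent-coefficients : ∀ a n → (∀ i → n ℕ.< ∣ i ∣ → a i ≡ 0ℤ) → HasCoefficients a (laurent a n)
  laurent-coefficients a n a≡0 = ΣF.sums n
    (λ i n<i → trans (*-congʳ {Z^ i} (reflexive (≡.cong const (a≡0 i n<i)))) (zeroˡ (Z^ i)))
    (sym (laurent-Σ± n (monomial a)))

-- Evaluation at z = 1

module Evaluation where
  open Polynomial using (Poly; coeff)
  open Laurent
  private module P where
    open Polynomial public using (_+_; _*_; -_; _≈_)
  open ≡-Reasoning
  open SemiringSum semiring using (sum)
  open SemiringSum (CommutativeRing.semiring ℤ.+-*-commutativeRing) using () renaming (sum to sumℤ)

  eval : Poly → ℤ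
  eval []      = 0ℤ
  eval (a ∷ p) = a ℤ.+ eval p

  eval-zero : ∀ p → (∀ k → coeff p k ≡ 0ℤ) → eval p ≡ 0ℤ
  eval-zero []      _   = ≡.refl
  eval-zero (a ∷ p) p≡0 = ≡.cong₂ ℤ._+_ (p≡0 0) (eval-zero p (p≡0 ∘ suc))

  eval-cong : ∀ p r → p P.≈ r → eval p ≡ eval r
  eval-cong []      r       p≈r = ≡.sym (eval-zero r (≡.sym ∘ p≈r))
  eval-cong (a ∷ p) []      p≈r = eval-zero (a ∷ p) p≈r
  eval-cong (a ∷ p) (b ∷ r) p≈r = ≡.cong₂ ℤ._+_ (p≈r 0) (eval-cong p r (p≈r ∘ suc))

  eval-+ : ∀ p r → eval (p P.+ r) ≡ eval p ℤ.+ eval r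
  eval-+ []      r       = ≡.sym (ℤ.+-identityˡ _)
  eval-+ (a ∷ p) []      = ≡.sym (ℤ.+-identityʳ _)
  eval-+ (a ∷ p) (b ∷ r) = ≡.trans (≡.cong (ℤ._+_ (a ℤ.+ b)) (eval-+ p r)) (interchange a b (eval p) (eval r))
    where
    interchange : ∀ a b c d → (a ℤ.+ b) ℤ.+ (c ℤ.+ d) ≡ (a ℤ.+ c) ℤ.+ (b ℤ.+ d)
    interchange = solveℤ

  eval-scale : ∀ a p → eval (map (a ℤ.*_) p) ≡ a ℤ.* eval p
  eval-scale a []      = ≡.sym (ℤ.*-zeroʳ a)
  eval-scale a (b ∷ p) = ≡.trans (≡.cong (ℤ._+_ (a ℤ.* b)) (eval-scale a p)) (≡.sym (ℤ.*-distribˡ-+ a b (eval p)))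

  eval-* : ∀ p r → eval (p P.* r) ≡ eval p ℤ.* eval r
  eval-* []      r = ≡.sym (ℤ.*-zeroˡ (eval r))
  eval-* (a ∷ p) r = begin
    eval (map (a ℤ.*_) r P.+ (0ℤ ∷ p P.* r))         ≡⟨ eval-+ (map (a ℤ.*_) r) _ ⟩
    eval (map (a ℤ.*_) r) ℤ.+ (0ℤ ℤ.+ eval (p P.* r)) ≡⟨ ≡.cong₂ (λ x y → x ℤ.+ (0ℤ ℤ.+ y)) (eval-scale a r) (eval-* p r) ⟩
    a ℤ.* eval r ℤ.+ (0ℤ ℤ.+ eval p ℤ.* eval r)       ≡⟨ collect a (eval p) (eval r) ⟩
    (a ℤ.+ eval p) ℤ.* eval r                         ∎
    where
    collect : ∀ a p r → a ℤ.* r ℤ.+ (0ℤ ℤ.+ p ℤ.* r) ≡ (a ℤ.+ p) ℤ.* r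
    collect = solveℤ

  record Representative (f : RatFun) (e : ℤ) : Set where
    constructor mk
    field
      pole-free : eval (den f) ≢ 0ℤ
      value     : eval (num f) ≡ e ℤ.* eval (den f)

  infix 4 _At1_
  -- The numerator and denominator of f may share a factor 1 - z, so the value is read off from some
  -- equal fraction whose denominator does not vanish at 1.
  record _At1_ (f : RatFun) (e : ℤ) : Set where
    constructor at1
    field
      {function}     : RatFun
      equal          : f ≃ function
      representative : Representative function e

  representative-* : ∀ f g {d e} → Representative f d → Representative g e → Representative (f * g) (d ℤ.* e)
  representative-* f g {d} {e} (mk p v) (mk r w) = mk
    (λ pr≡0 → nonzero p r (≡.trans (≡.sym (eval-* (den f) (den g))) pr≡0))
    (begin
      eval (num f P.* num g)                                ≡⟨ eval-* (num f) (num g) ⟩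
      eval (num f) ℤ.* eval (num g)                         ≡⟨ ≡.cong₂ ℤ._*_ v w ⟩
      d ℤ.* eval (den f) ℤ.* (e ℤ.* eval (den g))           ≡⟨ interchange d (eval (den f)) e (eval (den g)) ⟩
      d ℤ.* e ℤ.* (eval (den f) ℤ.* eval (den g))           ≡⟨ ≡.cong (ℤ._*_ (d ℤ.* e)) (eval-* (den f) (den g)) ⟨
      d ℤ.* e ℤ.* eval (den f P.* den g)                    ∎)
    where
    interchange : ∀ a b c d → a ℤ.* b ℤ.* (c ℤ.* d) ≡ a ℤ.* c ℤ.* (b ℤ.* d)
    interchange = solveℤ
    nonzero : ∀ {x y} → x ≢ 0ℤ → y ≢ 0ℤ → x ℤ.* y ≢ 0ℤ
    nonzero {x} x≢0 y≢0 xy≡0 with ℤ.i*j≡0⇒i≡0∨j≡0 x xy≡0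
    ... | inj₁ x≡0 = x≢0 x≡0
    ... | inj₂ y≡0 = y≢0 y≡0

  representative-+ : ∀ f g {d e} → Representative f d → Representative g e → Representative (f + g) (d ℤ.+ e)
  representative-+ f g {d} {e} F@(mk p v) G@(mk r w) = mk
    (Representative.pole-free (representative-* f g F G))
    (begin
      eval (num f P.* den g P.+ num g P.* den f)
        ≡⟨ eval-+ (num f P.* den g) _ ⟩
      eval (num f P.* den g) ℤ.+ eval (num g P.* den f)
        ≡⟨ ≡.cong₂ ℤ._+_ (eval-* (num f) (den g)) (eval-* (num g) (den f)) ⟩
      eval (num f) ℤ.* eval (den g) ℤ.+ eval (num g) ℤ.* eval (den f)
        ≡⟨ ≡.cong₂ (λ x y → x ℤ.* eval (den g) ℤ.+ y ℤ.* eval (den f)) v w ⟩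
      d ℤ.* eval (den f) ℤ.* eval (den g) ℤ.+ e ℤ.* eval (den g) ℤ.* eval (den f)
        ≡⟨ collect d e (eval (den f)) (eval (den g)) ⟩
      (d ℤ.+ e) ℤ.* (eval (den f) ℤ.* eval (den g))
        ≡⟨ ≡.cong (ℤ._*_ (d ℤ.+ e)) (eval-* (den f) (den g)) ⟨
      (d ℤ.+ e) ℤ.* eval (den f P.* den g) ∎)
    where
    collect : ∀ d e x y → d ℤ.* x ℤ.* y ℤ.+ e ℤ.* y ℤ.* x ≡ (d ℤ.+ e) ℤ.* (x ℤ.* y)
    collect = solveℤ

  at1-+ : ∀ f g {d e} → f At1 d → g At1 e → f + g At1 d ℤ.+ e
  at1-+ f g (at1 {f′} p F) (at1 {g′} r G) = at1 {function = f′ + g′} (+-cong {f} {f′} {g} {g′} p r) (representative-+ f′ g′ F G)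

  at1-* : ∀ f g {d e} → f At1 d → g At1 e → f * g At1 d ℤ.* e
  at1-* f g (at1 {f′} p F) (at1 {g′} r G) = at1 {function = f′ * g′} (*-cong {f} {f′} {g} {g′} p r) (representative-* f′ g′ F G)

  at1-const : ∀ a → const a At1 a
  at1-const a = at1 {function = const a} refl (mk (λ ()) (≡.trans (ℤ.+-identityʳ a) (≡.sym (ℤ.*-identityʳ a))))

  at1-cong : ∀ {f g e} → f ≃ g → g At1 e → f At1 e
  at1-cong f≃g (at1 p G) = at1 (trans f≃g p) G

  -- Cross multiplication of the two representatives survives evaluation, and the values of both
  -- denominators are nonzero and cancel.
  at1-unique : ∀ {f d e} → f At1 d → f At1 e → d ≡ e
  at1-unique {d = d} {e} (at1 {g} p (mk x v)) (at1 {h} r (mk y w)) = cancel (begin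
    d ℤ.* (eval (den g) ℤ.* eval (den h))   ≡⟨ ℤ.*-assoc d _ _ ⟨
    d ℤ.* eval (den g) ℤ.* eval (den h)     ≡⟨ ≡.cong (ℤ._* eval (den h)) v ⟨
    eval (num g) ℤ.* eval (den h)           ≡⟨ crossed ⟩
    eval (num h) ℤ.* eval (den g)           ≡⟨ ≡.cong (ℤ._* eval (den g)) w ⟩
    e ℤ.* eval (den h) ℤ.* eval (den g)     ≡⟨ swap e (eval (den h)) (eval (den g)) ⟩
    e ℤ.* (eval (den g) ℤ.* eval (den h))   ∎)
    where
    swap : ∀ e x y → e ℤ.* x ℤ.* y ≡ e ℤ.* (y ℤ.* x)
    swap = solveℤ
    crossed : eval (num g) ℤ.* eval (den h) ≡ eval (num h) ℤ.* eval (den g)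
    crossed = ≡.trans (≡.sym (eval-* (num g) (den h))) (≡.trans
      (eval-cong (num g P.* den h) (num h P.* den g) (PolynomialRing.at (RationalFunctionField.cross (trans (sym p) r))))
      (eval-* (num h) (den g)))
    factor : ∀ d e m → d ℤ.* m ℤ.- e ℤ.* m ≡ (d ℤ.- e) ℤ.* m
    factor = solveℤ
    cancel : d ℤ.* (eval (den g) ℤ.* eval (den h)) ≡ e ℤ.* (eval (den g) ℤ.* eval (den h)) → d ≡ e
    cancel eq with ℤ.i*j≡0⇒i≡0∨j≡0 (d ℤ.- e) (≡.trans (≡.sym (factor d e (eval (den g) ℤ.* eval (den h)))) (ℤ.i≡j⇒i-j≡0 eq))
    ... | inj₁ d-e≡0 = ℤ.i-j≡0⇒i≡j d e d-e≡0
    ... | inj₂ gh≡0 with ℤ.i*j≡0⇒i≡0∨j≡0 (eval (den g)) gh≡0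
    ...   | inj₁ g≡0 = contradiction g≡0 x
    ...   | inj₂ h≡0 = contradiction h≡0 y

  at1-Z : Z At1 1ℤ
  at1-Z = at1 {function = Z} refl (mk (λ ()) ≡.refl)

  at1-Z⁻¹ : Z⁻¹ At1 1ℤ
  at1-Z⁻¹ = at1 {function = Z⁻¹} refl (mk (λ ()) ≡.refl)

  at1-Z^ : ∀ i → Z^ i At1 1ℤ
  at1-Z^ (+ zero)     = at1-const 1ℤ
  at1-Z^ (+ suc n)    = at1-* Z (Z^ (+ n)) at1-Z (at1-Z^ (+ n))
  at1-Z^ -[1+ zero ]  = at1-* Z⁻¹ (const 1ℤ) at1-Z⁻¹ (at1-const 1ℤ)
  at1-Z^ -[1+ suc n ] = at1-* Z⁻¹ (Z^ -[1+ n ]) at1-Z⁻¹ (at1-Z^ -[1+ n ])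

  at1-monomial : ∀ a i → monomial a i At1 a i
  at1-monomial a i = ≡.subst (monomial a i At1_) (ℤ.*-identityʳ (a i)) (at1-* (const (a i)) (Z^ i) (at1-const (a i)) (at1-Z^ i))

  at1-Σ± : ∀ K (f : ℤ → RatFun) (e : ℤ → ℤ) → (∀ i → f i At1 e i) → ΣF.Σ± K f At1 Σℤ.Σ± K e
  at1-Σ± zero    f e p = p 0ℤ
  at1-Σ± (suc K) f e p = at1-+ (ΣF.Σ± K f) (f (+ suc K) + f -[1+ K ]) (at1-Σ± K f e p)
    (at1-+ (f (+ suc K)) (f -[1+ K ]) (p (+ suc K)) (p -[1+ K ]))

  -- The window inside p is unknown, hence the coefficient sum is required on all windows beyond
  -- some B.
  at1-coefficients : ∀ {a f e} → HasCoefficients a f → ∀ B → (∀ K → B ℕ.≤ K → Σℤ.Σ± K a ≡ e) → f At1 e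
  at1-coefficients {a} {f} p B sum≡e = at1-cong {f} {ΣF.Σ± K (monomial a)} (sym (ΣF.sums-at p (ℕ.m≤m⊔n (ΣF.bound p) B)))
    (≡.subst (ΣF.Σ± K (monomial a) At1_) (sum≡e K (ℕ.m≤n⊔m (ΣF.bound p) B)) (at1-Σ± K (monomial a) a (at1-monomial a)))
    where
    K : ℕ
    K = ΣF.bound p ℕ.⊔ B

  at1-sum : ∀ n (f : Fin n → RatFun) (e : Fin n → ℤ) → (∀ i → f i At1 e i) → sum f At1 sumℤ e
  at1-sum zero    f e p = at1-const 0ℤ
  at1-sum (suc n) f e p = at1-+ (f Fin.zero) (sum (f ∘ Fin.suc)) (p Fin.zero) (at1-sum n (f ∘ Fin.suc) (e ∘ Fin.suc) (p ∘ Fin.suc))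

-- The final algebra in an abstract ring

record IntegerRing : Set₁ where
  infix  4 _≈_
  infixl 6 _+_ _-_
  infixl 7 _*_
  infix  8 -_
  infixr 8 _^_
  field
    Carrier : Set
    _≈_     : Carrier → Carrier → Set
    _+_ _*_ : Carrier → Carrier → Carrier
    -_      : Carrier → Carrier
    0# 1#   : Carrier
    isCommutativeRing : IsCommutativeRing _≈_ _+_ _*_ -_ 0# 1#
    _-_     : Carrier → Carrier → Carrier
    _^_     : Carrier → ℕ → Carrier
    minus   : ∀ x y → x - y ≈ x + - y
    square  : ∀ x → x ^ 2 ≈ x * x
    cube    : ∀ x → x ^ 3 ≈ x * (x * x)
    ι       : ℤ → Carrier
    ι-+     : ∀ a b → ι (a ℤ.+ b) ≈ ι a + ι b
    ι-*     : ∀ a b → ι (a ℤ.* b) ≈ ι a * ι b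
    ι-neg   : ∀ a → ι (ℤ.- a) ≈ - ι a
    ι-0     : ι ℤ.0ℤ ≈ 0#
    ι-1     : ι ℤ.1ℤ ≈ 1#
    3#      : Carrier
    three   : 3# ≈ ι (+ 3)

-- Over an abstract ring the solver meets variables instead of series. Division by 2, by 1 - z and
-- by P enters through hypotheses such as `u * c ≈ ι (+ 1)`.
module RingIdentities (𝓡 : IntegerRing) where

  open IntegerRing 𝓡

  𝓢 : CommutativeRing 0ℓ 0ℓ
  𝓢 = record { isCommutativeRing = isCommutativeRing }

  open CommutativeRing 𝓢 using (setoid; refl; sym; trans; reflexive; +-cong; *-cong; *-congˡ; *-congʳ; +-congˡ; +-congʳ; -‿cong; *-assoc; *-identityˡ)
  open SetoidReasoning setoid

  morphism : ℤ.+-*-rawRing -Raw-AlmostCommutative⟶ toAlmostCommutativeRing 𝓢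
  morphism = record { ⟦_⟧ = ι ; +-homo = ι-+ ; *-homo = ι-* ; -‿homo = ι-neg ; 0-homo = ι-0 ; 1-homo = ι-1 }

  ι-cong? : ∀ a b → Maybe (ι a ≈ ι b)
  ι-cong? a b with a ℤ.≟ b
  ... | yes a≡b = just (reflexive (≡.cong ι a≡b))
  ... | no  _   = nothing

  open RingSolver ℤ.+-*-rawRing (toAlmostCommutativeRing 𝓢) morphism ι-cong?

  private
    1ι 2ι 3ι 6ι : Carrier
    1ι = ι (+ 1)
    2ι = ι (+ 2)
    3ι = ι (+ 3)
    6ι = ι (+ 6)

    1ι* : ∀ x → 1ι * x ≈ x
    1ι* x = trans (*-congʳ ι-1) (*-identityˡ x)

  -- As c is invertible, each Q may be traded for u θ C; the three factors θ thus obtained are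
  -- absorbed by G, and the resulting c³ cancels u³.
  clear-poles : ∀ {θ C c Q G X u} → θ * C ≈ c * Q → θ * (θ * (θ * G)) ≈ c * (c * (c * X)) → u * c ≈ ι (+ 1) →
    Q * (Q * (Q * G)) ≈ X * (C * (C * C))
  clear-poles {θ} {C} {c} {Q} {G} {X} {u} θC θ³G uc = begin
    Q * (Q * (Q * G))
      ≈⟨ insert Q G ⟩
    1ι * (1ι * (1ι * (Q * (Q * (Q * G)))))
      ≈⟨ *-cong uc (*-cong uc (*-congʳ uc)) ⟨
    (u * c) * ((u * c) * ((u * c) * (Q * (Q * (Q * G)))))
      ≈⟨ solve 4 (λ u c Q G → (u :* c) :* ((u :* c) :* ((u :* c) :* (Q :* (Q :* (Q :* G)))))
           := u :* (u :* u) :* ((c :* Q) :* ((c :* Q) :* ((c :* Q) :* G)))) refl u c Q G ⟩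
    u * (u * u) * ((c * Q) * ((c * Q) * ((c * Q) * G)))
      ≈⟨ *-congˡ (*-cong θC (*-cong θC (*-congʳ θC))) ⟨
    u * (u * u) * ((θ * C) * ((θ * C) * ((θ * C) * G)))
      ≈⟨ solve 4 (λ u θ C G → u :* (u :* u) :* ((θ :* C) :* ((θ :* C) :* ((θ :* C) :* G)))
           := u :* (u :* u) :* (C :* (C :* C)) :* (θ :* (θ :* (θ :* G)))) refl u θ C G ⟩
    u * (u * u) * (C * (C * C)) * (θ * (θ * (θ * G)))
      ≈⟨ *-congˡ θ³G ⟩
    u * (u * u) * (C * (C * C)) * (c * (c * (c * X)))
      ≈⟨ solve 4 (λ u c C X → u :* (u :* u) :* (C :* (C :* C)) :* (c :* (c :* (c :* X)))
           := (u :* c) :* ((u :* c) :* ((u :* c) :* (X :* (C :* (C :* C)))))) refl u c C X ⟩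
    (u * c) * ((u * c) * ((u * c) * (X * (C * (C * C)))))
      ≈⟨ *-cong uc (*-cong uc (*-congʳ uc)) ⟩
    1ι * (1ι * (1ι * (X * (C * (C * C)))))
      ≈⟨ trans (1ι* _) (trans (1ι* _) (1ι* _)) ⟩
    X * (C * (C * C)) ∎
    where
    insert : ∀ Q G → Q * (Q * (Q * G)) ≈ 1ι * (1ι * (1ι * (Q * (Q * (Q * G)))))
    insert Q G = sym (trans (1ι* _) (trans (1ι* _) (1ι* _)))

  -- Multiplying the former equation by P³ and the latter by z C³ makes their right-hand sides
  -- equal, so F disappears and Q³ can be cancelled. Then P³ G = 2 z P C³, and E inverts P.
  eliminate : ∀ {z F C Q G P E} → (∀ {x y} → Q * x ≈ Q * y → x ≈ y) → P * E ≈ ι (+ 1) →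
    Q * (Q * (Q * G)) ≈ (z * F) * (C * (C * C)) → Q * (Q * (Q * (ι (+ 2) * P))) ≈ F * (P * (P * P)) →
    G ≈ ι (+ 2) * (z * (E * E) * (C * (C * C)))
  eliminate {z} {F} {C} {Q} {G} {P} {E} cancel PE Q³G Q³P = begin
    G
      ≈⟨ trans (1ι* _) (trans (1ι* _) (1ι* _)) ⟨
    1ι * (1ι * (1ι * G))
      ≈⟨ *-cong PE (*-cong PE (*-congʳ PE)) ⟨
    (P * E) * ((P * E) * ((P * E) * G))
      ≈⟨ solve 3 (λ P E G → (P :* E) :* ((P :* E) :* ((P :* E) :* G)) := (P :* (P :* P)) :* G :* (E :* (E :* E))) refl P E G ⟩
    (P * (P * P)) * G * (E * (E * E))
      ≈⟨ *-congʳ (cancel (cancel (cancel cubes))) ⟩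
    2ι * (z * P * (C * (C * C))) * (E * (E * E))
      ≈⟨ solve 4 (λ z P C E → con (+ 2) :* (z :* P :* (C :* (C :* C))) :* (E :* (E :* E))
           := (P :* E) :* (con (+ 2) :* (z :* (E :* E) :* (C :* (C :* C))))) refl z P C E ⟩
    (P * E) * (2ι * (z * (E * E) * (C * (C * C))))
      ≈⟨ trans (*-congʳ PE) (1ι* _) ⟩
    2ι * (z * (E * E) * (C * (C * C))) ∎
    where
    cubes : Q * (Q * (Q * ((P * (P * P)) * G))) ≈ Q * (Q * (Q * (2ι * (z * P * (C * (C * C))))))
    cubes = begin
      Q * (Q * (Q * ((P * (P * P)) * G)))
        ≈⟨ solve 3 (λ Q P G → Q :* (Q :* (Q :* ((P :* (P :* P)) :* G))) := (P :* (P :* P)) :* (Q :* (Q :* (Q :* G)))) refl Q P G ⟩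
      (P * (P * P)) * (Q * (Q * (Q * G)))
        ≈⟨ *-congˡ Q³G ⟩
      (P * (P * P)) * ((z * F) * (C * (C * C)))
        ≈⟨ solve 4 (λ z F P C → (P :* (P :* P)) :* ((z :* F) :* (C :* (C :* C))) := (z :* (C :* (C :* C))) :* (F :* (P :* (P :* P)))) refl z F P C ⟩
      (z * (C * (C * C))) * (F * (P * (P * P)))
        ≈⟨ *-congˡ Q³P ⟨
      (z * (C * (C * C))) * (Q * (Q * (Q * (2ι * P))))
        ≈⟨ solve 4 (λ z C Q P → (z :* (C :* (C :* C))) :* (Q :* (Q :* (Q :* (con (+ 2) :* P))))
             := Q :* (Q :* (Q :* (con (+ 2) :* (z :* P :* (C :* (C :* C))))))) refl z C Q P ⟩
      Q * (Q * (Q * (2ι * (z * P * (C * (C * C)))))) ∎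

  second-form : ∀ h z c r d b a → 3# * c ^ 2 * a + h * c ^ 2 * b - h * (z ^ 2 - 1#) * d + z * r
    ≈ 3ι * (c * c) * a + h * (c * c) * b + - (h * (z * z + - 1ι) * d) + z * r
  second-form h z c r d b a = +-congʳ (trans (minus _ _) (+-cong
    (+-cong (*-congʳ (*-cong three (square c))) (*-congʳ (*-congˡ (square c))))
    (-‿cong (*-congʳ (*-congˡ (trans (minus _ _) (+-cong (square z) (-‿cong (sym ι-1)))))))))

  halve : ∀ {h z c r d b a Y} → h * ι (+ 2) ≈ ι (+ 1) →
    ι (+ 6) * (c * (c * a)) + c * (c * b) + (- (z * (z * d)) + d) + ι (+ 2) * (z * r) ≈ ι (+ 2) * Y →
    Y ≈ 3# * c ^ 2 * a + h * c ^ 2 * b - h * (z ^ 2 - 1#) * d + z * r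
  halve {h} {z} {c} {r} {d} {b} {a} {Y} h2 G≈2Y = begin
    Y
      ≈⟨ trans (*-congʳ h2) (1ι* Y) ⟨
    h * 2ι * Y
      ≈⟨ *-assoc h 2ι Y ⟩
    h * (2ι * Y)
      ≈⟨ *-congˡ G≈2Y ⟨
    h * (6ι * (c * (c * a)) + c * (c * b) + (- (z * (z * d)) + d) + 2ι * (z * r))
      ≈⟨ solve 7 (λ h z c r d b a →
           h :* (con (+ 6) :* (c :* (c :* a)) :+ c :* (c :* b) :+ (:- (z :* (z :* d)) :+ d) :+ con (+ 2) :* (z :* r))
           := h :* con (+ 2) :* (con (+ 3) :* (c :* c) :* a) :+ h :* (c :* c) :* b
              :+ :- (h :* (z :* z :+ :- con (+ 1)) :* d) :+ h :* con (+ 2) :* (z :* r)) refl h z c r d b a ⟩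
    h * 2ι * (3ι * (c * c) * a) + h * (c * c) * b + - (h * (z * z + - 1ι) * d) + h * 2ι * (z * r)
      ≈⟨ +-cong (+-congʳ (+-congʳ (trans (*-congʳ h2) (1ι* _)))) (trans (*-congʳ h2) (1ι* _)) ⟩
    3ι * (c * c) * a + h * (c * c) * b + - (h * (z * z + - 1ι) * d) + z * r
      ≈⟨ second-form h z c r d b a ⟨
    3# * c ^ 2 * a + h * c ^ 2 * b - h * (z ^ 2 - 1#) * d + z * r ∎

  -- With r = (1 - z) r′ and the product rule for its derivatives, the right-hand side of the second
  -- identity becomes (1 - z)³ times that of the first; u³ removes this factor.
  divide : ∀ {h z u E C r d b a r′ d′ b′ a′} → h * ι (+ 2) ≈ ι (+ 1) →
    u * (1# - z) ≈ ι (+ 1) → a ≈ (1# - z) * a′ → r ≈ (1# - z) * r′ → d ≈ (1# - z) * d′ - z * r′ →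
    b ≈ (1# - z) * b′ - ι (+ 2) * (z * d′) - z * r′ →
    z * E ^ 2 * C ^ 3 ≈ 3# * (1# - z) ^ 2 * a + h * (1# - z) ^ 2 * b - h * (z ^ 2 - 1#) * d + z * r →
    z * E ^ 2 * (u * C) ^ 3 ≈ 3# * a′ + h * d′ + h * b′
  divide {h} {z} {u} {E} {C} {r} {d} {b} {a} {r′} {d′} {b′} {a′} h2 uc′ a≈′ r≈′ d≈′ b≈′ identity′ = begin
    z * E ^ 2 * (u * C) ^ 3
      ≈⟨ *-cong (*-congˡ (square E)) (cube (u * C)) ⟩
    z * (E * E) * (u * C * (u * C * (u * C)))
      ≈⟨ solve 4 (λ z E u C → z :* (E :* E) :* (u :* C :* (u :* C :* (u :* C)))
           := u :* (u :* (u :* (z :* (E :* E) :* (C :* (C :* C)))))) refl z E u C ⟩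
    u * (u * (u * (z * (E * E) * (C * (C * C)))))
      ≈⟨ *-congˡ (*-congˡ (*-congˡ identity)) ⟩
    u * (u * (u * (3ι * (c * c) * a + h * (c * c) * b + - (h * (z * z + - 1ι) * d) + z * r)))
      ≈⟨ *-congˡ (*-congˡ (*-congˡ (+-cong (+-cong (+-cong (*-congˡ a≈) (*-congˡ b≈)) (-‿cong (*-congˡ d≈))) (*-congˡ r≈)))) ⟩
    u * (u * (u * (3ι * (c * c) * (c * a′) + h * (c * c) * (c * b′ + - (2ι * (z * d′)) + - (z * r′))
      + - (h * (z * z + - 1ι) * (c * d′ + - (z * r′))) + z * (c * r′))))
      -- To the solver h is a variable, so the one term without h receives the factor h · 2 = 1
      -- before it is compared with the others.
      ≈⟨ *-congˡ (*-congˡ (*-congˡ (+-congˡ (trans (*-congʳ h2) (1ι* _))))) ⟨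
    u * (u * (u * (3ι * (c * c) * (c * a′) + h * (c * c) * (c * b′ + - (2ι * (z * d′)) + - (z * r′))
      + - (h * (z * z + - 1ι) * (c * d′ + - (z * r′))) + h * 2ι * (z * (c * r′)))))
      ≈⟨ solve 7 (λ h z u r′ d′ b′ a′ → let c = con (+ 1) :+ :- z in
           u :* (u :* (u :* (con (+ 3) :* (c :* c) :* (c :* a′)
             :+ h :* (c :* c) :* (c :* b′ :+ :- (con (+ 2) :* (z :* d′)) :+ :- (z :* r′))
             :+ :- (h :* (z :* z :+ :- con (+ 1)) :* (c :* d′ :+ :- (z :* r′))) :+ h :* con (+ 2) :* (z :* (c :* r′)))))
           := (u :* c) :* ((u :* c) :* ((u :* c) :* (con (+ 3) :* a′ :+ h :* d′ :+ h :* b′)))) refl h z u r′ d′ b′ a′ ⟩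
    (u * c) * ((u * c) * ((u * c) * (3ι * a′ + h * d′ + h * b′)))
      ≈⟨ *-cong uc (*-cong uc (*-congʳ uc)) ⟩
    1ι * (1ι * (1ι * (3ι * a′ + h * d′ + h * b′)))
      ≈⟨ trans (1ι* _) (trans (1ι* _) (1ι* _)) ⟩
    3ι * a′ + h * d′ + h * b′
      ≈⟨ +-congʳ (+-congʳ (*-congʳ three)) ⟨
    3# * a′ + h * d′ + h * b′ ∎
    where
    c : Carrier
    c = 1ι + - z
    c≈ : 1# - z ≈ c
    c≈ = trans (minus 1# z) (+-congʳ (sym ι-1))
    uc : u * c ≈ 1ι
    uc = trans (*-congˡ (sym c≈)) uc′
    a≈ : a ≈ c * a′
    a≈ = trans a≈′ (*-congʳ c≈)
    r≈ : r ≈ c * r′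
    r≈ = trans r≈′ (*-congʳ c≈)
    d≈ : d ≈ c * d′ + - (z * r′)
    d≈ = trans d≈′ (trans (minus _ _) (+-congʳ (*-congʳ c≈)))
    b≈ : b ≈ c * b′ + - (2ι * (z * d′)) + - (z * r′)
    b≈ = trans b≈′ (trans (minus _ _) (+-congʳ (trans (minus _ _) (+-congʳ (*-congʳ c≈)))))
    identity : z * (E * E) * (C * (C * C)) ≈ 3ι * (c * c) * a + h * (c * c) * b + - (h * (z * z + - 1ι) * d) + z * r
    identity = trans (sym (*-cong (*-congˡ (square E)) (cube C))) (trans identity′ (trans (second-form h z (1# - z) r d b a)
      (+-congʳ (+-congʳ (+-cong (*-congʳ (*-congˡ (*-cong c≈ c≈))) (*-congʳ (*-congˡ (*-cong c≈ c≈))))))))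

  powers : ∀ z E C → z * E ^ 2 * C ^ 3 ≈ z * (E * E) * (C * (C * C))
  powers z E C = *-cong (*-congˡ (square E)) (cube C)

  second-derivative : ∀ c z d b r → c * b - z * d + - (z * r + z * d) ≈ c * b - ι (+ 2) * (z * d) - z * r
  second-derivative c z d b r = begin
    c * b - z * d + - (z * r + z * d)
      ≈⟨ +-congʳ (minus _ _) ⟩
    c * b + - (z * d) + - (z * r + z * d)
      ≈⟨ solve 5 (λ c z d b r → c :* b :+ :- (z :* d) :+ :- (z :* r :+ z :* d)
           := c :* b :+ :- (con (+ 2) :* (z :* d)) :+ :- (z :* r)) refl c z d b r ⟩
    c * b + - (2ι * (z * d)) + - (z * r)
      ≈⟨ trans (minus _ _) (+-congʳ (minus _ _)) ⟨
    c * b - 2ι * (z * d) - z * r ∎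

  1-z-* : ∀ z x → (1# - z) * x ≈ x + - (z * x)
  1-z-* z x = trans (*-congʳ (trans (minus 1# z) (+-congʳ (sym ι-1))))
    (solve 2 (λ z x → (con (+ 1) :+ :- z) :* x := x :+ :- (z :* x)) refl z x)

open import Defs

-- The ring of series and its z-free elements

module SeriesRing where
  private module F = Laurent
  open F using (RatFun; const; _≃_)
  open PowerSeries F.ring constant (λ _ → F.refl) (λ _ _ → F.refl) public
    using (_≋_; mk; at; constant-⊛; ⊛-zero; ⊛-cong; powerSeries-isCommutativeRing; tail)
  open SemiringSum F.semiring using (sum; sum-cong-≋)
  open SemiringSum (CommutativeRing.semiring ℤ.+-*-commutativeRing) using () renaming (sum to sumℤ)
  open PolynomialRing.ℤ[[z]] using (_⊛_)

  isCommutativeRing : IsCommutativeRing _≋_ _+_ _*_ -_ 𝟎 𝟏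
  isCommutativeRing = powerSeries-isCommutativeRing

  ring : CommutativeRing _ _
  ring = record { isCommutativeRing = isCommutativeRing }

  open CommutativeRing ring public
    using (setoid; refl; sym; trans; +-cong; *-cong; *-congˡ; *-congʳ; +-congˡ; +-congʳ; -‿cong; *-assoc; *-comm; *-identityˡ; *-identityʳ; distribˡ; -‿inverseʳ; +-identityˡ; +-identityʳ)

  constant-≋ : ∀ {f g} → f ≃ g → constant f ≋ constant g
  constant-≋ f≃g = mk λ { zero → f≃g ; (suc n) → F.refl }

  constant-+ : ∀ f g → constant (f F.+ g) ≋ constant f + constant g
  constant-+ f g = mk λ { zero → F.refl ; (suc n) → F.sym (F.+-identityˡ (const 0ℤ)) }

  constant-* : ∀ f g → constant (f F.* g) ≋ constant f * constant g
  constant-* f g = mk λ n → F.trans (pointwise n) (F.sym (constant-⊛ f (constant g) n))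
    where
    pointwise : ∀ n → constant (f F.* g) n ≃ f F.* constant g n
    pointwise zero    = F.refl
    pointwise (suc n) = F.sym (F.zeroʳ f)

  constant-neg : ∀ f → constant (F.- f) ≋ - constant f
  constant-neg f = mk λ { zero → F.refl ; (suc n) → F.refl }

  ι : ℤ → Series
  ι a = constant (const a)

  square : ∀ f → f ^ 2 ≋ f * f
  square f = *-congˡ {f} (*-identityʳ f)

  cube : ∀ f → f ^ 3 ≋ f * (f * f)
  cube f = *-congˡ {f} (square f)

  -- Substituting the record literal makes the projections reduce, so that the
  -- instances mention the operations of series themselves; comparing them with
  -- unreduced projections would unfold the products of series.
  atSeries : ∀ {P : IntegerRing → Set} → (∀ 𝓡 → P 𝓡) → P record
    { Carrier = Series ; _≈_ = _≋_ ; _+_ = _+_ ; _*_ = _*_ ; -_ = -_ ; 0# = 𝟎 ; 1# = 𝟏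
    ; isCommutativeRing = isCommutativeRing
    ; _-_ = _-_ ; _^_ = _^_ ; minus = λ f g → refl ; square = square ; cube = cube
    ; ι = ι
    ; ι-+ = λ a b → trans (constant-≋ (F.const-+ a b)) (constant-+ (const a) (const b))
    ; ι-* = λ a b → trans (constant-≋ (F.const-* a b)) (constant-* (const a) (const b))
    ; ι-neg = λ a → trans (constant-≋ (F.const-neg a)) (constant-neg (const a))
    ; ι-0 = refl ; ι-1 = refl ; 3# = 𝟑 ; three = refl }
  atSeries p = p _

  1-z-* : ∀ z f → (𝟏 - z) * f ≋ f + - (z * f)
  1-z-* = atSeries RingIdentities.1-z-*

  -- The series free of z with integer coefficients; on these, evaluation at z = 1 loses nothing.
  embed : (ℕ → ℤ) → Series
  embed e n = const (e n)

  embed-* : ∀ d e → embed (d ⊛ e) ≋ embed d * embed e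
  embed-* d e = mk λ n → F.trans (const-sum (suc n) (λ i → d (toℕ i) ℤ.* e (n ∸ toℕ i)))
    (sum-cong-≋ {suc n} λ i → F.const-* (d (toℕ i)) (e (n ∸ toℕ i)))
    where
    const-sum : ∀ n (e : Fin n → ℤ) → const (sumℤ e) ≃ sum (λ i → const (e i))
    const-sum zero    e = F.refl
    const-sum (suc n) e = F.trans (F.const-+ (e Fin.zero) _) (F.+-congˡ {const (e Fin.zero)} (const-sum n (e ∘ Fin.suc)))

  zeros-⊛ : ∀ n (f g : Series) → (∀ i → i ℕ.≤ n → g i ≃ const 0ℤ) → (f * g) n ≃ const 0ℤ
  zeros-⊛ n f g g≃0 = zeros (suc n) (λ i → f (toℕ i) F.* g (n ∸ toℕ i))
    λ i → F.trans (F.*-congˡ {f (toℕ i)} (g≃0 (n ∸ toℕ i) (ℕ.m∸n≤m n (toℕ i)))) (F.zeroʳ (f (toℕ i)))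
    where
    zeros : ∀ n (t : Fin n → RatFun) → (∀ i → t i ≃ const 0ℤ) → sum t ≃ const 0ℤ
    zeros zero    t p = F.refl
    zeros (suc n) t p = F.trans (F.+-cong {t Fin.zero} (p Fin.zero) (zeros n (t ∘ Fin.suc) (p ∘ Fin.suc))) (F.+-identityˡ (const 0ℤ))

  -- With constant term 1 in f, the coefficient n of f g is `g n` plus multiples of earlier
  -- coefficients of g, which are already 0. N is the measure of this strong induction.
  no-zero-divisor : ∀ f g → f 0 ≃ const 1ℤ → f * g ≋ 𝟎 → ∀ N n → n ℕ.< N → g n ≃ const 0ℤ
  no-zero-divisor f g f≃1 fg≃0 (suc N) zero    _ = F.trans (F.sym (F.trans (F.*-congʳ {g 0} f≃1) (F.*-identityˡ (g 0))))
    (F.trans (F.sym (⊛-zero f g)) (at fg≃0 0))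
  no-zero-divisor f g f≃1 fg≃0 (suc N) (suc n) (s≤s n<N) = F.trans (F.sym head) (at fg≃0 (suc n))
    where
    head : (f * g) (suc n) ≃ g (suc n)
    head = F.trans (F.+-cong {f 0 F.* g (suc n)} {g (suc n)} {(tail f * g) n} {const 0ℤ}
        (F.trans (F.*-congʳ {g (suc n)} f≃1) (F.*-identityˡ (g (suc n))))
        (zeros-⊛ n (tail f) g λ i i≤n → no-zero-divisor f g f≃1 fg≃0 N i (ℕ.≤-<-trans i≤n n<N)))
      (F.+-identityʳ (g (suc n)))

  cancelˡ : ∀ f → f 0 ≃ const 1ℤ → ∀ {g h} → f * g ≋ f * h → g ≋ h
  cancelˡ f f≃1 {g} {h} fg≋fh = begin
    g              ≈⟨ +-identityʳ g ⟨
    g + 𝟎          ≈⟨ +-congˡ {g} (-‿inverseˡ h) ⟨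
    g + (- h + h)  ≈⟨ +-assoc g (- h) h ⟨
    g - h + h      ≈⟨ +-congʳ {h} {g - h} {𝟎} (mk λ n → F.trans (no-zero-divisor f (g - h) f≃1 difference (suc n) n (ℕ.n<1+n n)) (F.sym (zero-at n))) ⟩
    𝟎 + h          ≈⟨ +-identityˡ h ⟩
    h              ∎
    where
    open SetoidReasoning setoid
    open CommutativeRing ring using (+-assoc; -‿inverseˡ)
    open import Algebra.Properties.Ring (CommutativeRing.ring ring) using (-‿distribʳ-*)
    zero-at : ∀ n → 𝟎 n ≃ const 0ℤ
    zero-at zero    = F.refl
    zero-at (suc n) = F.refl
    difference : f * (g - h) ≋ 𝟎
    difference = begin
      f * (g - h)          ≈⟨ distribˡ f g (- h) ⟩
      f * g + f * (- h)    ≈⟨ +-cong fg≋fh (sym (-‿distribʳ-* f h)) ⟩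
      f * h + - (f * h)    ≈⟨ -‿inverseʳ (f * h) ⟩
      𝟎                    ∎

  infix 4 _AtOne_
  _AtOne_ : Series → (ℕ → ℤ) → Set
  f AtOne e = ∀ n → f n Evaluation.At1 e n

  atOne-* : ∀ f g {d e} → f AtOne d → g AtOne e → f * g AtOne d ⊛ e
  atOne-* f g {d} {e} p r n = Evaluation.at1-sum (suc n) (λ i → f (toℕ i) F.* g (n ∸ toℕ i)) (λ i → d (toℕ i) ℤ.* e (n ∸ toℕ i))
    λ i → Evaluation.at1-* (f (toℕ i)) (g (n ∸ toℕ i)) (p (toℕ i)) (r (n ∸ toℕ i))

  atOne-embed : ∀ e → embed e AtOne e
  atOne-embed e n = Evaluation.at1-const (e n)

  atOne-z : ∀ f {e} → f AtOne e → z * f AtOne e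
  atOne-z f {e} p n = Evaluation.at1-cong (constant-⊛ F.Z f n)
    (≡.subst (F.Z F.* f n Evaluation.At1_) (ℤ.*-identityˡ (e n)) (Evaluation.at1-* F.Z (f n) Evaluation.at1-Z (p n)))

  atOne-unique : ∀ {f g d e} → f ≋ g → f AtOne d → g AtOne e → embed d ≋ embed e
  atOne-unique f≋g p r = mk λ n → F.reflexive (≡.cong const (Evaluation.at1-unique (p n) (Evaluation.at1-cong (at f≋g n) (r n))))

-- Arrays as coefficients of series

module Arrays where
  open SeriesRing
  private module F = Laurent
  open F using (RatFun; const; _≃_; HasCoefficients; Z^_)
  open F.ΣF using () renaming (Σ± to ΣF±)
  open Theta using (Array; Vanishes; vanish; ∇; Θ; T; sgn; ∣s∣≤1+T; thetaTerm; negative)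
  open Weights using (⟦_⟧; ⟦⟧-true; ⟦⟧-false; +-∸)
  open SemiringSum F.semiring using (sum; sum-cong-≋; ∑-distrib-+)

  -- For each n only finitely many k may contribute. Hence ∇ L and ∇ W represent series, while L and
  -- W, equal to `pTotal` for large k, do not.
  record HasArray (a : Array) (f : Series) : Set where
    constructor mk
    field
      coefficients : ∀ n → HasCoefficients (λ k → a k (+ n)) (f n)
  open HasArray public

  array-≃ : ∀ {a f g} → (∀ n → f n ≃ g n) → HasArray a f → HasArray a g
  array-≃ f≃g p = mk λ n → F.ΣF.sums-cong (λ _ → F.refl) (f≃g n) (coefficients p n)

  array-cong : ∀ {a b f} → (∀ k n → a k n ≡ b k n) → HasArray a f → HasArray b f
  array-cong a≡b p = mk λ n → F.coefficients-cong (λ k → a≡b k (+ n)) (coefficients p n)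

  array-unique : ∀ {a f g} → HasArray a f → HasArray a g → f ≋ g
  array-unique {a} p r = mk λ n → F.coefficients-unique {λ k → a k (+ n)} (coefficients p n) (coefficients r n)

  array-+ : ∀ {a b} f g → HasArray a f → HasArray b g → HasArray (λ k n → a k n ℤ.+ b k n) (f + g)
  array-+ {a} {b} f g p r = mk λ n → F.coefficients-+ {λ k → a k (+ n)} {λ k → b k (+ n)} (coefficients p n) (coefficients r n)

  array-constant : ∀ {a} c f → HasArray a f → HasArray (λ k n → c ℤ.* a k n) (ι c * f)
  array-constant {a} c f p = array-≃ (λ n → F.sym (constant-⊛ (const c) f n))
    (mk λ n → F.coefficients-scale {λ k → a k (+ n)} c (coefficients p n))

  array-neg : ∀ {a} f → HasArray a f → HasArray (λ k n → ℤ.- a k n) (- f)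
  array-neg {a} f p = array-cong (λ k n → ℤ.-1*i≡-i (a k n)) (array-≃ (λ n → F.const-1* (f n))
    (mk λ n → F.coefficients-scale {λ k → a k (+ n)} ℤ.-1ℤ (coefficients p n)))

  array-z : ∀ {a} f → HasArray a f → HasArray (λ k n → a (k ℤ.- 1ℤ) n) (z * f)
  array-z {a} f p = array-≃ (λ n → F.trans (F.*-congʳ {f n} (F.*-identityʳ F.Z)) (F.sym (constant-⊛ F.Z f n)))
    (mk λ n → F.coefficients-shift {λ k → a k (+ n)} 1ℤ (coefficients p n))

  array-∇ : ∀ {a} f → HasArray a f → HasArray (∇ a) ((𝟏 - z) * f)
  array-∇ f p = array-≃ (at (sym (1-z-* z f))) (array-+ f (- (z * f)) p (array-neg (z * f) (array-z f p)))

  array-δz : ∀ {a} f → HasArray a f → HasArray (λ k n → k ℤ.* a k n) (δz f)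
  array-δz {a} f p = mk λ n → F.coefficients-θZ {λ k → a k (+ n)} (coefficients p n)

  array-δq : ∀ {a} f → HasArray a f → HasArray (λ k n → n ℤ.* a k n) (δq f)
  array-δq {a} f p = mk λ n → F.coefficients-scale {λ k → a k (+ n)} (+ n) (coefficients p n)

  array-embed : ∀ {a} → (∀ k n → k ≢ 0ℤ → a k n ≡ 0ℤ) → HasArray a (embed λ n → a 0ℤ (+ n))
  array-embed {a} a≡0 = array-≃ (λ n → F.*-identityʳ (const (a 0ℤ (+ n))))
    (mk λ n → F.coefficients-monomial {λ k → a k (+ n)} 0ℤ λ k → a≡0 k (+ n))

  array-z-embed : ∀ {a} → (∀ k n → k ≢ 1ℤ → a k n ≡ 0ℤ) → HasArray a (z * embed λ n → a 1ℤ (+ n))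
  array-z-embed {a} a≡0 = array-≃ (λ n → F.trans (F.*-congˡ {const (a 1ℤ (+ n))} (F.*-identityʳ F.Z))
      (F.trans (F.*-comm (const (a 1ℤ (+ n))) F.Z) (F.sym (constant-⊛ F.Z (embed λ n → a 1ℤ (+ n)) n))))
    (mk λ n → F.coefficients-monomial {λ k → a k (+ n)} 1ℤ λ k → a≡0 k (+ n))

  thetaCoefficient : ℕ → ℤ → RatFun
  thetaCoefficient n s = const ⟦ T s ℕ.≟ n ⟧ F.* (const (sgn s) F.* Z^ s)

  θ : Series
  θ n = ΣF± (suc n) (thetaCoefficient n)

  private
    0≃ : ∀ f → const 0ℤ F.* f ≃ const 0ℤ
    0≃ f = F.zeroˡ f

    1≃ : ∀ f → const 1ℤ F.* f ≃ f
    1≃ f = F.*-identityˡ f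

  sum-Σ± : ∀ n K (f : Fin n → ℤ → RatFun) → sum (λ t → ΣF± K (f t)) ≃ ΣF± K (λ s → sum (λ t → f t s))
  sum-Σ± n zero    f = F.refl
  sum-Σ± n (suc K) f = F.trans (∑-distrib-+ (λ t → ΣF± K (f t)) (λ t → f t (+ suc K) F.+ f t -[1+ K ]))
    (F.+-cong (sum-Σ± n K f) (∑-distrib-+ (λ t → f t (+ suc K)) (λ t → f t -[1+ K ])))

  delta-out : ∀ m t (Y : ℕ → RatFun) → m ℕ.≤ t → sum {m} (λ i → const ⟦ t ℕ.≟ toℕ i ⟧ F.* Y (toℕ i)) ≃ const 0ℤ
  delta-out zero    t Y m≤t = F.refl
  delta-out (suc m) t Y m<t = F.trans (F.sum-snoc m (λ i → const ⟦ t ℕ.≟ i ⟧ F.* Y i)) (F.trans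
    (F.+-cong (delta-out m t Y (ℕ.<⇒≤ m<t))
      (F.trans (F.*-congʳ {Y m} (F.reflexive (≡.cong const (⟦⟧-false (t ℕ.≟ m) (ℕ.>⇒≢ m<t))))) (0≃ (Y m))))
    (F.+-identityˡ (const 0ℤ)))

  delta-in : ∀ m t (Y : ℕ → RatFun) → t ℕ.< m → sum {m} (λ i → const ⟦ t ℕ.≟ toℕ i ⟧ F.* Y (toℕ i)) ≃ Y t
  delta-in (suc m) t Y (s≤s t≤m) with t ℕ.≟ m
  ... | yes ≡.refl = F.trans (F.sum-snoc m (λ i → const ⟦ t ℕ.≟ i ⟧ F.* Y i)) (F.trans
    (F.+-cong (delta-out m t Y ℕ.≤-refl)
      (F.trans (F.*-congʳ {Y m} (F.reflexive (≡.cong const (⟦⟧-true (t ℕ.≟ m) ≡.refl)))) (1≃ (Y m))))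
    (F.+-identityˡ (Y t)))
  ... | no  t≢m = F.trans (F.sum-snoc m (λ i → const ⟦ t ℕ.≟ i ⟧ F.* Y i)) (F.trans
    (F.+-cong (delta-in m t Y (ℕ.≤∧≢⇒< t≤m t≢m))
      (F.trans (F.*-congʳ {Y m} (F.reflexive (≡.cong const (⟦⟧-false (t ℕ.≟ m) t≢m)))) (0≃ (Y m))))
    (F.+-identityʳ (Y t)))

  extend : Series → ℤ → RatFun
  extend f (+ n)    = f n
  extend f -[1+ _ ] = const 0ℤ

  θ-enlarge : ∀ n t → t ℕ.≤ n → θ t ≃ ΣF± (suc n) (thetaCoefficient t)
  θ-enlarge n t t≤n = F.sym (F.ΣF.enlarge {suc t} {suc n} {thetaCoefficient t} supports (s≤s t≤n))
    where
    supports : F.ΣF.Supp (suc t) (thetaCoefficient t)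
    supports s t<s = F.trans (F.*-congʳ {const (sgn s) F.* Z^ s} (F.reflexive (≡.cong const
      (⟦⟧-false (T s ℕ.≟ t) λ { ≡.refl → ℕ.<⇒≱ t<s (∣s∣≤1+T s) })))) (0≃ (const (sgn s) F.* Z^ s))

  -- After the sums are exchanged, the bracket in `thetaCoefficient` selects t = T s. For T s > n it
  -- selects nothing, and `extend` supplies the matching 0.
  θ-* : ∀ f n → (θ * f) n ≃ ΣF± (suc n) (λ s → const (sgn s) F.* (Z^ s F.* extend f (+ n ℤ.- + T s)))
  θ-* f n = begin
    sum {suc n} (λ t → θ (toℕ t) F.* f (n ∸ toℕ t))
      ≈⟨ sum-cong-≋ {suc n} (λ t → F.trans
           (F.*-congʳ {f (n ∸ toℕ t)} (θ-enlarge n (toℕ t) (ℕ.≤-pred (Fin.toℕ<n t))))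
           (F.trans (F.*-comm _ (f (n ∸ toℕ t))) (F.sym (F.ΣF.Σ±-scale (suc n) (f (n ∸ toℕ t)) (thetaCoefficient (toℕ t)))))) ⟩
    sum {suc n} (λ t → ΣF± (suc n) (λ s → f (n ∸ toℕ t) F.* thetaCoefficient (toℕ t) s))
      ≈⟨ sum-Σ± (suc n) (suc n) (λ t s → f (n ∸ toℕ t) F.* thetaCoefficient (toℕ t) s) ⟩
    ΣF± (suc n) (λ s → sum {suc n} (λ t → f (n ∸ toℕ t) F.* thetaCoefficient (toℕ t) s))
      ≈⟨ F.ΣF.Σ±-cong (suc n) (λ s → F.trans
           (sum-cong-≋ {suc n} (λ t → rearrange (f (n ∸ toℕ t)) (const ⟦ T s ℕ.≟ toℕ t ⟧) (const (sgn s)) (Z^ s))) (select s)) ⟩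
    ΣF± (suc n) (λ s → const (sgn s) F.* (Z^ s F.* extend f (+ n ℤ.- + T s))) ∎
    where
    open SetoidReasoning F.setoid
    rearrange : ∀ y d c w → y F.* (d F.* (c F.* w)) ≃ d F.* (c F.* (w F.* y))
    rearrange = solve-∀ RationalFunctionField.almostRing
    select : ∀ s → sum {suc n} (λ t → const ⟦ T s ℕ.≟ toℕ t ⟧ F.* (const (sgn s) F.* (Z^ s F.* f (n ∸ toℕ t))))
      ≃ const (sgn s) F.* (Z^ s F.* extend f (+ n ℤ.- + T s))
    select s with T s ℕ.≤? n
    ... | yes T≤n = F.trans (delta-in (suc n) (T s) (λ t → const (sgn s) F.* (Z^ s F.* f (n ∸ t))) (s≤s T≤n))
      (F.reflexive (≡.cong (λ x → const (sgn s) F.* (Z^ s F.* extend f x)) (≡.sym (+-∸ T≤n))))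
    ... | no  T≰n = F.trans (delta-out (suc n) (T s) (λ t → const (sgn s) F.* (Z^ s F.* f (n ∸ t))) (ℕ.≰⇒> T≰n))
      (F.sym (F.trans (F.*-congˡ {const (sgn s)} (F.trans
        (F.*-congˡ {Z^ s} (F.reflexive (≡.cong (extend f) (proj₂ (negative (ℕ.≰⇒> T≰n)))))) (F.zeroʳ (Z^ s)))) (F.zeroʳ (const (sgn s)))))

  -- `Θ` reads a at n - T s, which may be negative; `Vanishes` makes these entries agree with
  -- `extend f`.
  array-Θ : ∀ {a} f → Vanishes a → HasArray a f → HasArray (Θ a) (θ * f)
  array-Θ {a} f van p = array-≃ (λ n → F.sym (θ-* f n)) (mk λ n →
    F.coefficients-Σ± (suc n) {λ s k → thetaTerm a k (+ n) s} {λ s → const (sgn s) F.* (Z^ s F.* extend f (+ n ℤ.- + T s))}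
      λ s → F.coefficients-scale {λ k → a (k ℤ.- s) (+ n ℤ.- + T s)} (sgn s)
        (F.coefficients-shift {λ k → a k (+ n ℤ.- + T s)} s (extended (+ n ℤ.- + T s))))
    where
    extended : ∀ m → HasCoefficients (λ k → a k m) (extend f m)
    extended (+ n)    = coefficients p n
    extended -[1+ j ] = F.coefficients-cong (λ k → ≡.sym (vanish van k j)) F.coefficients-0

-- Euler's product for the partition function

module EulerProduct where
  open SeriesRing
  private module F = Laurent
  open F using (const; _≃_)
  open Arrays using (extend)
  open Weights using (S-suc; S-stable)
  open Theta using (negative)
  open RankCounts using (pTotal)
  open SemiringSum F.semiring using (sum-cong-≋)
  open SetoidReasoning setoid

  q-* : ∀ f n → (q * f) n ≃ extend f (+ n ℤ.- 1ℤ)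
  q-* f zero    = F.trans (⊛-zero q f) (F.zeroˡ (f 0))
  q-* f (suc n) = F.trans (F.+-cong {const 0ℤ F.* f (suc n)} (F.zeroˡ (f (suc n)))
      (F.trans (⊛-cong {tail q} {𝟏} {f} {f} (λ { zero → F.refl ; (suc n) → F.refl }) (λ _ → F.refl) n) (at (*-identityˡ f) n)))
    (F.+-identityˡ (f n))

  q^-* : ∀ k f n → (q ^ k * f) n ≃ extend f (+ n ℤ.- + k)
  q^-* zero    f n = F.trans (at (*-identityˡ f) n) (F.reflexive (≡.cong (extend f) (≡.sym (ℤ.+-identityʳ (+ n)))))
  q^-* (suc k) f n = F.trans (at (*-assoc q (q ^ k) f) n) (F.trans (q-* (q ^ k * f) n) (shifted n))
    where
    shifted : ∀ n → extend (q ^ k * f) (+ n ℤ.- 1ℤ) ≃ extend f (+ n ℤ.- + suc k)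
    shifted zero    = F.refl
    shifted (suc n) = F.trans (q^-* k f n) (F.reflexive (≡.cong (extend f) (cancel (+ n) (+ k))))
      where
      cancel : ∀ n k → n ℤ.- k ≡ 1ℤ ℤ.+ n ℤ.- (1ℤ ℤ.+ k)
      cancel = solveℤ

  -- The series 1 / (q)ₖ.
  bounded : ℕ → Series
  bounded k = embed λ n → CrankCounts.p (+ k) (+ n)

  all : Series
  all = embed λ n → pTotal (+ n)

  extend-bounded : ∀ k m → extend (bounded k) m ≡ const (CrankCounts.p (+ k) m)
  extend-bounded k (+ m)    = ≡.refl
  extend-bounded k -[1+ m ] = ≡.refl

  bounded-suc : ∀ k → (𝟏 - q ^ suc k) * bounded (suc k) ≋ bounded k
  bounded-suc k = begin
    (𝟏 - q ^ suc k) * bounded (suc k)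
      ≈⟨ 1-z-* (q ^ suc k) (bounded (suc k)) ⟩
    bounded (suc k) - q ^ suc k * bounded (suc k)
      ≈⟨ +-congʳ { - (q ^ suc k * bounded (suc k))} recurrence ⟩
    bounded k + q ^ suc k * bounded (suc k) - q ^ suc k * bounded (suc k)
      ≈⟨ +-assoc (bounded k) (q ^ suc k * bounded (suc k)) (- (q ^ suc k * bounded (suc k))) ⟩
    bounded k + (q ^ suc k * bounded (suc k) - q ^ suc k * bounded (suc k))
      ≈⟨ +-congˡ {bounded k} (-‿inverseʳ (q ^ suc k * bounded (suc k))) ⟩
    bounded k + 𝟎
      ≈⟨ +-identityʳ (bounded k) ⟩
    bounded k ∎
    where
    open CommutativeRing ring using (+-assoc)
    recurrence : bounded (suc k) ≋ bounded k + q ^ suc k * bounded (suc k)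
    recurrence = mk λ n → F.trans (F.reflexive (≡.cong const (S-suc k (+ n) (λ _ → 1ℤ))))
      (F.trans (F.const-+ (CrankCounts.p (+ k) (+ n)) (CrankCounts.p (+ suc k) (+ n ℤ.- + suc k)))
        (F.+-congˡ {bounded k n} (F.sym (F.trans (q^-* (suc k) (bounded (suc k)) n) (F.reflexive (extend-bounded (suc k) (+ n ℤ.- + suc k)))))))

  factors : ℕ → Series
  factors n = product {n} λ i → 𝟏 - q ^ suc (toℕ i)

  product-snoc : ∀ n (f : ℕ → Series) → product {suc n} (f ∘ toℕ) ≋ product {n} (f ∘ toℕ) * f n
  product-snoc zero    f = trans (*-identityʳ (f 0)) (sym (*-identityˡ (f 0)))
  product-snoc (suc n) f = trans (*-congˡ {f 0} (product-snoc n (f ∘ suc))) (sym (*-assoc (f 0) (product {n} (f ∘ suc ∘ toℕ)) (f (suc n))))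

  factors-suc : ∀ n → factors (suc n) ≋ factors n * (𝟏 - q ^ suc n)
  factors-suc n = product-snoc n (λ i → 𝟏 - q ^ suc i)

  factors-bounded : ∀ n → factors n * bounded n ≋ 𝟏
  factors-bounded zero    = trans (*-identityˡ (bounded 0)) (mk λ { zero → F.refl ; (suc n) → F.refl })
  factors-bounded (suc n) = begin
    factors (suc n) * bounded (suc n)                    ≈⟨ *-congʳ {bounded (suc n)} (factors-suc n) ⟩
    factors n * (𝟏 - q ^ suc n) * bounded (suc n)        ≈⟨ *-assoc (factors n) (𝟏 - q ^ suc n) (bounded (suc n)) ⟩
    factors n * ((𝟏 - q ^ suc n) * bounded (suc n))      ≈⟨ *-congˡ {factors n} (bounded-suc n) ⟩
    factors n * bounded n                                ≈⟨ factors-bounded n ⟩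
    𝟏                                                    ∎

  -- A further factor 1 - q^(m+1) with m ≥ i changes only coefficients beyond qⁱ.
  factors-stable : ∀ d i → factors (d ℕ.+ i) i ≃ factors i i
  factors-stable zero    i = F.refl
  factors-stable (suc d) i = F.trans (F.trans (at (factors-suc (d ℕ.+ i)) i) (truncate (d ℕ.+ i) (ℕ.m≤n+m i d))) (factors-stable d i)
    where
    truncate : ∀ m → i ℕ.≤ m → (factors m * (𝟏 - q ^ suc m)) i ≃ factors m i
    truncate m i≤m = F.trans (at (trans (*-comm (factors m) (𝟏 - q ^ suc m)) (1-z-* (q ^ suc m) (factors m))) i)
      (F.trans (F.+-congˡ {factors m i} (F.trans (F.-‿cong (F.trans (q^-* (suc m) (factors m) i)
        (F.reflexive (≡.cong (extend (factors m)) (proj₂ (negative (s≤s i≤m))))))) F.refl)) (F.+-identityʳ (factors m i)))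

  -- The coefficient of qⁿ involves only degrees ≤ n, where both series agree with their truncations
  -- at n, and these are inverse to each other.
  all*[q]∞ : all * [q]∞ ≋ 𝟏
  all*[q]∞ = trans (*-comm all [q]∞) (mk λ n → F.trans
    (sum-cong-≋ {suc n} λ i → F.*-cong (stable n (toℕ i) (ℕ.≤-pred (Fin.toℕ<n i))) (F.reflexive (total n (n ∸ toℕ i) (ℕ.m∸n≤m n (toℕ i)))))
    (at (factors-bounded n) n))
    where
    stable : ∀ n i → i ℕ.≤ n → [q]∞ i ≃ factors n i
    stable n i i≤n = F.sym (≡.subst (λ m → factors m i ≃ factors i i) (ℕ.m∸n+n≡m i≤n) (factors-stable (n ∸ i) i))
    total : ∀ n m → m ℕ.≤ n → all m ≡ bounded n m
    total n m m≤n = ≡.cong const (≡.sym (≡.trans (≡.cong (λ k → CrankCounts.p (+ k) (+ m)) (≡.sym (ℕ.m∸n+n≡m m≤n))) (S-stable m (n ∸ m) (λ _ → 1ℤ))))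

-- From the theta identities to the rank-crank identity

module RankCrank where
  open SeriesRing
  private module F = Laurent
  open F using (const; _≃_; θZ)
  open Arrays
  open EulerProduct using (all; all*[q]∞)
  open Theta using (Array; Vanishes; vanish; ∇; Θ; heat; Θ-crank; Θ³-rank; Θ-vanishes; ∇-vanishes; ∇-Θ; Θ-cong)
  open RankCounts using (L; L-vanishes; ∇L≡N; heat-recurrence; L-high; L-low; pTotal)
  open CrankCounts using (W; W-vanishes; W-recurrence; W-high; W-low)
  open CrankStatistics using (∇W≡M)
  open Σℤ using (Σ±)
  open PolynomialRing.ℤ[[z]] using (_⊛_)

  -- The boundary behaviour shared by L and W: it bounds the support of ∇ a and evaluates
  -- telescoping sums.
  record Cumulative (a : Array) : Set where
    field
      high : ∀ n k → n ℕ.≤ k → a (+ k) (+ n) ≡ pTotal (+ n)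
      low  : ∀ n k → n ℕ.≤ k → a -[1+ k ] (+ n) ≡ 0ℤ

    low′ : ∀ n k → n ℕ.≤ k → a (-[1+ k ] ℤ.- 1ℤ) (+ n) ≡ 0ℤ
    -- The index `-[1+ k ] - 1ℤ` reduces to one with k + 0 in place of k.
    low′ n k n≤k = low n (suc (k ℕ.+ 0)) (ℕ.m≤n⇒m≤1+n (ℕ.≤-trans n≤k (ℕ.m≤m+n k 0)))

    low″ : ∀ n k → n ℕ.≤ k → a (-[1+ k ] ℤ.- 1ℤ ℤ.- 1ℤ) (+ n) ≡ 0ℤ
    low″ n k n≤k = low′ n (suc (k ℕ.+ 0)) (ℕ.m≤n⇒m≤1+n (ℕ.≤-trans n≤k (ℕ.m≤m+n k 0)))

    ∇-support : ∀ n k → n ℕ.< ∣ k ∣ → ∇ a k (+ n) ≡ 0ℤ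
    ∇-support n (+ suc k) (s≤s n≤k) = ≡.trans (≡.cong₂ ℤ._-_ (high n (suc k) (ℕ.m≤n⇒m≤1+n n≤k)) (high n k n≤k)) (ℤ.+-inverseʳ (pTotal (+ n)))
    ∇-support n -[1+ k ]  (s≤s n≤k) = ≡.cong₂ ℤ._-_ (low n k n≤k) (low′ n k n≤k)

  open Cumulative

  L-cumulative : Cumulative L
  L-cumulative = record { high = L-high ; low = L-low }

  W-cumulative : Cumulative W
  W-cumulative = record { high = W-high ; low = W-low }

  telescope : ∀ K (f : ℤ → ℤ) → Σ± K (λ k → f k ℤ.- f (k ℤ.- 1ℤ)) ≡ f (+ K) ℤ.- f -[1+ K ]
  telescope zero    f = ≡.refl
  telescope (suc K) f = ≡.trans
    (≡.cong₂ (λ x y → x ℤ.+ (f (+ suc K) ℤ.- f (+ K) ℤ.+ (f -[1+ K ] ℤ.- f y))) (telescope K f) (≡.cong (λ m → -[1+ suc m ]) (ℕ.+-identityʳ K)))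
    (cancel (f (+ K)) (f -[1+ K ]) (f (+ suc K)) (f -[1+ suc K ]))
    where
    cancel : ∀ a b c d → a ℤ.- b ℤ.+ (c ℤ.- a ℤ.+ (b ℤ.- d)) ≡ c ℤ.- d
    cancel = solveℤ

  laurent-array : ∀ {a} (m : ℤ → ℕ → ℤ) → Cumulative a → (∀ k n → ∇ a k (+ n) ≡ m k n) → HasArray (∇ a) (λ n → laurent (λ k → m k n) n)
  laurent-array m cum ∇a≡m = mk λ n → F.coefficients-cong (λ k → ≡.sym (∇a≡m k n))
    (F.laurent-coefficients (λ k → m k n) n λ k n<k → ≡.trans (≡.sym (∇a≡m k n)) (∇-support cum n k n<k))

  R-array : HasArray (∇ L) R
  R-array = laurent-array N L-cumulative ∇L≡N

  C-array : HasArray (∇ W) C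
  C-array = laurent-array M W-cumulative ∇W≡M

  atOne : ∀ {a} (f : Series) (e : ℕ → ℤ) → HasArray a f → (∀ n K → 2 ℕ.+ n ℕ.≤ K → Σ± K (λ k → a k (+ n)) ≡ e n) → f AtOne e
  atOne {a} f e p total n = Evaluation.at1-coefficients {λ k → a k (+ n)} (coefficients p n) (2 ℕ.+ n) (total n)

  C-atOne : C AtOne λ n → pTotal (+ n)
  C-atOne = atOne C (λ n → pTotal (+ n)) C-array λ n K n<K → ≡.trans (telescope K (λ k → W k (+ n)))
    (≡.trans (≡.cong₂ ℤ._-_ (W-high n K (ℕ.m+n≤o⇒n≤o 2 n<K)) (W-low n K (ℕ.m+n≤o⇒n≤o 2 n<K))) (ℤ.+-identityʳ _))

  h : Array
  h k n = heat k n ℤ.* L k n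

  h-vanishes : Vanishes h
  h-vanishes = Theta.mk λ k j → *-annihilʳ (heat k -[1+ j ]) (vanish L-vanishes k j)

  -- Twice the right-hand side of the second identity.
  G : Series
  G = ι (+ 6) * ((𝟏 - z) * ((𝟏 - z) * δq R)) + (𝟏 - z) * ((𝟏 - z) * δz (δz R)) + (- (z * (z * δz R)) + δz R) + ι (+ 2) * (z * R)

  -- ∇³ h stands for (1 - z)³ times twice the operator on R*. Moving 1 - z through δz gives the
  -- coefficients in G; on arrays this is a polynomial identity in four neighbouring values of L.
  G-array : HasArray (∇ (∇ (∇ h))) G
  G-array = array-cong (λ k n → identity k n (L k n) (L (k ℤ.- 1ℤ) n) (L (k ℤ.- 1ℤ ℤ.- 1ℤ) n) (L (k ℤ.- 1ℤ ℤ.- 1ℤ ℤ.- 1ℤ) n))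
    (array-+ (ι (+ 6) * ((𝟏 - z) * ((𝟏 - z) * δq R)) + (𝟏 - z) * ((𝟏 - z) * δz (δz R)) + (- (z * (z * δz R)) + δz R)) (ι (+ 2) * (z * R))
      (array-+ (ι (+ 6) * ((𝟏 - z) * ((𝟏 - z) * δq R)) + (𝟏 - z) * ((𝟏 - z) * δz (δz R))) (- (z * (z * δz R)) + δz R)
        (array-+ (ι (+ 6) * ((𝟏 - z) * ((𝟏 - z) * δq R))) ((𝟏 - z) * ((𝟏 - z) * δz (δz R)))
          (array-constant (+ 6) ((𝟏 - z) * ((𝟏 - z) * δq R)) (array-∇ ((𝟏 - z) * δq R) (array-∇ (δq R) (array-δq R R-array))))
          (array-∇ ((𝟏 - z) * δz (δz R)) (array-∇ (δz (δz R)) (array-δz (δz R) (array-δz R R-array)))))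
        (array-+ (- (z * (z * δz R))) (δz R)
          (array-neg (z * (z * δz R)) (array-z (z * δz R) (array-z (δz R) (array-δz R R-array))))
          (array-δz R R-array)))
      (array-constant (+ 2) (z * R) (array-z R R-array)))
    where
    identity : ∀ k n w x y v →
      + 6 ℤ.* ((n ℤ.* (w ℤ.- x) ℤ.- n ℤ.* (x ℤ.- y)) ℤ.- (n ℤ.* (x ℤ.- y) ℤ.- n ℤ.* (y ℤ.- v)))
      ℤ.+ ((k ℤ.* (k ℤ.* (w ℤ.- x)) ℤ.- (k ℤ.- 1ℤ) ℤ.* ((k ℤ.- 1ℤ) ℤ.* (x ℤ.- y)))
        ℤ.- ((k ℤ.- 1ℤ) ℤ.* ((k ℤ.- 1ℤ) ℤ.* (x ℤ.- y)) ℤ.- (k ℤ.- 1ℤ ℤ.- 1ℤ) ℤ.* ((k ℤ.- 1ℤ ℤ.- 1ℤ) ℤ.* (y ℤ.- v))))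
      ℤ.+ (ℤ.- ((k ℤ.- 1ℤ ℤ.- 1ℤ) ℤ.* (y ℤ.- v)) ℤ.+ k ℤ.* (w ℤ.- x))
      ℤ.+ + 2 ℤ.* (x ℤ.- y)
      ≡ (((+ 6 ℤ.* n ℤ.+ k ℤ.* k ℤ.+ k) ℤ.* w ℤ.- (+ 6 ℤ.* n ℤ.+ (k ℤ.- 1ℤ) ℤ.* (k ℤ.- 1ℤ) ℤ.+ (k ℤ.- 1ℤ)) ℤ.* x)
          ℤ.- ((+ 6 ℤ.* n ℤ.+ (k ℤ.- 1ℤ) ℤ.* (k ℤ.- 1ℤ) ℤ.+ (k ℤ.- 1ℤ)) ℤ.* x ℤ.- (+ 6 ℤ.* n ℤ.+ (k ℤ.- 1ℤ ℤ.- 1ℤ) ℤ.* (k ℤ.- 1ℤ ℤ.- 1ℤ) ℤ.+ (k ℤ.- 1ℤ ℤ.- 1ℤ)) ℤ.* y))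
        ℤ.- (((+ 6 ℤ.* n ℤ.+ (k ℤ.- 1ℤ) ℤ.* (k ℤ.- 1ℤ) ℤ.+ (k ℤ.- 1ℤ)) ℤ.* x ℤ.- (+ 6 ℤ.* n ℤ.+ (k ℤ.- 1ℤ ℤ.- 1ℤ) ℤ.* (k ℤ.- 1ℤ ℤ.- 1ℤ) ℤ.+ (k ℤ.- 1ℤ ℤ.- 1ℤ)) ℤ.* y)
          ℤ.- ((+ 6 ℤ.* n ℤ.+ (k ℤ.- 1ℤ ℤ.- 1ℤ) ℤ.* (k ℤ.- 1ℤ ℤ.- 1ℤ) ℤ.+ (k ℤ.- 1ℤ ℤ.- 1ℤ)) ℤ.* y
            ℤ.- (+ 6 ℤ.* n ℤ.+ (k ℤ.- 1ℤ ℤ.- 1ℤ ℤ.- 1ℤ) ℤ.* (k ℤ.- 1ℤ ℤ.- 1ℤ ℤ.- 1ℤ) ℤ.+ (k ℤ.- 1ℤ ℤ.- 1ℤ ℤ.- 1ℤ)) ℤ.* v))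
    identity = solveℤ

  twice : ℕ → ℤ
  twice n = + 2 ℤ.* pTotal (+ n)

  -- The sum of ∇³ h telescopes to ∇² h at the top of the window minus 0 at the bottom. At the top L
  -- is constantly p(n), and the second difference of `heat` is 2.
  G-atOne : G AtOne twice
  G-atOne = atOne G twice G-array total
    where
    secondDifference : ∀ n k x → let heat = λ k → + 6 ℤ.* n ℤ.+ k ℤ.* k ℤ.+ k in
      (heat (1ℤ ℤ.+ (1ℤ ℤ.+ k)) ℤ.* x ℤ.- heat (1ℤ ℤ.+ k) ℤ.* x) ℤ.- (heat (1ℤ ℤ.+ k) ℤ.* x ℤ.- heat k ℤ.* x) ℤ.- 0ℤ ≡ + 2 ℤ.* x
    secondDifference = solveℤ
    total : ∀ n K → 2 ℕ.+ n ℕ.≤ K → Σ± K (λ k → ∇ (∇ (∇ h)) k (+ n)) ≡ twice n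
    -- The second difference at K + 2 also uses L at K + 1 and K, so K itself must be at least n.
    total n (suc (suc K)) (s≤s (s≤s n≤K)) = ≡.trans (telescope (suc (suc K)) (λ k → ∇ (∇ h) k (+ n)))
      (≡.trans (≡.cong₂ ℤ._-_ top bottom) (secondDifference (+ n) (+ K) (pTotal (+ n))))
      where
      top : ∇ (∇ h) (+ suc (suc K)) (+ n) ≡
        (heat (+ suc (suc K)) (+ n) ℤ.* pTotal (+ n) ℤ.- heat (+ suc K) (+ n) ℤ.* pTotal (+ n))
          ℤ.- (heat (+ suc K) (+ n) ℤ.* pTotal (+ n) ℤ.- heat (+ K) (+ n) ℤ.* pTotal (+ n))
      top = ≡.cong₂ ℤ._-_
        (≡.cong₂ (λ x y → heat (+ suc (suc K)) (+ n) ℤ.* x ℤ.- heat (+ suc K) (+ n) ℤ.* y)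
          (L-high n (suc (suc K)) (ℕ.m≤n⇒m≤1+n (ℕ.m≤n⇒m≤1+n n≤K))) (L-high n (suc K) (ℕ.m≤n⇒m≤1+n n≤K)))
        (≡.cong₂ (λ x y → heat (+ suc K) (+ n) ℤ.* x ℤ.- heat (+ K) (+ n) ℤ.* y) (L-high n (suc K) (ℕ.m≤n⇒m≤1+n n≤K)) (L-high n K n≤K))
      zero-h : ∀ k → L k (+ n) ≡ 0ℤ → h k (+ n) ≡ 0ℤ
      zero-h k L≡0 = *-annihilʳ (heat k (+ n)) L≡0
      K′ : ℤ
      K′ = -[1+ suc (suc K) ]
      n≤ : n ℕ.≤ suc (suc K)
      n≤ = ℕ.m≤n⇒m≤1+n (ℕ.m≤n⇒m≤1+n n≤K)
      bottom : ∇ (∇ h) K′ (+ n) ≡ 0ℤ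
      bottom = ≡.cong₂ ℤ._-_
        (≡.cong₂ ℤ._-_ (zero-h K′ (low L-cumulative n (suc (suc K)) n≤)) (zero-h (K′ ℤ.- 1ℤ) (low′ L-cumulative n (suc (suc K)) n≤)))
        (≡.cong₂ ℤ._-_ (zero-h (K′ ℤ.- 1ℤ) (low′ L-cumulative n (suc (suc K)) n≤)) (zero-h (K′ ℤ.- 1ℤ ℤ.- 1ℤ) (low″ L-cumulative n (suc (suc K)) n≤)))

  pTotal-negative : ∀ j → pTotal -[1+ j ] ≡ 0ℤ
  pTotal-negative j = ≡.refl

  Q : Series
  Q = embed λ n → Θ W 0ℤ (+ n)

  -- The array of θ C is Θ ∇ W = ∇ Θ W, and by `Θ-crank` Θ W is supported at k = 0, so it represents
  -- a series of its own.
  θ*C : θ * C ≋ (𝟏 - z) * Q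
  θ*C = array-unique (array-Θ C (∇-vanishes W-vanishes) C-array)
    (array-cong (λ k n → ∇-Θ W k n) (array-∇ Q (array-embed {Θ W} λ k n → Θ-crank W-vanishes pTotal-negative W-recurrence k n)))

  F₁ : Series
  F₁ = embed λ n → Θ (Θ (Θ h)) 1ℤ (+ n)

  -- Θ³ h is concentrated at k = 1 and represents z F₁; its three differences are the three factors
  -- 1 - z.
  θ³*G : θ * (θ * (θ * G)) ≋ (𝟏 - z) * ((𝟏 - z) * ((𝟏 - z) * (z * F₁)))
  θ³*G = array-unique
    (array-Θ (θ * (θ * G)) (Θ-vanishes (Θ-vanishes ∇³h-vanishes)) (array-Θ (θ * G) (Θ-vanishes ∇³h-vanishes) (array-Θ G ∇³h-vanishes G-array)))
    (array-cong commute (array-∇ ((𝟏 - z) * ((𝟏 - z) * (z * F₁))) (array-∇ ((𝟏 - z) * (z * F₁)) (array-∇ (z * F₁)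
      (array-z-embed {Θ (Θ (Θ h))} λ k n → Θ³-rank L-vanishes pTotal-negative heat-recurrence k n)))))
    where
    ∇³h-vanishes : Vanishes (∇ (∇ (∇ h)))
    ∇³h-vanishes = ∇-vanishes (∇-vanishes (∇-vanishes h-vanishes))
    ∇-cong : ∀ {f g} → (∀ k n → f k n ≡ g k n) → ∀ k n → ∇ f k n ≡ ∇ g k n
    ∇-cong p k n = ≡.cong₂ ℤ._-_ (p k n) (p (k ℤ.- 1ℤ) n)
    ∇-Θ³ : ∀ f k n → ∇ (Θ (Θ (Θ f))) k n ≡ Θ (Θ (Θ (∇ f))) k n
    ∇-Θ³ f k n = ≡.trans (∇-Θ (Θ (Θ f)) k n) (Θ-cong {∇ (Θ (Θ f))} {Θ (Θ (∇ f))}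
      (λ k n → ≡.trans (∇-Θ (Θ f) k n) (Θ-cong {∇ (Θ f)} {Θ (∇ f)} (∇-Θ f) k n)) k n)
    commute : ∀ k n → ∇ (∇ (∇ (Θ (Θ (Θ h))))) k n ≡ Θ (Θ (Θ (∇ (∇ (∇ h))))) k n
    commute k n = ≡.trans (∇-cong {∇ (∇ (Θ (Θ (Θ h))))} {∇ (Θ (Θ (Θ (∇ h))))} (∇-cong {∇ (Θ (Θ (Θ h)))} {Θ (Θ (Θ (∇ h)))} (∇-Θ³ h)) k n)
      (≡.trans (∇-cong {∇ (Θ (Θ (Θ (∇ h))))} {Θ (Θ (Θ (∇ (∇ h))))} (∇-Θ³ (∇ h)) k n) (∇-Θ³ (∇ (∇ h)) k n))

  Q-constant : Q 0 ≃ const 1ℤ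
  Q-constant = F.reflexive (≡.cong const value)
    where
    value : Θ W 0ℤ 0ℤ ≡ 1ℤ
    -- T s = 0 only for s = 0 and s = 1, so the constant term of Q is W(0,0) - W(-1,0).
    value = ≡.cong₂ (λ x y → 1ℤ ℤ.* x ℤ.+ (ℤ.-1ℤ ℤ.* y ℤ.+ 0ℤ)) (W-high 0 0 z≤n) (W-low 0 0 z≤n)

  u : Series
  u = constant RationalFunction.[1-Z]⁻¹

  u*c : u * (𝟏 - z) ≋ ι (+ 1)
  u*c = trans (*-congˡ {u} c≋) (trans (sym (constant-* RationalFunction.[1-Z]⁻¹ (const 1ℤ F.+ F.- F.Z))) (constant-≋ inverse))
    where
    c≋ : 𝟏 - z ≋ constant (const 1ℤ F.+ F.- F.Z)
    c≋ = sym (trans (constant-+ (const 1ℤ) (F.- F.Z)) (+-congˡ {𝟏} (constant-neg F.Z)))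
    inverse : RationalFunction.[1-Z]⁻¹ F.* (const 1ℤ F.+ F.- F.Z) ≃ const 1ℤ
    inverse = F.*≡* λ { 0 → ≡.refl ; 1 → ≡.refl ; 2 → ≡.refl ; 3 → ≡.refl ; (suc (suc (suc (suc k)))) → ≡.refl }

  ½*2 : ½ * ι (+ 2) ≋ ι (+ 1)
  ½*2 = trans (sym (constant-* RationalFunction.half (const (+ 2)))) (constant-≋ (F.*≡* λ { 0 → ≡.refl ; 1 → ≡.refl ; (suc (suc k)) → ≡.refl }))

  Q³*G : Q * (Q * (Q * G)) ≋ (z * F₁) * (C * (C * C))
  Q³*G = atSeries RingIdentities.clear-poles {θ} {C} {𝟏 - z} {Q} {G} {z * F₁} {u} θ*C θ³*G u*c

  -- `Q³*G` at z = 1: G becomes 2P and C becomes P, while Q and F₁ are free of z. The resulting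
  -- equality of integer sequences is read back as one of series.
  Q³*2P : Q * (Q * (Q * (ι (+ 2) * all))) ≋ F₁ * (all * (all * all))
  Q³*2P = trans (sym left) (trans (atOne-unique (trans Q³*G (*-assoc z F₁ (C * (C * C))))
      (atOne-* Q (Q * (Q * G)) (atOne-embed Qₙ) (atOne-* Q (Q * G) (atOne-embed Qₙ) (atOne-* Q G (atOne-embed Qₙ) G-atOne)))
      (atOne-z (F₁ * (C * (C * C))) (atOne-* F₁ (C * (C * C)) (atOne-embed Fₙ) (atOne-* C (C * C) C-atOne (atOne-* C C C-atOne C-atOne)))))
    right)
    where
    Qₙ Fₙ Pₙ : ℕ → ℤ
    Qₙ n = Θ W 0ℤ (+ n)
    Fₙ n = Θ (Θ (Θ h)) 1ℤ (+ n)
    Pₙ n = pTotal (+ n)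
    double : embed twice ≋ ι (+ 2) * all
    double = mk λ n → F.trans (F.const-* (+ 2) (Pₙ n)) (F.sym (constant-⊛ (const (+ 2)) all n))
    left : embed (Qₙ ⊛ (Qₙ ⊛ (Qₙ ⊛ twice))) ≋ Q * (Q * (Q * (ι (+ 2) * all)))
    left = trans (embed-* Qₙ (Qₙ ⊛ (Qₙ ⊛ twice))) (*-congˡ {Q} (trans (embed-* Qₙ (Qₙ ⊛ twice)) (*-congˡ {Q} (trans (embed-* Qₙ twice) (*-congˡ {Q} double)))))
    right : embed (Fₙ ⊛ (Pₙ ⊛ (Pₙ ⊛ Pₙ))) ≋ F₁ * (all * (all * all))
    right = trans (embed-* Fₙ (Pₙ ⊛ (Pₙ ⊛ Pₙ))) (*-congˡ {F₁} (trans (embed-* Pₙ (Pₙ ⊛ Pₙ)) (*-congˡ {all} (embed-* Pₙ Pₙ))))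

  crank-rank : z * [q]∞ ^ 2 * C ^ 3 ≋ 𝟑 * (𝟏 - z) ^ 2 * δq R + ½ * (𝟏 - z) ^ 2 * δz (δz R) - ½ * (z ^ 2 - 𝟏) * δz R + z * R
  crank-rank = trans (atSeries RingIdentities.powers z [q]∞ C) (atSeries RingIdentities.halve {½} {z} {𝟏 - z} {R} {δz R} {δz (δz R)} {δq R} {z * ([q]∞ * [q]∞) * (C * (C * C))} ½*2
    (atSeries RingIdentities.eliminate {z} {F₁} {C} {Q} {G} {all} {[q]∞} (λ {x} {y} → cancelˡ Q Q-constant {x} {y}) all*[q]∞ Q³*G Q³*2P))

  -- The product rule with δz (1 - z) = -z.
  δz-c* : ∀ f → δz ((𝟏 - z) * f) ≋ (𝟏 - z) * δz f - z * f
  δz-c* f = mk λ n → F.trans (θZ-at n) (F.trans (regroup (θZ (f n)) (F.Z F.* f n) (F.Z F.* θZ (f n))) (F.sym (rhs n)))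
    where
    split : ∀ n → ((𝟏 - z) * f) n ≃ f n F.+ F.- (F.Z F.* f n)
    split n = F.trans (at (1-z-* z f) n) (F.+-congˡ {f n} (F.-‿cong (constant-⊛ F.Z f n)))
    θZ-at : ∀ n → θZ (((𝟏 - z) * f) n) ≃ θZ (f n) F.+ F.- (F.Z F.* f n F.+ F.Z F.* θZ (f n))
    θZ-at n = F.trans (F.θZ-cong (split n)) (F.trans (F.θZ-+ (f n) (F.- (F.Z F.* f n)))
      (F.+-congˡ {θZ (f n)} (F.trans (F.θZ-neg (F.Z F.* f n)) (F.-‿cong (F.trans (F.θZ-* F.Z (f n)) (F.+-congʳ {F.Z F.* θZ (f n)} (F.*-congʳ {f n} F.θZ-Z)))))))
    regroup : ∀ a b d → a F.+ F.- (b F.+ d) ≃ (a F.+ F.- d) F.+ F.- b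
    regroup = solve-∀ RationalFunctionField.almostRing
    rhs : ∀ n → ((𝟏 - z) * δz f - z * f) n ≃ (θZ (f n) F.+ F.- (F.Z F.* θZ (f n))) F.+ F.- (F.Z F.* f n)
    rhs n = F.+-cong {((𝟏 - z) * δz f) n} (F.trans (at (1-z-* z (δz f)) n) (F.+-congˡ {θZ (f n)} (F.-‿cong (constant-⊛ F.Z (δz f) n))))
      (F.-‿cong (constant-⊛ F.Z f n))

  δz-cong : ∀ {f g} → f ≋ g → δz f ≋ δz g
  δz-cong f≋g = mk λ n → F.θZ-cong (at f≋g n)

  δz-z* : ∀ f → δz (z * f) ≋ z * f + z * δz f
  δz-z* f = mk λ n → F.trans (F.θZ-cong (constant-⊛ F.Z f n)) (F.trans (F.θZ-* F.Z (f n))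
    (F.+-cong {θZ F.Z F.* f n} (F.trans (F.*-congʳ {f n} F.θZ-Z) (F.sym (constant-⊛ F.Z f n))) (F.sym (constant-⊛ F.Z (δz f) n))))

  δq-c* : ∀ f → δq ((𝟏 - z) * f) ≋ (𝟏 - z) * δq f
  δq-c* f = mk λ n → F.trans (F.*-congˡ {const (+ n)} (c-at f n)) (F.trans (swap (const (+ n)) (const 1ℤ F.+ F.- F.Z) (f n)) (F.sym (c-at (δq f) n)))
    where
    c-at : ∀ f n → ((𝟏 - z) * f) n ≃ (const 1ℤ F.+ F.- F.Z) F.* f n
    c-at f n = F.trans (at (*-congʳ {f} (sym (trans (constant-+ (const 1ℤ) (F.- F.Z)) (+-congˡ {𝟏} (constant-neg F.Z))))) n)
      (constant-⊛ (const 1ℤ F.+ F.- F.Z) f n)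
    swap : ∀ a b d → a F.* (b F.* d) ≃ b F.* (a F.* d)
    swap = solve-∀ RationalFunctionField.almostRing

  R≋c*R* : R ≋ (𝟏 - z) * R*
  R≋c*R* = sym (trans (sym (*-assoc (𝟏 - z) u R)) (trans (*-congʳ {R} (trans (*-comm (𝟏 - z) u) u*c)) (*-identityˡ R)))

  δzR : δz R ≋ (𝟏 - z) * δz R* - z * R*
  δzR = trans (δz-cong R≋c*R*) (δz-c* R*)

  δzδzR : δz (δz R) ≋ (𝟏 - z) * δz (δz R*) - ι (+ 2) * (z * δz R*) - z * R*
  δzδzR = trans (δz-cong δzR) (trans (mk λ n → F.θZ-+ (((𝟏 - z) * δz R*) n) (F.- (z * R*) n))
    (trans (+-cong {δz ((𝟏 - z) * δz R*)} (δz-c* (δz R*)) (trans negated (-‿cong (δz-z* R*))))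
      (atSeries RingIdentities.second-derivative (𝟏 - z) z (δz R*) (δz (δz R*)) R*)))
    where
    negated : δz (- (z * R*)) ≋ - δz (z * R*)
    negated = mk λ n → F.θZ-neg ((z * R*) n)

  crank-rank* : z * [q]∞ ^ 2 * C* ^ 3 ≋ 𝟑 * δq R* + ½ * δz R* + ½ * δz (δz R*)
  crank-rank* = atSeries RingIdentities.divide {½} {z} {u} {[q]∞} {C} {R} {δz R} {δz (δz R)} {δq R} {R*} {δz R*} {δz (δz R*)} {δq R*} ½*2 u*c
    (trans (mk λ n → F.*-congˡ {const (+ n)} (at R≋c*R* n)) (δq-c* R*)) R≋c*R* δzR δzδzR crank-rank

theorem1p1 : (z * [q]∞ ^ 2 * C* ^ 3
    ≈ 𝟑 * δq R* + ½ * δz R* + ½ * δz (δz R*))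
    ×
    (z * [q]∞ ^ 2 * C ^ 3
    ≈ 𝟑 * (𝟏 - z) ^ 2 * δq R + ½ * (𝟏 - z) ^ 2 * δz (δz R)
    - ½ * (z ^ 2 - 𝟏) * δz R + z * R)
theorem1p1 = SeriesRing.at RankCrank.crank-rank* , SeriesRing.at RankCrank.crank-rank
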